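{- As $n\to\infty$, \[ F(n)\le n^{4/3}\exp\!\left(O\!\left(\frac{\log n}{\log\log n}\right)\right), \] where the implied constant is absolute.
   Context: For an integer $m$ and a positive integer $H$, write $I(m,H):=\{m+1,\dots,m+H\}$. For an integer $n\ge1$, $F(n)$ is the least positive integer $H$ such that, for every $m\in\mathbb Z$, the set $I(m,H)$ contains pairwise distinct integers $a_1,\dots,a_n$ satisfying $i\mid a_i$ for all $1\le i\le n$. The $O$-notation means: there is an absolute constant $C>0$ such that $F(n)\le n^{4/3}\exp(C\log n/\log\log n)$ for all sufficiently large $n$. -}

module Defs where

open import Data.Nat as ℕ using (ℕ; zero; suc; _!; z≤n; s≤s)
import Data.Nat.Properties as ℕ
import Data.Nat.Divisibility as ℕ
open import Data.Integer as ℤ using (ℤ; +_)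
import Data.Integer.Properties as ℤ
import Data.Integer.DivMod as ℤ
open import Data.Integer.Divisibility.Signed as ℤ using (divides)
open import Data.Integer.Tactic.RingSolver using () renaming (solve-∀ to solve-ℤ)
open import Data.Fin as Fin using (Fin; toℕ)
import Data.Fin.Properties as Fin
open import Data.Rational
open import Data.Rational.Properties
import Data.Rational.Unnormalised as ℚᵘ
import Data.Rational.Unnormalised.Properties as ℚᵘ
open import Data.Empty using (⊥-elim)
open import Data.Product using (_×_; _,_; ∃-syntax; proj₁; proj₂)
open import Data.Sum using (_⊎_; inj₁; inj₂; [_,_]′)
open import Function.Definitions using (Injective)
open import Level using (0ℓ)
open import Relation.Binary.Definitions using (tri<; tri≈; tri>)
open import Relation.Binary.PropositionalEquality
open import Relation.Nullary using (Dec; yes; no; ¬_)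
open import Relation.Nullary.Decidable using (map′; _×-dec_; _→-dec_; dec⇒maybe; from-yes)
open import Relation.Unary using (Decidable)
open import Algebra.Bundles using (CommutativeRing)
open import Algebra.Properties.AbelianGroup ℤ.+-0-abelianGroup using (∙-cancelˡ; ∙-cancelʳ)
open import Algebra.Properties.CommutativeSemiring.Exp (CommutativeRing.commutativeSemiring +-*-commutativeRing)
open import Tactic.RingSolver using (solve-∀)
open import Tactic.RingSolver.Core.AlmostCommutativeRing using (AlmostCommutativeRing; fromCommutativeRing)

infix 4 _∈I[_,_]

_∈I[_,_] : ℤ → ℤ → ℕ → Set
a ∈I[ m , H ] = m ℤ.+ + 1 ℤ.≤ a × a ℤ.≤ m ℤ.+ + H

-- i : Fin n stands for the integer suc (toℕ i) ∈ {1, …, n}.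
HasMultiples : ℕ → ℕ → ℤ → Set
HasMultiples n H m = ∃[ a ]
    (∀ (i : Fin n) → a i ∈I[ m , H ])
  × Injective _≡_ _≡_ a
  × (∀ (i : Fin n) → + suc (toℕ i) ℤ.∣ a i)

Admissible : ℕ → ℕ → Set
Admissible n H = ∀ m → HasMultiples n H m

IsLeastPositive : (ℕ → Set) → ℕ → Set
IsLeastPositive P H = 0 ℕ.< H × P H × (∀ H′ → 0 ℕ.< H′ → P H′ → H ℕ.≤ H′)

private
  findLeast : ∀ {P : ℕ → Set} → Decidable P → ∀ b →
    (∃[ k ] P k × (∀ j → P j → k ℕ.≤ j)) ⊎ (∀ j → j ℕ.< b → ¬ P j)
  findLeast P? zero = inj₂ λ _ ()
  findLeast P? (suc b) with findLeast P? b
  ... | inj₁ r = inj₁ r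
  ... | inj₂ none with P? b
  ...   | yes p = inj₁ (b , p , λ j pj → ℕ.≮⇒≥ λ j<b → none j j<b pj)
  ...   | no ¬p = inj₂ λ j j<1+b pj → [ (λ j<b → none j j<b pj) , (λ { refl → ¬p pj }) ]′
                           (ℕ.m≤n⇒m<n∨m≡n (ℕ.≤-pred j<1+b))

  leastPositive : ∀ {P : ℕ → Set} → Decidable P → ∀ b → P (suc b) → ∃[ H ] IsLeastPositive P H
  leastPositive P? b pb with findLeast (λ H → (0 ℕ.<? H) ×-dec P? H) (suc (suc b))
  ... | inj₁ (H , (0<H , pH) , least) = H , 0<H , pH , λ H′ 0<H′ pH′ → least H′ (0<H′ , pH′)
  ... | inj₂ none = ⊥-elim (none (suc b) ℕ.≤-refl (s≤s z≤n , pb))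

  k∣n! : ∀ {n k} → 0 ℕ.< k → k ℕ.≤ n → k ℕ.∣ n !
  k∣n! {zero} (s≤s _) ()
  k∣n! {suc n} {k} 0<k k≤ with ℕ.m≤n⇒m<n∨m≡n k≤
  ... | inj₁ k<  = ℕ.∣n⇒∣m*n (suc n) (k∣n! 0<k (ℕ.≤-pred k<))
  ... | inj₂ refl = ℕ.∣m⇒∣m*n (n !) ℕ.∣-refl

  i∣n! : ∀ {n} (i : Fin n) → + suc (toℕ i) ℤ.∣ + (n !)
  i∣n! i = ℤ.∣ᵤ⇒∣ (k∣n! (s≤s z≤n) (Fin.toℕ<n i))

  shift : ∀ {n H m} (q : ℤ) → HasMultiples n H m → HasMultiples n H (m ℤ.+ q ℤ.* + (n !))
  shift {n} {H} {m} q (a , a∈ , inj , div) = (λ i → a i ℤ.+ s)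
    , (λ i → subst (ℤ._≤ a i ℤ.+ s) (lem m (+ 1) s) (ℤ.+-monoˡ-≤ s (proj₁ (a∈ i)))
           , subst (a i ℤ.+ s ℤ.≤_) (lem m (+ H) s) (ℤ.+-monoˡ-≤ s (proj₂ (a∈ i))))
    , (λ {i} {j} eq → inj (∙-cancelʳ s (a i) (a j) eq))
    , (λ i → ℤ.∣m∣n⇒∣m+n (div i) (ℤ.∣n⇒∣m*n q (i∣n! i)))
    where
    s : ℤ
    s = q ℤ.* + (n !)
    lem : ∀ m c s → m ℤ.+ c ℤ.+ s ≡ m ℤ.+ s ℤ.+ c
    lem = solve-ℤ

  Offsets : ∀ n H → ℤ → (Fin n → Fin H) → Set
  Offsets n H m f = (∀ i j → f i ≡ f j → i ≡ j) × (∀ i → + suc (toℕ i) ℤ.∣ m ℤ.+ + 1 ℤ.+ + toℕ (f i))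

  offsets? : ∀ n H m f → Dec (Offsets n H m f)
  offsets? n H m f =
    (Fin.all? λ i → Fin.all? λ j → (f i Fin.≟ f j) →-dec (i Fin.≟ j))
    ×-dec (Fin.all? λ i → + suc (toℕ i) ℤ.∣? m ℤ.+ + 1 ℤ.+ + toℕ (f i))

  offsets-cong : ∀ {n H m f g} → (∀ i → f i ≡ g i) → Offsets n H m f → Offsets n H m g
  offsets-cong {m = m} eq (inj , div) =
    (λ i j e → inj i j (trans (eq i) (trans e (sym (eq j))))) ,
    (λ i → subst (λ z → + suc (toℕ i) ℤ.∣ m ℤ.+ + 1 ℤ.+ + toℕ z) (eq i) (div i))

  fromOffsets : ∀ {n H m} f → Offsets n H m f → HasMultiples n H m
  fromOffsets {n} {H} {m} f (inj , div) = (λ i → m ℤ.+ + 1 ℤ.+ + toℕ (f i))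
    , (λ i → ℤ.i≤i+j (m ℤ.+ + 1) (+ toℕ (f i))
           , subst (ℤ._≤ m ℤ.+ + H) (sym (ℤ.+-assoc m (+ 1) (+ toℕ (f i)))) (ℤ.+-monoʳ-≤ m (ℤ.+≤+ (Fin.toℕ<n (f i)))))
    , (λ {i} {j} eq → inj i j (Fin.toℕ-injective (ℤ.+-injective (∙-cancelˡ (m ℤ.+ + 1) _ _ eq))))
    , div

  toOffsets : ∀ {n H m} → HasMultiples n H m → ∃[ f ] Offsets n H m f
  toOffsets {n} {H} {m} (a , a∈ , inj , div) = f
    , (λ i j eq → inj (trans (sym (back i)) (trans (cong (λ z → m ℤ.+ + 1 ℤ.+ + toℕ z) eq) (back j))))
    , (λ i → subst (+ suc (toℕ i) ℤ.∣_) (sym (back i)) (div i))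
    where
    d : Fin n → ℕ
    d i = ℤ.∣ a i ℤ.- (m ℤ.+ + 1) ∣
    d≡ : ∀ i → + d i ≡ a i ℤ.- (m ℤ.+ + 1)
    d≡ i = ℤ.0≤i⇒+∣i∣≡i (ℤ.i≤j⇒0≤j-i (proj₁ (a∈ i)))
    lem : ∀ m a → a ℤ.- (m ℤ.+ + 1) ℤ.+ + 1 ≡ a ℤ.- m
    lem = solve-ℤ
    lem′ : ∀ m h → m ℤ.+ h ℤ.- m ≡ h
    lem′ = solve-ℤ
    d<H : ∀ i → d i ℕ.< H
    d<H i = ℤ.drop‿+≤+ (subst₂ ℤ._≤_
      (trans (sym (lem m (a i))) (trans (cong (ℤ._+ + 1) (sym (d≡ i))) (cong +_ (ℕ.+-comm (d i) 1))))
      (lem′ m (+ H))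
      (ℤ.+-monoˡ-≤ (ℤ.- m) (proj₂ (a∈ i))))
    f : Fin n → Fin H
    f i = Fin.fromℕ< (d<H i)
    lem″ : ∀ c a → c ℤ.+ (a ℤ.- c) ≡ a
    lem″ = solve-ℤ
    back : ∀ i → m ℤ.+ + 1 ℤ.+ + toℕ (f i) ≡ a i
    back i = trans (cong (λ z → m ℤ.+ + 1 ℤ.+ + z) (Fin.toℕ-fromℕ< (d<H i)))
      (trans (cong (λ z → m ℤ.+ + 1 ℤ.+ z) (d≡ i)) (lem″ (m ℤ.+ + 1) (a i)))

  hasMultiples? : ∀ n H m → Dec (HasMultiples n H m)
  hasMultiples? n H m = map′
    (λ (c , o) → fromOffsets {m = m} (Fin.finToFun c) o)
    (λ h → let f , o = toOffsets {m = m} h in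
      Fin.funToFin f , offsets-cong {m = m} (λ i → sym (Fin.finToFun-funToFin f i)) o)
    (Fin.any? λ (c : Fin (H ℕ.^ n)) → offsets? n H m (Fin.finToFun c))

admissible? : ∀ n H → Dec (Admissible n H)
admissible? n H = map′ to (λ h r → h (+ toℕ r)) (Fin.all? λ (r : Fin (n !)) → hasMultiples? n H (+ toℕ r))
  where
  instance
    n!≢0 : ℕ.NonZero (n !)
    n!≢0 = ℕ._!≢0 n
  to : (∀ (r : Fin (n !)) → HasMultiples n H (+ toℕ r)) → Admissible n H
  to h m = subst (HasMultiples n H) (sym (ℤ.a≡a%ℕn+[a/ℕn]*n m (n !)))
    (shift {n} {H} {+ (m ℤ.%ℕ (n !))} (m ℤ./ℕ (n !)) (subst (λ z → HasMultiples n H (+ z)) (Fin.toℕ-fromℕ< r<) (h (Fin.fromℕ< r<))))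
    where
    r< : m ℤ.%ℕ (n !) ℕ.< n !
    r< = ℤ.n%ℕd<d m (n !)

-- Each of the n consecutive blocks of length n contains a multiple of each i ≤ n.
n²-admissible : ∀ n → Admissible n (n ℕ.* n)
n²-admissible n m = a , (λ i → lower i , upper i) , injective , λ i → divides (q i) refl
  where
  t : Fin n → ℤ
  t i = m ℤ.+ + (toℕ i ℕ.* n) ℤ.+ + n
  q a : Fin n → ℤ
  q i = t i ℤ./ℕ suc (toℕ i)
  a i = q i ℤ.* + suc (toℕ i)
  rem : Fin n → ℕ
  rem i = t i ℤ.%ℕ suc (toℕ i)
  t≡ : ∀ i → t i ≡ + rem i ℤ.+ a i
  t≡ i = ℤ.a≡a%ℕn+[a/ℕn]*n (t i) (suc (toℕ i))
  a≤t : ∀ i → a i ℤ.≤ t i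
  a≤t i = subst (a i ℤ.≤_) (trans (ℤ.+-comm (a i) (+ rem i)) (sym (t≡ i))) (ℤ.i≤i+j (a i) (+ rem i))
  rem<n : ∀ i → suc (rem i) ℕ.≤ n
  rem<n i = ℕ.≤-trans (ℤ.n%ℕd<d (t i) (suc (toℕ i))) (Fin.toℕ<n i)
  low : ∀ i → m ℤ.+ + (toℕ i ℕ.* n) ℤ.+ + 1 ℤ.≤ a i
  low i = subst₂ ℤ._≤_ (lem₁ (m ℤ.+ + (toℕ i ℕ.* n)) (+ n) (+ rem i))
      (trans (cong (ℤ._+ (+ 1 ℤ.- + suc (rem i))) (t≡ i)) (lem₂ (+ rem i) (a i)))
      (ℤ.+-monoʳ-≤ (t i) (ℤ.+-monoʳ-≤ (+ 1) (ℤ.neg-mono-≤ (ℤ.+≤+ (rem<n i)))))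
    where
    lem₁ : ∀ b n r → b ℤ.+ n ℤ.+ (+ 1 ℤ.- n) ≡ b ℤ.+ + 1
    lem₁ = solve-ℤ
    lem₂ : ∀ r a → r ℤ.+ a ℤ.+ (+ 1 ℤ.- (+ 1 ℤ.+ r)) ≡ a
    lem₂ = solve-ℤ
  lower : ∀ i → m ℤ.+ + 1 ℤ.≤ a i
  lower i = ℤ.≤-trans (ℤ.+-monoˡ-≤ (+ 1) (ℤ.i≤i+j m (+ (toℕ i ℕ.* n)))) (low i)
  block : ∀ i {j} → toℕ i ℕ.< j → t i ℤ.≤ m ℤ.+ + (j ℕ.* n)
  block i {j} i<j = subst (ℤ._≤ m ℤ.+ + (j ℕ.* n)) (sym (ℤ.+-assoc m (+ (toℕ i ℕ.* n)) (+ n)))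
    (ℤ.+-monoʳ-≤ m (ℤ.+≤+ (subst (ℕ._≤ j ℕ.* n) (ℕ.+-comm n (toℕ i ℕ.* n)) (ℕ.*-monoˡ-≤ n i<j))))
  upper : ∀ i → a i ℤ.≤ m ℤ.+ + (n ℕ.* n)
  upper i = ℤ.≤-trans (a≤t i) (block i (Fin.toℕ<n i))
  a<a : ∀ {i j} → toℕ i ℕ.< toℕ j → a i ℤ.< a j
  a<a {i} {j} i<j = ℤ.≤-<-trans (ℤ.≤-trans (a≤t i) (block i i<j))
    (ℤ.suc[i]≤j⇒i<j (subst (ℤ._≤ a j) (ℤ.+-comm (m ℤ.+ + (toℕ j ℕ.* n)) (+ 1)) (low j)))
  injective : Injective _≡_ _≡_ a
  injective {i} {j} eq with ℕ.<-cmp (toℕ i) (toℕ j)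
  ... | tri< i<j _ _ = ⊥-elim (ℤ.<-irrefl eq (a<a i<j))
  ... | tri≈ _ i≡j _ = Fin.toℕ-injective i≡j
  ... | tri> _ _ j<i = ⊥-elim (ℤ.<-irrefl (sym eq) (a<a j<i))

opaque
  leastAdmissible : ∀ n → ∃[ H ] IsLeastPositive (Admissible n) H
  leastAdmissible n = leastPositive (admissible? n) (n ℕ.* n) λ m →
    let a , a∈ , inj , div = n²-admissible n m in
    a , (λ i → proj₁ (a∈ i) , ℤ.≤-trans (proj₂ (a∈ i)) (ℤ.+-monoʳ-≤ m (ℤ.+≤+ (ℕ.n≤1+n (n ℕ.* n))))) , inj , div

F : ℕ → ℕ
F n = proj₁ (leastAdmissible n)

F-isLeast : ∀ n → IsLeastPositive (Admissible n) (F n)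
F-isLeast n = proj₂ (leastAdmissible n)

ℚ-ring : AlmostCommutativeRing 0ℓ 0ℓ
ℚ-ring = fromCommutativeRing +-*-commutativeRing (λ x → dec⇒maybe (0ℚ ≟ x))

-- Inequalities are proved by exhibiting the difference as an expression that is
-- visibly nonnegative and checking the identity with the ring solver.
≤-cert : ∀ {p q} e → 0ℚ ≤ e → q ≡ p + e → p ≤ q
≤-cert {p} e 0≤e refl = subst (_≤ p + e) (+-identityʳ p) (+-monoʳ-≤ p 0≤e)

<-cert : ∀ {p q} e → 0ℚ < e → q ≡ p + e → p < q
<-cert {p} e 0<e refl = subst (_< p + e) (+-identityʳ p) (+-monoʳ-< p 0<e)

0≤q-p : ∀ {p q} → p ≤ q → 0ℚ ≤ q - p
0≤q-p {p} {q} h = subst (_≤ q - p) (+-inverseʳ p) (+-monoˡ-≤ (- p) h)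

0<q-p : ∀ {p q} → p < q → 0ℚ < q - p
0<q-p {p} {q} h = subst (_< q - p) (+-inverseʳ p) (+-monoˡ-< (- p) h)

infixl 6 _⊕_
infixl 7 _⊗_

_⊕_ : ∀ {p q} → 0ℚ ≤ p → 0ℚ ≤ q → 0ℚ ≤ p + q
_⊕_ = +-mono-≤

_⊗_ : ∀ {p q} → 0ℚ ≤ p → 0ℚ ≤ q → 0ℚ ≤ p * q
_⊗_ {p} {q} hp hq = nonNegative⁻¹ (p * q)
  {{nonNeg*nonNeg⇒nonNeg p {{nonNegative hp}} q {{nonNegative hq}}}}

0<* : ∀ {p q} → 0ℚ < p → 0ℚ < q → 0ℚ < p * q
0<* {p} {q} hp hq = positive⁻¹ (p * q) {{pos*pos⇒pos p {{positive hp}} q {{positive hq}}}}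

0≤sq : ∀ p → 0ℚ ≤ p * p
0≤sq p with ≤-total 0ℚ p
... | inj₁ h = h ⊗ h
... | inj₂ h = subst (0ℚ ≤_) (lem p) (0≤q-p h ⊗ 0≤q-p h)
  where
  lem : ∀ p → (0ℚ - p) * (0ℚ - p) ≡ p * p
  lem = solve-∀ ℚ-ring

0≤1 : 0ℚ ≤ 1ℚ
0≤1 = nonNegative⁻¹ 1ℚ

0<1 : 0ℚ < 1ℚ
0<1 = positive⁻¹ 1ℚ

∣∣≤ : ∀ {z ε} → z ≤ ε → - z ≤ ε → ∣ z ∣ ≤ ε
∣∣≤ {z} {ε} h₁ h₂ with ∣p∣≡p∨∣p∣≡-p z
... | inj₁ e = subst (_≤ ε) (sym e) h₁
... | inj₂ e = subst (_≤ ε) (sym e) h₂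

p≤∣p∣ : ∀ p → p ≤ ∣ p ∣
p≤∣p∣ p with ≤-total 0ℚ p
... | inj₁ h = ≤-reflexive (sym (0≤p⇒∣p∣≡p h))
... | inj₂ h = ≤-trans h (0≤∣p∣ p)

-p≤∣p∣ : ∀ p → - p ≤ ∣ p ∣
-p≤∣p∣ p = subst (- p ≤_) (∣-p∣≡∣p∣ p) (p≤∣p∣ (- p))

∣p-q∣≡∣q-p∣ : ∀ p q → ∣ p - q ∣ ≡ ∣ q - p ∣
∣p-q∣≡∣q-p∣ p q = trans (sym (∣-p∣≡∣p∣ (p - q))) (cong ∣_∣ (lem p q))
  where
  lem : ∀ p q → - (p - q) ≡ q - p
  lem = solve-∀ ℚ-ring

-- The k-th term of every approximating sequence below uses n = suc k, and u k = 1/n.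
opaque
  ι u : ℕ → ℚ
  ι n = + n / 1
  u k = + 1 / suc k

private
  toᵘ-/ : ∀ i k → toℚᵘ (i / suc k) ℚᵘ.≃ ℚᵘ.mkℚᵘ i k
  toᵘ-/ i k = toℚᵘ-fromℚᵘ (ℚᵘ.mkℚᵘ i k)

opaque
  unfolding ι

  ι0 : ι 0 ≡ 0ℚ
  ι0 = refl

  ι1 : ι 1 ≡ 1ℚ
  ι1 = refl

  ι-+ : ∀ m n → ι (m ℕ.+ n) ≡ ι m + ι n
  ι-+ m n = toℚᵘ-injective (ℚᵘ.≃-trans (toᵘ-/ (+ (m ℕ.+ n)) 0) (ℚᵘ.≃-trans
    (ℚᵘ.*≡* (cong (ℤ._* + 1) (cong₂ ℤ._+_ (sym (ℤ.*-identityʳ (+ m))) (sym (ℤ.*-identityʳ (+ n))))))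
    (ℚᵘ.≃-sym (ℚᵘ.≃-trans (toℚᵘ-homo-+ (ι m) (ι n)) (ℚᵘ.+-cong (toᵘ-/ (+ m) 0) (toᵘ-/ (+ n) 0))))))

  ι-* : ∀ m n → ι (m ℕ.* n) ≡ ι m * ι n
  ι-* m n = toℚᵘ-injective (ℚᵘ.≃-trans (toᵘ-/ (+ (m ℕ.* n)) 0) (ℚᵘ.≃-trans
    (ℚᵘ.*≡* (cong (ℤ._* + 1) (ℤ.pos-* m n)))
    (ℚᵘ.≃-sym (ℚᵘ.≃-trans (toℚᵘ-homo-* (ι m) (ι n)) (ℚᵘ.*-cong (toᵘ-/ (+ m) 0) (toᵘ-/ (+ n) 0))))))

  ι-suc : ∀ n → ι (suc n) ≡ 1ℚ + ι n
  ι-suc n = ι-+ 1 n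

  0≤ι : ∀ n → 0ℚ ≤ ι n
  0≤ι n = nonNegative⁻¹ (ι n) {{normalize-nonNeg n 1}}

ι-mono : ∀ {m n} → m ℕ.≤ n → ι m ≤ ι n
ι-mono {m} {n} h = ≤-cert (ι (n ℕ.∸ m)) (0≤ι (n ℕ.∸ m))
  (trans (cong ι (sym (ℕ.m+[n∸m]≡n h))) (ι-+ m (n ℕ.∸ m)))

opaque
  unfolding ι u

  0<u : ∀ k → 0ℚ < u k
  0<u k = positive⁻¹ (u k) {{normalize-pos 1 (suc k)}}

0≤u : ∀ k → 0ℚ ≤ u k
0≤u k = <⇒≤ (0<u k)

opaque
  unfolding ι u

  ι*u : ∀ k → ι (suc k) * u k ≡ 1ℚ
  ι*u k = toℚᵘ-injective (ℚᵘ.≃-trans (toℚᵘ-homo-* (ι (suc k)) (u k))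
    (ℚᵘ.≃-trans (ℚᵘ.*-cong (toᵘ-/ (+ suc k) 0) (toᵘ-/ (+ 1) k))
    (ℚᵘ.*≡* (cong +_ (trans (ℕ.*-identityʳ (suc k ℕ.* 1)) (trans (ℕ.*-identityʳ (suc k))
       (sym (trans (ℕ.*-identityˡ (1 ℕ.* suc k)) (ℕ.*-identityˡ (suc k))))))))))

ιB*u≤1 : ∀ {B k} → B ℕ.≤ suc k → ι B * u k ≤ 1ℚ
ιB*u≤1 {B} {k} h = ≤-cert ((ι (suc k) - ι B) * u k) (0≤q-p (ι-mono h) ⊗ 0≤u k)
  (trans (sym (ι*u k)) (lem (ι B) (ι (suc k)) (u k)))
  where
  lem : ∀ b n u → n * u ≡ b * u + (n - b) * u
  lem = solve-∀ ℚ-ring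

bound : ℚ → ℕ
bound p = ℤ.∣ ↥ p ∣

opaque
  unfolding ι

  ≤-bound : ∀ p → p ≤ ι (bound p)
  ≤-bound p@(mkℚ n d _) = toℚᵘ-cancel-≤ (ℚᵘ.≤-respʳ-≃ (ℚᵘ.≃-sym (toᵘ-/ (+ ℤ.∣ n ∣) 0))
    (ℚᵘ.*≤* (lem n)))
    where
    lem : ∀ n → n ℤ.* + 1 ℤ.≤ + ℤ.∣ n ∣ ℤ.* + suc d
    lem (+ m) = subst₂ ℤ._≤_ (ℤ.pos-* m 1) (ℤ.pos-* m (suc d)) (ℤ.+≤+ (ℕ.*-monoʳ-≤ m {1} {suc d} (ℕ.s≤s ℕ.z≤n)))
    lem (ℤ.-[1+ m ]) = subst (ℤ.-[1+ m ] ℤ.* + 1 ℤ.≤_) (ℤ.pos-* (suc m) (suc d))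
      (subst (ℤ._≤ + (suc m ℕ.* suc d)) (sym (ℤ.*-identityʳ ℤ.-[1+ m ])) ℤ.-≤+)

-- Total, with the junk value recip 0 = 0.

recip : ℚ → ℚ
recip p with p ≟ 0ℚ
... | yes _  = 0ℚ
... | no p≢0 = 1/_ p {{≢-nonZero p≢0}}

recip-inverse : ∀ {p} → 0ℚ < p → p * recip p ≡ 1ℚ
recip-inverse {p} 0<p with p ≟ 0ℚ
... | yes p≡0 = ⊥-elim (<⇒≢ 0<p (sym p≡0))
... | no p≢0  = *-inverseʳ p {{≢-nonZero p≢0}}

0<recip : ∀ {p} → 0ℚ < p → 0ℚ < recip p
0<recip {p} 0<p with p ≟ 0ℚ
... | yes p≡0 = ⊥-elim (<⇒≢ 0<p (sym p≡0))
... | no p≢0  = positive⁻¹ _ {{1/pos⇒pos p {{positive 0<p}}}}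

opaque
  archimedean : ∀ C ε → 0ℚ ≤ C → 0ℚ < ε → ∃[ N ] ∀ n → N ℕ.≤ n → C * u n ≤ ε
  archimedean C ε 0≤C 0<ε = bound (C * recip ε) , λ n N≤n →
    let M = ι (suc n) ; v = u n ; r = recip ε
        h : C * r ≤ M
        h = ≤-trans (≤-bound (C * recip ε)) (ι-mono (ℕ.m≤n⇒m≤1+n N≤n))
    in ≤-cert (ε * v * (M - C * r)) ((<⇒≤ 0<ε ⊗ 0≤u n) ⊗ 0≤q-p h)
         (begin
           ε                                         ≡⟨ lem₁ ε ⟩
           ε * 1ℚ                                    ≡⟨ cong (ε *_) (sym (ι*u n)) ⟩
           ε * (M * v)                               ≡⟨ lem₂ C ε r M v ⟩
           C * v * (ε * r) + ε * v * (M - C * r)     ≡⟨ cong (λ z → C * v * z + ε * v * (M - C * r)) (recip-inverse 0<ε) ⟩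
           C * v * 1ℚ + ε * v * (M - C * r)          ≡⟨ cong (_+ ε * v * (M - C * r)) (*-identityʳ (C * v)) ⟩
           C * v + ε * v * (M - C * r)               ∎)
    where
    open ≡-Reasoning
    lem₁ : ∀ e → e ≡ e * 1ℚ
    lem₁ e = sym (*-identityʳ e)
    lem₂ : ∀ C ε r M v → ε * (M * v) ≡ C * v * (ε * r) + ε * v * (M - C * r)
    lem₂ = solve-∀ ℚ-ring

^-nonNeg : ∀ {a} n → 0ℚ ≤ a → 0ℚ ≤ a ^ n
^-nonNeg zero    h = 0≤1
^-nonNeg (suc n) h = h ⊗ ^-nonNeg n h

^-mono : ∀ {a b} n → 0ℚ ≤ a → a ≤ b → a ^ n ≤ b ^ n
^-mono zero _ _ = ≤-refl
^-mono {a} {b} (suc n) 0≤a a≤b =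
  ≤-cert ((b - a) * b ^ n + a * (b ^ n - a ^ n))
    (0≤q-p a≤b ⊗ ^-nonNeg n (≤-trans 0≤a a≤b) ⊕ 0≤a ⊗ 0≤q-p (^-mono n 0≤a a≤b))
    (lem a b (a ^ n) (b ^ n))
  where
  lem : ∀ a b A B → b * B ≡ a * A + ((b - a) * B + a * (B - A))
  lem = solve-∀ ℚ-ring

1^n≡1 : ∀ n → 1ℚ ^ n ≡ 1ℚ
1^n≡1 zero    = refl
1^n≡1 (suc n) = trans (*-identityˡ (1ℚ ^ n)) (1^n≡1 n)

^≤1 : ∀ {a} n → 0ℚ ≤ a → a ≤ 1ℚ → a ^ n ≤ 1ℚ
^≤1 {a} n h₀ h₁ = subst (a ^ n ≤_) (1^n≡1 n) (^-mono n h₀ h₁)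

^≤^suc : ∀ {a} n → 1ℚ ≤ a → a ^ n ≤ a ^ suc n
^≤^suc {a} n h = ≤-cert ((a - 1ℚ) * a ^ n) (0≤q-p h ⊗ ^-nonNeg n (≤-trans 0≤1 h)) (lem a (a ^ n))
  where
  lem : ∀ a A → a * A ≡ A + (a - 1ℚ) * A
  lem = solve-∀ ℚ-ring

bernoulli : ∀ {t} n → 0ℚ ≤ 1ℚ + t → 1ℚ + ι n * t ≤ (1ℚ + t) ^ n
bernoulli {t} zero h = ≤-reflexive (trans (cong (λ z → 1ℚ + z * t) ι0) (lem t))
  where
  lem : ∀ t → 1ℚ + 0ℚ * t ≡ 1ℚ
  lem = solve-∀ ℚ-ring
bernoulli {t} (suc n) h =
  subst (λ z → 1ℚ + z * t ≤ (1ℚ + t) ^ suc n) (sym (ι-suc n))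
  (≤-cert ((1ℚ + t) * ((1ℚ + t) ^ n - (1ℚ + ι n * t)) + ι n * (t * t))
    (h ⊗ 0≤q-p (bernoulli n h) ⊕ 0≤ι n ⊗ 0≤sq t)
    (lem t (ι n) ((1ℚ + t) ^ n)))
  where
  lem : ∀ t N P → (1ℚ + t) * P ≡ 1ℚ + (1ℚ + N) * t + ((1ℚ + t) * (P - (1ℚ + N * t)) + N * (t * t))
  lem = solve-∀ ℚ-ring

^-diff-upper : ∀ {a b} n → 0ℚ ≤ b → b ≤ a → a ^ suc n ≤ b ^ suc n + ι (suc n) * (a - b) * a ^ n
^-diff-upper {a} {b} zero 0≤b b≤a = ≤-reflexive
  (trans (lem a b) (cong (λ z → b * 1ℚ + z * (a - b) * 1ℚ) (sym ι1)))
  where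
  lem : ∀ a b → a * 1ℚ ≡ b * 1ℚ + 1ℚ * (a - b) * 1ℚ
  lem = solve-∀ ℚ-ring
^-diff-upper {a} {b} (suc n) 0≤b b≤a =
  subst (λ z → a ^ suc (suc n) ≤ b ^ suc (suc n) + z * (a - b) * a ^ suc n) (sym (ι-suc (suc n)))
  (≤-cert (b * (b ^ suc n + N * (a - b) * P - a * P) + N * ((a - b) * (a - b) * P))
    (0≤b ⊗ 0≤q-p (^-diff-upper n 0≤b b≤a)
      ⊕ 0≤ι (suc n) ⊗ (0≤sq (a - b) ⊗ ^-nonNeg n (≤-trans 0≤b b≤a)))
    (lem a b N P (b ^ suc n)))
  where
  N P : ℚ
  N = ι (suc n)
  P = a ^ n
  lem : ∀ a b N P B → b * B + (1ℚ + N) * (a - b) * (a * P)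
      ≡ a * (a * P) + (b * (B + N * (a - b) * P - a * P) + N * ((a - b) * (a - b) * P))
  lem = solve-∀ ℚ-ring

^-diff-lower : ∀ {a b} n → 0ℚ ≤ b → b ≤ a → b ^ suc n + ι (suc n) * (a - b) * b ^ n ≤ a ^ suc n
^-diff-lower {a} {b} zero 0≤b b≤a = ≤-reflexive
  (trans (cong (λ z → b * 1ℚ + z * (a - b) * 1ℚ) ι1) (lem a b))
  where
  lem : ∀ a b → b * 1ℚ + 1ℚ * (a - b) * 1ℚ ≡ a * 1ℚ
  lem = solve-∀ ℚ-ring
^-diff-lower {a} {b} (suc n) 0≤b b≤a =
  subst (λ z → b ^ suc (suc n) + z * (a - b) * b ^ suc n ≤ a ^ suc (suc n)) (sym (ι-suc (suc n)))
  (≤-cert (a * (a ^ suc n - (b * Q + N * (a - b) * Q)) + N * ((a - b) * (a - b) * Q))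
    (≤-trans 0≤b b≤a ⊗ 0≤q-p (^-diff-lower n 0≤b b≤a)
      ⊕ 0≤ι (suc n) ⊗ (0≤sq (a - b) ⊗ ^-nonNeg n 0≤b))
    (lem a b N Q (a ^ suc n)))
  where
  N Q : ℚ
  N = ι (suc n)
  Q = b ^ n
  lem : ∀ a b N Q A → a * A
      ≡ b * (b * Q) + (1ℚ + N) * (a - b) * (b * Q) + (a * (A - (b * Q + N * (a - b) * Q)) + N * ((a - b) * (a - b) * Q))
  lem = solve-∀ ℚ-ring

-- E k a = (1 + a/n)ⁿ with n = suc k, which tends to exp a.
E : ℕ → ℚ → ℚ
E k a = (1ℚ + a * u k) ^ suc k

Bd : ℕ → ℚ → Set
Bd B a = (- ι B ≤ a) × (a ≤ ι B)

Bd-neg : ∀ {B a} → Bd B a → Bd B (- a)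
Bd-neg {B} {a} (l , h) = neg-antimono-≤ h ,
  ≤-cert (a - (- ι B)) (0≤q-p l) (lem (ι B) a)
  where
  lem : ∀ b a → b ≡ - a + (a - (- b))
  lem = solve-∀ ℚ-ring

Bd-∣∣ : ∀ {B a} → ∣ a ∣ ≤ ι B → Bd B a
Bd-∣∣ {B} {a} h = ≤-cert (ι B - - a) (0≤q-p (≤-trans (-p≤∣p∣ a) h)) (lem (ι B) a) , ≤-trans (p≤∣p∣ a) h
  where
  lem : ∀ b a → a ≡ - b + (b - (- a))
  lem = solve-∀ ℚ-ring

Bd-top : ∀ B → Bd B (ι B)
Bd-top B = ≤-cert (ι B + ι B) (0≤ι B ⊕ 0≤ι B) (lem (ι B)) , ≤-refl
  where
  lem : ∀ b → b ≡ - b + (b + b)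
  lem = solve-∀ ℚ-ring

0≤1+au : ∀ {B a k} → Bd B a → B ℕ.≤ suc k → 0ℚ ≤ 1ℚ + a * u k
0≤1+au {B} {a} {k} (l , _) h =
  ≤-cert ((1ℚ - ι B * u k) + (a - (- ι B)) * u k)
    (0≤q-p (ιB*u≤1 h) ⊕ 0≤q-p l ⊗ 0≤u k) (lem (ι B) a (u k))
  where
  lem : ∀ b a u → 1ℚ + a * u ≡ 0ℚ + ((1ℚ - b * u) + (a - (- b)) * u)
  lem = solve-∀ ℚ-ring

E-nonNeg : ∀ {a} k → 0ℚ ≤ 1ℚ + a * u k → 0ℚ ≤ E k a
E-nonNeg k h = ^-nonNeg (suc k) h

E-mono : ∀ {a b} k → 0ℚ ≤ 1ℚ + a * u k → a ≤ b → E k a ≤ E k b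
E-mono {a} {b} k h a≤b = ^-mono (suc k) h
  (≤-cert ((b - a) * u k) (0≤q-p a≤b ⊗ 0≤u k) (lem a b (u k)))
  where
  lem : ∀ a b u → 1ℚ + b * u ≡ 1ℚ + a * u + (b - a) * u
  lem = solve-∀ ℚ-ring

-- 1 + a ≤ (1 + a/n)ⁿ
E-bernoulli : ∀ {a} k → 0ℚ ≤ 1ℚ + a * u k → 1ℚ + a ≤ E k a
E-bernoulli {a} k h = subst (_≤ E k a)
  (trans (lem a (ι (suc k)) (u k)) (trans (cong (λ z → 1ℚ + z * a) (ι*u k)) (cong (λ z → 1ℚ + z) (*-identityˡ a))))
  (bernoulli (suc k) h)
  where
  lem : ∀ a n u → 1ℚ + n * (a * u) ≡ 1ℚ + (n * u) * a
  lem = solve-∀ ℚ-ring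

u≤1 : ∀ k → u k ≤ 1ℚ
u≤1 k = subst (_≤ 1ℚ) (trans (cong (_* u k) ι1) (*-identityˡ (u k))) (ιB*u≤1 {1} {k} (ℕ.s≤s ℕ.z≤n))

E-refine : ∀ {a} k l → 0ℚ ≤ 1ℚ + a * u k →
  0ℚ ≤ 1ℚ + a * (u k * u l) × E k a ≤ (1ℚ + a * (u k * u l)) ^ (suc l ℕ.* suc k)
E-refine {a} k l h = 0≤1+t , ≤-trans (^-mono (suc k) h step) (≤-reflexive (^-assocʳ (1ℚ + t) (suc l) (suc k)))
  where
  t : ℚ
  t = a * (u k * u l)
  lem₁ : ∀ a v w → 1ℚ + a * (v * w) ≡ 0ℚ + ((1ℚ + a * v) * w + (1ℚ - w))
  lem₁ = solve-∀ ℚ-ring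
  0≤1+t : 0ℚ ≤ 1ℚ + t
  0≤1+t = ≤-cert _ (h ⊗ 0≤u l ⊕ 0≤q-p (u≤1 l)) (lem₁ a (u k) (u l))
  lem₂ : ∀ a v w n → 1ℚ + n * (a * (v * w)) ≡ 1ℚ + (n * w) * (a * v)
  lem₂ = solve-∀ ℚ-ring
  step : 1ℚ + a * u k ≤ (1ℚ + t) ^ suc l
  step = subst (_≤ (1ℚ + t) ^ suc l)
    (trans (lem₂ a (u k) (u l) (ι (suc l))) (trans (cong (λ z → 1ℚ + z * (a * u k)) (ι*u l)) (cong (λ z → 1ℚ + z) (*-identityˡ (a * u k)))))
    (bernoulli (suc l) 0≤1+t)

*-mono-nn : ∀ {a b c d} → 0ℚ ≤ a → 0ℚ ≤ c → a ≤ b → c ≤ d → a * c ≤ b * d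
*-mono-nn {a} {b} {c} {d} 0≤a 0≤c a≤b c≤d = ≤-cert ((b - a) * d + a * (d - c))
  (0≤q-p a≤b ⊗ ≤-trans 0≤c c≤d ⊕ 0≤a ⊗ 0≤q-p c≤d) (lem a b c d)
  where
  lem : ∀ a b c d → b * d ≡ a * c + ((b - a) * d + a * (d - c))
  lem = solve-∀ ℚ-ring

-- (1 + a/n)ⁿ (1 - a/m)ᵐ ≤ 1
E*E⁻≤1 : ∀ {a} k l → 0ℚ ≤ 1ℚ + a * u k → 0ℚ ≤ 1ℚ + (- a) * u l → E k a * E l (- a) ≤ 1ℚ
E*E⁻≤1 {a} k l h₁ h₂ = begin
  E k a * E l (- a)                  ≤⟨ *-mono-nn (E-nonNeg {a} k h₁) (E-nonNeg { - a} l h₂) (proj₂ r₁) (proj₂ r₂) ⟩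
  X ^ (suc l ℕ.* suc k) * Y ^ (suc k ℕ.* suc l)
                                     ≡⟨ cong (λ z → X ^ (suc l ℕ.* suc k) * Y ^ z) (ℕ.*-comm (suc k) (suc l)) ⟩
  X ^ N * Y ^ N                      ≡⟨ sym (^-distrib-* X Y N) ⟩
  (X * Y) ^ N                        ≤⟨ ^≤1 N (proj₁ r₁ ⊗ proj₁ r₂) xy≤1 ⟩
  1ℚ                                 ∎
  where
  open ≤-Reasoning
  N : ℕ
  N = suc l ℕ.* suc k
  X Y : ℚ
  X = 1ℚ + a * (u k * u l)
  Y = 1ℚ + (- a) * (u l * u k)
  r₁ = E-refine {a} k l h₁
  r₂ = E-refine { - a} l k h₂
  lem : ∀ a v w → 1ℚ ≡ (1ℚ + a * (v * w)) * (1ℚ + (- a) * (w * v)) + (a * (v * w)) * (a * (v * w))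
  lem = solve-∀ ℚ-ring
  xy≤1 : X * Y ≤ 1ℚ
  xy≤1 = ≤-cert ((a * (u k * u l)) * (a * (u k * u l))) (0≤sq (a * (u k * u l))) (lem a (u k) (u l))

-- 1 - a²/n ≤ (1 + a/n)ⁿ (1 - a/n)ⁿ
E*E⁻-lower : ∀ {a} k → 0ℚ ≤ 1ℚ + a * u k → 0ℚ ≤ 1ℚ + (- a) * u k →
  1ℚ - a * a * u k ≤ E k a * E k (- a)
E*E⁻-lower {a} k h₁ h₂ = begin
  1ℚ - a * a * u k                                    ≡⟨ sym (cong (λ z → 1ℚ - a * a * u k * z) (ι*u k) ▹ cong (λ z → 1ℚ - z) (*-identityʳ (a * a * u k))) ⟩
  1ℚ - a * a * u k * (ι (suc k) * u k)                ≡⟨ lem a (u k) (ι (suc k)) ⟩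
  1ℚ + ι (suc k) * t                                  ≤⟨ bernoulli (suc k) (subst (0ℚ ≤_) (sym (lem₂ a (u k))) (h₁ ⊗ h₂)) ⟩
  (1ℚ + t) ^ suc k                                    ≡⟨ cong (_^ suc k) (lem₂ a (u k)) ⟩
  ((1ℚ + a * u k) * (1ℚ + (- a) * u k)) ^ suc k       ≡⟨ ^-distrib-* (1ℚ + a * u k) (1ℚ + (- a) * u k) (suc k) ⟩
  E k a * E k (- a)                                   ∎
  where
  open ≤-Reasoning
  _▹_ = trans {A = ℚ}
  t : ℚ
  t = - ((a * u k) * (a * u k))
  lem : ∀ a v n → 1ℚ - a * a * v * (n * v) ≡ 1ℚ + n * (- ((a * v) * (a * v)))
  lem = solve-∀ ℚ-ring
  lem₂ : ∀ a v → 1ℚ + - ((a * v) * (a * v)) ≡ (1ℚ + a * v) * (1ℚ + (- a) * v)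
  lem₂ = solve-∀ ℚ-ring

-- K B bounds (1 + a/n)ⁿ for all |a| ≤ B and n ≥ B.
K : ℕ → ℚ
K B = (1ℚ + 1ℚ) ^ suc (2 ℕ.* B)

0≤K : ∀ B → 0ℚ ≤ K B
0≤K B = ^-nonNeg (suc (2 ℕ.* B)) (0≤1 ⊕ 0≤1)

E≤K : ∀ {B a} k → Bd B a → B ℕ.≤ suc k → E k a ≤ K B
E≤K {B} {a} k bd h = ≤-trans (E-mono {a} {ι B} k (0≤1+au {B} {a} {k} bd h) (proj₂ bd)) main
  where
  l : ℕ
  l = 2 ℕ.* B
  b : ℚ
  b = ι B
  posk : 0ℚ ≤ 1ℚ + b * u k
  posk = 0≤1+au {B} {b} {k} (Bd-top B) h
  2bu≤1 : (b + b) * u l ≤ 1ℚ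
  2bu≤1 = subst (λ z → z * u l ≤ 1ℚ) (trans (cong ι (cong (B ℕ.+_) (ℕ.+-identityʳ B))) (ι-+ B B)) (ιB*u≤1 {l} {l} (ℕ.n≤1+n l))
  lemh : ∀ b v → 1ℚ + (- b) * v ≡ ½ + ½ * (1ℚ - (b + b) * v)
  lemh = solve-∀ ℚ-ring
  0≤½ : 0ℚ ≤ ½
  0≤½ = nonNegative⁻¹ ½
  half : ½ ≤ 1ℚ + (- b) * u l
  half = ≤-cert (½ * (1ℚ - (b + b) * u l)) (0≤½ ⊗ 0≤q-p 2bu≤1) (lemh b (u l))
  X : ℚ
  X = E k b
  H : ℚ
  H = ½ ^ suc l
  prod : X * H ≤ 1ℚ
  prod = ≤-trans (*-mono-nn (E-nonNeg {b} k posk) (^-nonNeg (suc l) 0≤½) ≤-refl (^-mono (suc l) 0≤½ half))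
                 (E*E⁻≤1 {b} k l posk (≤-trans 0≤½ half))
  HK : H * K B ≡ 1ℚ
  HK = trans (sym (^-distrib-* ½ (1ℚ + 1ℚ) (suc l))) (1^n≡1 (suc l))
  lem : ∀ X H K → K ≡ X * (H * K) + K * (1ℚ - X * H)
  lem = solve-∀ ℚ-ring
  main : X ≤ K B
  main = ≤-cert (K B * (1ℚ - X * H)) (0≤K B ⊗ 0≤q-p prod)
    (trans (lem X H (K B)) (cong (_+ K B * (1ℚ - X * H)) (trans (cong (X *_) HK) (*-identityʳ X))))

E-lip : ∀ {B a b} k → Bd B a → Bd B b → B ℕ.≤ suc k → b ≤ a → E k a ≤ E k b + K B * (a - b)
E-lip {B} {a} {b} k bda bdb h b≤a =
  ≤-trans (^-diff-upper k pb pba)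
    (≤-cert ((a - b) * (K B - P)) (0≤q-p b≤a ⊗ 0≤q-p P≤K)
      (trans (lem a b (K B) P (E k b))
        (cong (λ z → E k b + z + (a - b) * (K B - P))
          (trans (cong (λ z → z * ((a - b) * P)) (sym (ι*u k))) (lem₂ a b (ι (suc k)) (u k) P)))))
  where
  pb : 0ℚ ≤ 1ℚ + b * u k
  pb = 0≤1+au {B} {b} {k} bdb h
  lem₀ : ∀ a b v → 1ℚ + a * v ≡ 1ℚ + b * v + (a - b) * v
  lem₀ = solve-∀ ℚ-ring
  pba : 1ℚ + b * u k ≤ 1ℚ + a * u k
  pba = ≤-cert ((a - b) * u k) (0≤q-p b≤a ⊗ 0≤u k) (lem₀ a b (u k))
  T : ℚ
  T = 1ℚ + ι B * u k
  aT : 1ℚ + a * u k ≤ T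
  aT = ≤-cert ((ι B - a) * u k) (0≤q-p (proj₂ bda) ⊗ 0≤u k) (lem₀ (ι B) a (u k))
  1≤T : 1ℚ ≤ T
  1≤T = ≤-cert (ι B * u k) (0≤ι B ⊗ 0≤u k) refl
  P : ℚ
  P = (1ℚ + a * u k) ^ k
  P≤K : P ≤ K B
  P≤K = ≤-trans (^-mono k (≤-trans pb pba) aT) (≤-trans (^≤^suc k 1≤T) (E≤K {B} {ι B} k (Bd-top B) h))
  lem : ∀ a b K P X → X + K * (a - b) ≡ X + 1ℚ * ((a - b) * P) + (a - b) * (K - P)
  lem = solve-∀ ℚ-ring
  lem₂ : ∀ a b n v P → n * v * ((a - b) * P) ≡ n * (1ℚ + a * v - (1ℚ + b * v)) * P
  lem₂ = solve-∀ ℚ-ring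

E-lip∣∣ : ∀ {B a b} k → Bd B a → Bd B b → B ℕ.≤ suc k → E k a ≤ E k b + K B * ∣ a - b ∣
E-lip∣∣ {B} {a} {b} k bda bdb h with ≤-total b a
... | inj₁ b≤a = subst (λ z → E k a ≤ E k b + K B * z) (sym (0≤p⇒∣p∣≡p (0≤q-p b≤a))) (E-lip {B} {a} {b} k bda bdb h b≤a)
... | inj₂ a≤b = ≤-trans (E-mono {a} {b} k (0≤1+au {B} {a} {k} bda h) a≤b)
                   (≤-cert (K B * ∣ a - b ∣) (0≤K B ⊗ 0≤∣p∣ (a - b)) refl)

sq≤ : ∀ {B a} → Bd B a → a * a ≤ ι B * ι B
sq≤ {B} {a} (l , h) = ≤-cert ((ι B - a) * (a - - ι B)) (0≤q-p h ⊗ 0≤q-p l) (lem (ι B) a)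
  where
  lem : ∀ b a → b * b ≡ a * a + (b - a) * (a - - b)
  lem = solve-∀ ℚ-ring

E-compare : ∀ {B a} k l → Bd B a → B ℕ.≤ suc k → B ℕ.≤ suc l →
  E k a ≤ E l a + K B * (ι B * ι B) * u l
E-compare {B} {a} k l bd hk hl =
  ≤-cert (Q * (1ℚ - P * G) + P * (Q * G - (1ℚ - a * a * v)) + (KB * (b * b - a * a) + (KB - P) * (a * a)) * v)
    (0≤Q ⊗ 0≤q-p (E*E⁻≤1 {a} k l pk nl)
      ⊕ 0≤P ⊗ 0≤q-p (E*E⁻-lower {a} l pl nl)
      ⊕ (0≤K B ⊗ 0≤q-p (sq≤ {B} {a} bd) ⊕ 0≤q-p (E≤K {B} {a} k bd hk) ⊗ 0≤sq a) ⊗ 0≤u l)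
    (lem a b v KB P Q G)
  where
  P Q G KB b v : ℚ
  P = E k a
  Q = E l a
  G = E l (- a)
  KB = K B
  b = ι B
  v = u l
  pk = 0≤1+au {B} {a} {k} bd hk
  pl = 0≤1+au {B} {a} {l} bd hl
  nl = 0≤1+au {B} { - a} {l} (Bd-neg {B} {a} bd) hl
  0≤P = E-nonNeg {a} k pk
  0≤Q = E-nonNeg {a} l pl
  lem : ∀ a b v K P Q G → Q + K * (b * b) * v ≡
    P + (Q * (1ℚ - P * G) + P * (Q * G - (1ℚ - a * a * v)) + (K * (b * b - a * a) + (K - P) * (a * a)) * v)
  lem = solve-∀ ℚ-ring

Eventually : (ℕ → Set) → Set
Eventually P = ∃[ N ] ∀ n → N ℕ.≤ n → P n

IsCauchy : (ℕ → ℚ) → Set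
IsCauchy x = ∀ ε → 0ℚ < ε → ∃[ N ] ∀ m n → N ℕ.≤ m → N ℕ.≤ n → ∣ x m - x n ∣ ≤ ε

-- Cauchy sequences of rationals; equality of reals is _≃ℝ_.
record ℝ : Set where
  constructor mkℝ
  field
    seq    : ℕ → ℚ
    cauchy : IsCauchy seq
open ℝ public

infix 4 _≤ℝ_ _<ℝ_ _≃ℝ_

_≤ℝ_ _<ℝ_ _≃ℝ_ : ℝ → ℝ → Set
x ≤ℝ y = ∀ ε → 0ℚ < ε → Eventually (λ n → seq x n ≤ seq y n + ε)
x <ℝ y = ∃[ ε ] 0ℚ < ε × Eventually (λ n → seq x n + ε ≤ seq y n)
x ≃ℝ y = ∀ ε → 0ℚ < ε → Eventually (λ n → ∣ seq x n - seq y n ∣ ≤ ε)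

half : ∀ {ε} → 0ℚ < ε → 0ℚ < ½ * ε
half = 0<* {½} (positive⁻¹ ½)

half+half : ∀ ε → ½ * ε + ½ * ε ≡ ε
half+half = solve-∀ ℚ-ring

opaque
  shrink : ∀ C ε → 0ℚ ≤ C → 0ℚ < ε → ∃[ η ] 0ℚ < η × C * η ≤ ε
  shrink C ε 0≤C 0<ε = ε * r , 0<* 0<ε 0<r ,
    ≤-cert (ε * r) (<⇒≤ (0<* 0<ε 0<r))
     (trans (sym (*-identityʳ ε)) (trans (cong (ε *_) (sym (recip-inverse 0<D))) (lem C ε r)))
    where
    D r : ℚ
    D = 1ℚ + C
    0<D : 0ℚ < D
    0<D = +-mono-<-≤ 0<1 0≤C
    r = recip D
    0<r : 0ℚ < r
    0<r = 0<recip 0<D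
    lem : ∀ C ε r → ε * ((1ℚ + C) * r) ≡ C * (ε * r) + ε * r
    lem = solve-∀ ℚ-ring

p≤q+ε⇒p-q≤ε : ∀ {p q ε} → p ≤ q + ε → p - q ≤ ε
p≤q+ε⇒p-q≤ε {p} {q} {ε} h = ≤-cert (q + ε - p) (0≤q-p h) (lem p q ε)
  where
  lem : ∀ p q ε → ε ≡ p - q + (q + ε - p)
  lem = solve-∀ ℚ-ring

p-q≤ε⇒p≤q+ε : ∀ {p q ε} → p - q ≤ ε → p ≤ q + ε
p-q≤ε⇒p≤q+ε {p} {q} {ε} h = ≤-cert (ε - (p - q)) (0≤q-p h) (lem p q ε)
  where
  lem : ∀ p q ε → q + ε ≡ p + (ε - (p - q))
  lem = solve-∀ ℚ-ring

∣-∣⇒≤ : ∀ {p q ε} → ∣ p - q ∣ ≤ ε → p ≤ q + ε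
∣-∣⇒≤ {p} {q} h = p-q≤ε⇒p≤q+ε {p} {q} (≤-trans (p≤∣p∣ (p - q)) h)

≤≤⇒∣-∣ : ∀ {p q ε} → p ≤ q + ε → q ≤ p + ε → ∣ p - q ∣ ≤ ε
≤≤⇒∣-∣ {p} {q} {ε} h₁ h₂ = ∣∣≤ (p≤q+ε⇒p-q≤ε {p} {q} h₁) (subst (_≤ ε) (lem p q) (p≤q+ε⇒p-q≤ε {q} {p} h₂))
  where
  lem : ∀ p q → q - p ≡ - (p - q)
  lem = solve-∀ ℚ-ring

mkCauchy : ∀ {x : ℕ → ℚ} →
  (∀ ε → 0ℚ < ε → ∃[ N ] ∀ m n → N ℕ.≤ m → N ℕ.≤ n → x m ≤ x n + ε) → IsCauchy x
mkCauchy {x} h ε 0<ε = let N , f = h ε 0<ε in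
  N , λ m n N≤m N≤n → ≤≤⇒∣-∣ {x m} {x n} (f m n N≤m N≤n) (f n m N≤n N≤m)

opaque
  eventually-bounded : ∀ x → ∃[ B ] Eventually (λ n → ∣ seq x n ∣ ≤ ι B)
  eventually-bounded x = let N , f = cauchy x 1ℚ 0<1 in
    bound (1ℚ + ∣ seq x N ∣) , N , λ n N≤n → ≤-trans
      (subst (_≤ 1ℚ + ∣ seq x N ∣) (cong ∣_∣ (lem (seq x n) (seq x N)))
        (≤-trans (∣p+q∣≤∣p∣+∣q∣ (seq x n - seq x N) (seq x N)) (+-monoˡ-≤ ∣ seq x N ∣ (f n N N≤n ℕ.≤-refl))))
      (≤-bound (1ℚ + ∣ seq x N ∣))
    where
    lem : ∀ a b → a - b + b ≡ a
    lem = solve-∀ ℚ-ring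

fromℚ : ℚ → ℝ
fromℚ q = mkℝ (λ _ → q) λ ε 0<ε → 0 , λ _ _ _ _ →
  subst (_≤ ε) (sym (cong ∣_∣ (+-inverseʳ q))) (<⇒≤ 0<ε)

fromℕ : ℕ → ℝ
fromℕ n = fromℚ (ι n)

0ℝ 1ℝ : ℝ
0ℝ = fromℚ 0ℚ
1ℝ = fromℚ 1ℚ

infixl 7 _*ℝ_

opaque
  *ℝ-cauchy : ∀ x y → IsCauchy (λ n → seq x n * seq y n)
  *ℝ-cauchy x y = λ ε 0<ε →
    let A , M , f = eventually-bounded x
        B , N , g = eventually-bounded y
        η , 0<η , hη = shrink (ι A + ι B) ε (0≤ι A ⊕ 0≤ι B) 0<ε
        P , h = cauchy x η 0<η
        Q , k = cauchy y η 0<η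
    in (M ℕ.⊔ N) ℕ.⊔ (P ℕ.⊔ Q) , λ m n hm hn →
      let a = seq x m ; b = seq y m ; c = seq x n ; d = seq y n
          MN≤m = ℕ.m⊔n≤o⇒m≤o (M ℕ.⊔ N) (P ℕ.⊔ Q) hm
          MN≤n = ℕ.m⊔n≤o⇒m≤o (M ℕ.⊔ N) (P ℕ.⊔ Q) hn
          PQ≤m = ℕ.m⊔n≤o⇒n≤o (M ℕ.⊔ N) (P ℕ.⊔ Q) hm
          PQ≤n = ℕ.m⊔n≤o⇒n≤o (M ℕ.⊔ N) (P ℕ.⊔ Q) hn
          open ≤-Reasoning
      in begin
        ∣ a * b - c * d ∣                     ≡⟨ cong ∣_∣ (lem a b c d) ⟩
        ∣ a * (b - d) + d * (a - c) ∣         ≤⟨ ∣p+q∣≤∣p∣+∣q∣ (a * (b - d)) (d * (a - c)) ⟩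
        ∣ a * (b - d) ∣ + ∣ d * (a - c) ∣     ≡⟨ cong₂ _+_ (∣p*q∣≡∣p∣*∣q∣ a (b - d)) (∣p*q∣≡∣p∣*∣q∣ d (a - c)) ⟩
        ∣ a ∣ * ∣ b - d ∣ + ∣ d ∣ * ∣ a - c ∣
          ≤⟨ +-mono-≤
               (*-mono-nn (0≤∣p∣ a) (0≤∣p∣ (b - d)) (f m (ℕ.m⊔n≤o⇒m≤o M N MN≤m))
                 (k m n (ℕ.m⊔n≤o⇒n≤o P Q PQ≤m) (ℕ.m⊔n≤o⇒n≤o P Q PQ≤n)))
               (*-mono-nn (0≤∣p∣ d) (0≤∣p∣ (a - c)) (g n (ℕ.m⊔n≤o⇒n≤o M N MN≤n))
                 (h m n (ℕ.m⊔n≤o⇒m≤o P Q PQ≤m) (ℕ.m⊔n≤o⇒m≤o P Q PQ≤n))) ⟩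
        ι A * η + ι B * η                     ≡⟨ sym (*-distribʳ-+ η (ι A) (ι B)) ⟩
        (ι A + ι B) * η                       ≤⟨ hη ⟩
        ε                                     ∎
    where
    lem : ∀ a b c d → a * b - c * d ≡ a * (b - d) + d * (a - c)
    lem = solve-∀ ℚ-ring

_*ℝ_ : ℝ → ℝ → ℝ
x *ℝ y = mkℝ (λ n → seq x n * seq y n) (*ℝ-cauchy x y)

recip-anti : ∀ {ε x} → 0ℚ < ε → ε ≤ x → recip x ≤ recip ε
recip-anti {ε} {x} 0<ε ε≤x = ≤-cert (recip x * recip ε * (x - ε))
  (<⇒≤ (0<* (0<recip 0<x) (0<recip 0<ε)) ⊗ 0≤q-p ε≤x)
  (sym (trans (lem ε x (recip x) (recip ε))
    (trans (cong₂ (λ p q → recip x * (1ℚ - p) + recip ε * q) (recip-inverse 0<ε) (recip-inverse 0<x))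
      (lem₂ (recip x) (recip ε)))))
  where
  0<x : 0ℚ < x
  0<x = <-≤-trans 0<ε ε≤x
  lem : ∀ ε x r s → r + r * s * (x - ε) ≡ r * (1ℚ - ε * s) + s * (x * r)
  lem = solve-∀ ℚ-ring
  lem₂ : ∀ r s → r * (1ℚ - 1ℚ) + s * 1ℚ ≡ s
  lem₂ = solve-∀ ℚ-ring

opaque
  inverse-cauchy : ∀ x → 0ℝ <ℝ x → IsCauchy (λ n → recip (seq x n))
  inverse-cauchy x (δ , 0<δ , N , hN) = (mkCauchy λ ε 0<ε →
    let R = recip δ
        0≤R = <⇒≤ (0<recip 0<δ)
        η , 0<η , hη = shrink (R * R) ε (0≤R ⊗ 0≤R) 0<ε
        M , hM = cauchy x η 0<η
    in N ℕ.⊔ M , λ m n hm hn →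
      let a = seq x m ; b = seq x n
          δ≤a = δ≤ m (ℕ.m⊔n≤o⇒m≤o N M hm)
          δ≤b = δ≤ n (ℕ.m⊔n≤o⇒m≤o N M hn)
          0<a = <-≤-trans 0<δ δ≤a
          0<b = <-≤-trans 0<δ δ≤b
          r = recip a ; s = recip b
          b-a = ≤-trans (p≤∣p∣ (b - a)) (hM n m (ℕ.m⊔n≤o⇒n≤o N M hn) (ℕ.m⊔n≤o⇒n≤o N M hm))
          open ≤-Reasoning
      in begin
        r                                ≡⟨ sym (trans (cong₂ (λ p q → s + (r * p - s * q)) (recip-inverse 0<b) (recip-inverse 0<a)) (lem₁ r s)) ⟩
        s + (r * (b * s) - s * (a * r))  ≡⟨ lem₂ a b r s ⟩
        s + r * s * (b - a)              ≤⟨ +-monoʳ-≤ s (≤-trans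
                                              (*-monoˡ-≤-nonNeg (r * s) {{nonNegative (<⇒≤ (0<* (0<recip 0<a) (0<recip 0<b)))}} b-a)
                                              (≤-trans (*-mono-nn (<⇒≤ (0<* (0<recip 0<a) (0<recip 0<b))) (<⇒≤ 0<η)
                                                 (*-mono-nn (<⇒≤ (0<recip 0<a)) (<⇒≤ (0<recip 0<b)) (recip-anti 0<δ δ≤a) (recip-anti 0<δ δ≤b)) ≤-refl)
                                               hη)) ⟩
        s + ε                            ∎)
    where
    δ≤ : ∀ n → N ℕ.≤ n → δ ≤ seq x n
    δ≤ n h = subst (_≤ seq x n) (+-identityˡ δ) (hN n h)
    lem₁ : ∀ r s → s + (r * 1ℚ - s * 1ℚ) ≡ r
    lem₁ = solve-∀ ℚ-ring
    lem₂ : ∀ a b r s → s + (r * (b * s) - s * (a * r)) ≡ s + r * s * (b - a)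
    lem₂ = solve-∀ ℚ-ring

inverse : (x : ℝ) → 0ℝ <ℝ x → ℝ
inverse x 0<x = mkℝ (λ n → recip (seq x n)) (inverse-cauchy x 0<x)

_÷ℝ_[_] : (x y : ℝ) → 0ℝ <ℝ y → ℝ
x ÷ℝ y [ 0<y ] = x *ℝ inverse y 0<y

opaque
  exp-cauchy : ∀ x → IsCauchy (λ n → E n (seq x n))
  exp-cauchy x = (mkCauchy λ ε 0<ε →
    let B , M , f = eventually-bounded x
        η , 0<η , hη = shrink (K B) (½ * ε) (0≤K B) (half 0<ε)
        N , g = cauchy x η 0<η
        L , h = archimedean (K B * (ι B * ι B)) (½ * ε) (0≤K B ⊗ (0≤ι B ⊗ 0≤ι B)) (half 0<ε)
    in (M ℕ.⊔ N) ℕ.⊔ (L ℕ.⊔ B) , λ m n hm hn →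
      let MN≤m = ℕ.m⊔n≤o⇒m≤o (M ℕ.⊔ N) (L ℕ.⊔ B) hm
          MN≤n = ℕ.m⊔n≤o⇒m≤o (M ℕ.⊔ N) (L ℕ.⊔ B) hn
          LB≤m = ℕ.m⊔n≤o⇒n≤o (M ℕ.⊔ N) (L ℕ.⊔ B) hm
          LB≤n = ℕ.m⊔n≤o⇒n≤o (M ℕ.⊔ N) (L ℕ.⊔ B) hn
          a = seq x m ; b = seq x n
          bda = Bd-∣∣ {B} {a} (f m (ℕ.m⊔n≤o⇒m≤o M N MN≤m))
          bdb = Bd-∣∣ {B} {b} (f n (ℕ.m⊔n≤o⇒m≤o M N MN≤n))
          B≤m = ℕ.m≤n⇒m≤1+n (ℕ.m⊔n≤o⇒n≤o L B LB≤m)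
          B≤n = ℕ.m≤n⇒m≤1+n (ℕ.m⊔n≤o⇒n≤o L B LB≤n)
          open ≤-Reasoning
      in begin
        E m a                                                 ≤⟨ E-lip∣∣ {B} {a} {b} m bda bdb B≤m ⟩
        E m b + K B * ∣ a - b ∣                               ≤⟨ +-mono-≤ (E-compare {B} {b} m n bdb B≤m B≤n)
                                                                   (≤-trans (*-monoˡ-≤-nonNeg (K B) {{nonNegative (0≤K B)}}
                                                                     (g m n (ℕ.m⊔n≤o⇒n≤o M N MN≤m) (ℕ.m⊔n≤o⇒n≤o M N MN≤n))) hη) ⟩
        E n b + K B * (ι B * ι B) * u n + ½ * ε               ≤⟨ +-monoˡ-≤ (½ * ε) (+-monoʳ-≤ (E n b) (h n (ℕ.m⊔n≤o⇒m≤o L B LB≤n))) ⟩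
        E n b + ½ * ε + ½ * ε                                 ≡⟨ lem (E n b) ε ⟩
        E n b + ε                                             ∎)
    where
    lem : ∀ a ε → a + ½ * ε + ½ * ε ≡ a + ε
    lem = solve-∀ ℚ-ring

-- exp x = lim (1 + x/n)ⁿ, with x replaced by its n-th approximation.
exp : ℝ → ℝ
exp x = mkℝ (λ n → E n (seq x n)) (exp-cauchy x)

opaque
  greatest≤ : (ℕ → ℚ) → ℚ → ℕ → ℕ
  greatest≤ f a zero = zero
  greatest≤ f a (suc b) with f (suc b) ≤? a
  ... | yes _ = suc b
  ... | no  _ = greatest≤ f a b

  greatest≤-spec : ∀ (f : ℕ → ℚ) {a} b → f 0 ≤ a → a < f (suc b) →
    f (greatest≤ f a b) ≤ a × a < f (suc (greatest≤ f a b))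
  greatest≤-spec f     zero    p q = p , q
  greatest≤-spec f {a} (suc b) p q with f (suc b) ≤? a
  ... | yes r = r , q
  ... | no ¬r = greatest≤-spec f b p (≰⇒> ¬r)

-- With n = suc k, logIndex k a is the greatest i such that (i/n²)ⁿ ≤ a (the
-- bound on the search is never attained, see logIndex-spec), and
-- logApprox k a = n (i/n² - 1) is the largest r on the grid of step 1/n such
-- that (1 + r/n)ⁿ ≤ a.
opaque
  logIndex : ℕ → ℚ → ℕ
  logIndex k a = greatest≤ (λ i → (ι i * (u k * u k)) ^ suc k) a (suc k ℕ.* suc k ℕ.* suc (bound a))

  logIndex-spec : ∀ k {a} → 0ℚ ≤ a →
    (ι (logIndex k a) * (u k * u k)) ^ suc k ≤ a × a < (ι (suc (logIndex k a)) * (u k * u k)) ^ suc k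
  logIndex-spec k {a} 0≤a = greatest≤-spec (λ i → (ι i * (v * v)) ^ suc k) b P0 Pb
    where
    c b : ℕ
    c = suc (bound a)
    b = suc k ℕ.* suc k ℕ.* c
    v : ℚ
    v = u k
    P0 : (ι 0 * (v * v)) ^ suc k ≤ a
    P0 = subst (λ z → z ^ suc k ≤ a) (sym (trans (cong (_* (v * v)) ι0) (*-zeroˡ (v * v)))) (subst (_≤ a) (sym (*-zeroˡ (0ℚ ^ k))) 0≤a)
    1≤c : 1ℚ ≤ ι c
    1≤c = subst (_≤ ι c) ι1 (ι-mono {1} {c} (ℕ.s≤s ℕ.z≤n))
    1≤c^ : 1ℚ ≤ ι c ^ k
    1≤c^ = subst (_≤ ι c ^ k) (1^n≡1 k) (^-mono k 0≤1 1≤c)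
    eq : ι b * (v * v) ≡ ι c
    eq = trans (cong (_* (v * v)) (trans (ι-* (suc k ℕ.* suc k) c) (cong (_* ι c) (ι-* (suc k) (suc k)))))
          (trans (lem (ι (suc k)) (ι c) v) (trans (cong (λ z → z * z * ι c) (ι*u k)) (lem₂ (ι c))))
      where
      lem : ∀ n c v → n * n * c * (v * v) ≡ (n * v) * (n * v) * c
      lem = solve-∀ ℚ-ring
      lem₂ : ∀ c → 1ℚ * 1ℚ * c ≡ c
      lem₂ = solve-∀ ℚ-ring
    c≤ : ι c ≤ ι (suc b) * (v * v)
    c≤ = subst (_≤ ι (suc b) * (v * v)) eq
      (*-monoʳ-≤-nonNeg (v * v) {{nonNegative (0≤u k ⊗ 0≤u k)}} (ι-mono (ℕ.n≤1+n b)))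
    c≤c^ : ι c ≤ ι c ^ suc k
    c≤c^ = ≤-cert (ι c * (ι c ^ k - 1ℚ)) (0≤ι c ⊗ 0≤q-p 1≤c^) (lem (ι c) (ι c ^ k))
      where
      lem : ∀ c p → c * p ≡ c + c * (p - 1ℚ)
      lem = solve-∀ ℚ-ring
    a<c : a < ι c
    a<c = ≤-<-trans (≤-bound a) (<-cert 1ℚ 0<1 (trans (ι-suc (bound a)) (+-comm 1ℚ (ι (bound a)))))
    Pb : a < (ι (suc b) * (v * v)) ^ suc k
    Pb = <-≤-trans a<c (≤-trans c≤c^ (^-mono (suc k) (0≤ι c) c≤))

  logApprox : ℕ → ℚ → ℚ
  logApprox k a = ι (logIndex k a) * u k - ι (suc k)

  logApprox-grid : ∀ k a → 1ℚ + logApprox k a * u k ≡ ι (logIndex k a) * (u k * u k)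
  logApprox-grid k a = lem (ι (logIndex k a)) (u k) (ι (suc k)) (ι*u k)
    where
    lem₁ : ∀ i v n → 1ℚ + (i * v - n) * v ≡ 1ℚ - n * v + i * (v * v)
    lem₁ = solve-∀ ℚ-ring
    lem₂ : ∀ z → 1ℚ - 1ℚ + z ≡ z
    lem₂ = solve-∀ ℚ-ring
    lem : ∀ i v n → n * v ≡ 1ℚ → 1ℚ + (i * v - n) * v ≡ i * (v * v)
    lem i v n h = trans (lem₁ i v n) (trans (cong (λ z → 1ℚ - z + i * (v * v)) h) (lem₂ (i * (v * v))))

logApprox-grid⁺ : ∀ k a → 1ℚ + (logApprox k a + u k) * u k ≡ ι (suc (logIndex k a)) * (u k * u k)
logApprox-grid⁺ k a = lem (logApprox k a) (u k) (ι (logIndex k a)) (ι (suc (logIndex k a))) (logApprox-grid k a) (ι-suc (logIndex k a))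
  where
  lem₁ : ∀ r v → 1ℚ + (r + v) * v ≡ 1ℚ + r * v + v * v
  lem₁ = solve-∀ ℚ-ring
  lem₂ : ∀ i v → i * (v * v) + v * v ≡ (1ℚ + i) * (v * v)
  lem₂ = solve-∀ ℚ-ring
  lem : ∀ r v i j → 1ℚ + r * v ≡ i * (v * v) → j ≡ 1ℚ + i → 1ℚ + (r + v) * v ≡ j * (v * v)
  lem r v i j h refl = trans (lem₁ r v) (trans (cong (_+ v * v) h) (lem₂ i v))

log-pos₁ : ∀ k a → 0ℚ ≤ 1ℚ + logApprox k a * u k
log-pos₁ k a = subst (0ℚ ≤_) (sym (logApprox-grid k a)) (0≤ι (logIndex k a) ⊗ (0≤u k ⊗ 0≤u k))

log-pos₂ : ∀ k a → 0ℚ ≤ 1ℚ + (logApprox k a + u k) * u k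
log-pos₂ k a = subst (0ℚ ≤_) (sym (logApprox-grid⁺ k a)) (0≤ι (suc (logIndex k a)) ⊗ (0≤u k ⊗ 0≤u k))

log-spec : ∀ k {a} → 0ℚ ≤ a → E k (logApprox k a) ≤ a × a < E k (logApprox k a + u k)
log-spec k {a} 0≤a =
  subst (_≤ a) (sym (cong (_^ suc k) (logApprox-grid k a))) (proj₁ (logIndex-spec k 0≤a)) ,
  subst (a <_) (sym (cong (_^ suc k) (logApprox-grid⁺ k a))) (proj₂ (logIndex-spec k 0≤a))

E-lower : ∀ {δ s} k → 0ℚ < δ → 0ℚ ≤ 1ℚ + s * u k → δ ≤ E k s → - recip δ ≤ s
E-lower {δ} {s} k 0<δ ps δ≤ with ≤-total 0ℚ s
... | inj₁ 0≤s = ≤-trans (subst (- recip δ ≤_) refl (neg-antimono-≤ (<⇒≤ (0<recip 0<δ)))) 0≤s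
... | inj₂ s≤0 = ≤-cert (1ℚ + R * (1ℚ - δ * (1ℚ + - s)))
      (0≤1 ⊕ <⇒≤ (0<recip 0<δ) ⊗ 0≤q-p h)
      (sym (trans (lem δ R s) (trans (cong (λ z → 1ℚ - z * (1ℚ - s)) (recip-inverse 0<δ)) (lem₂ s))))
  where
  R : ℚ
  R = recip δ
  0≤-s : 0ℚ ≤ - s
  0≤-s = neg-antimono-≤ s≤0
  p-s : 0ℚ ≤ 1ℚ + (- s) * u k
  p-s = 0≤1 ⊕ 0≤-s ⊗ 0≤u k
  h : δ * (1ℚ + - s) ≤ 1ℚ
  h = ≤-trans (*-mono-nn (<⇒≤ 0<δ) (0≤1 ⊕ 0≤-s) δ≤ (E-bernoulli { - s} k p-s)) (E*E⁻≤1 {s} k k ps p-s)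
  lem : ∀ δ R s → - R + (1ℚ + R * (1ℚ - δ * (1ℚ + - s))) ≡ 1ℚ - δ * R * (1ℚ - s)
  lem = solve-∀ ℚ-ring
  lem₂ : ∀ s → 1ℚ - 1ℚ * (1ℚ - s) ≡ s
  lem₂ = solve-∀ ℚ-ring

E-inverse-lip : ∀ {B a b D} k → Bd B a → Bd B b → B ℕ.≤ suc k → ι B * ι B * u k ≤ ½ →
  0ℚ ≤ D → E k a ≤ E k b + D → a ≤ b + (K B + K B) * D
E-inverse-lip {B} {a} {b} {D} k bda bdb hB hk 0≤D h with ≤-total a b
... | inj₁ a≤b = ≤-trans a≤b (≤-cert ((K B + K B) * D) ((0≤K B ⊕ 0≤K B) ⊗ 0≤D) refl)
... | inj₂ b≤a = ≤-cert ((KB + KB) * (Ea - (Eb + n * (a′ - b′) * Q)) + (a - b) * ((KB + KB) * Q - 1ℚ) + (KB + KB) * (Eb + D - Ea))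
    ((0≤KK ⊗ 0≤q-p (^-diff-lower k pb a′≥)) ⊕ (0≤q-p b≤a ⊗ 0≤q-p 1≤2KQ) ⊕ 0≤KK ⊗ 0≤q-p h)
    (sym (trans (lem a b D KB Ea Eb n v Q) (trans (cong (λ z → b + (KB + KB) * D + (KB + KB) * Q * (a - b) * (1ℚ - z)) (ι*u k)) (lem₂ (b + (KB + KB) * D) ((KB + KB) * Q * (a - b))))))
  where
  KB Ea Eb n v a′ b′ Q T : ℚ
  KB = K B
  Ea = E k a
  Eb = E k b
  n = ι (suc k)
  v = u k
  a′ = 1ℚ + a * v
  b′ = 1ℚ + b * v
  Q = b′ ^ k
  T = 1ℚ + (- ι B) * v
  0≤KK : 0ℚ ≤ KB + KB
  0≤KK = 0≤K B ⊕ 0≤K B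
  pb : 0ℚ ≤ b′
  pb = 0≤1+au {B} {b} {k} bdb hB
  lem₀ : ∀ a b v → 1ℚ + a * v ≡ 1ℚ + b * v + (a - b) * v
  lem₀ = solve-∀ ℚ-ring
  a′≥ : b′ ≤ a′
  a′≥ = ≤-cert ((a - b) * v) (0≤q-p b≤a ⊗ 0≤u k) (lem₀ a b v)
  bdB = Bd-top B
  0≤T : 0ℚ ≤ T
  0≤T = 0≤1+au {B} { - ι B} {k} (Bd-neg {B} {ι B} bdB) hB
  0≤T⁺ : 0ℚ ≤ 1ℚ + ι B * v
  0≤T⁺ = 0≤1+au {B} {ι B} {k} bdB hB
  T≤1 : T ≤ 1ℚ
  T≤1 = ≤-cert (ι B * v) (0≤ι B ⊗ 0≤u k) (lem₁ (ι B) v)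
    where
    lem₁ : ∀ b v → 1ℚ ≡ 1ℚ + (- b) * v + b * v
    lem₁ = solve-∀ ℚ-ring
  T≤b′ : T ≤ b′
  T≤b′ = ≤-cert ((b - - ι B) * v) (0≤q-p (proj₁ bdb) ⊗ 0≤u k) (lem₀ b (- ι B) v)
  T^≤Q : T ^ suc k ≤ Q
  T^≤Q = ≤-trans (≤-cert ((1ℚ - T) * T ^ k) (0≤q-p T≤1 ⊗ ^-nonNeg k 0≤T) (lem₁ T (T ^ k))) (^-mono k 0≤T T≤b′)
    where
    lem₁ : ∀ t p → p ≡ t * p + (1ℚ - t) * p
    lem₁ = solve-∀ ℚ-ring
  ½≤KQ : 1ℚ - ½ ≤ KB * Q
  ½≤KQ = ≤-trans (+-monoʳ-≤ 1ℚ (neg-antimono-≤ hk)) (≤-trans (E*E⁻-lower {ι B} k 0≤T⁺ 0≤T)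
     (*-mono-nn (E-nonNeg {ι B} k 0≤T⁺) (E-nonNeg { - ι B} k 0≤T) (E≤K {B} {ι B} k bdB hB) T^≤Q))
  1≤2KQ : 1ℚ ≤ (KB + KB) * Q
  1≤2KQ = ≤-cert ((1ℚ + 1ℚ) * (KB * Q - (1ℚ - ½))) ((0≤1 ⊕ 0≤1) ⊗ 0≤q-p ½≤KQ) (lem₁ KB Q)
    where
    lem₁ : ∀ k q → (k + k) * q ≡ 1ℚ + (1ℚ + 1ℚ) * (k * q - (1ℚ - ½))
    lem₁ = solve-∀ ℚ-ring
  lem : ∀ a b D K Ea Eb n v Q →
    a + ((K + K) * (Ea - (Eb + n * (1ℚ + a * v - (1ℚ + b * v)) * Q)) + (a - b) * ((K + K) * Q - 1ℚ) + (K + K) * (Eb + D - Ea))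
    ≡ b + (K + K) * D + (K + K) * Q * (a - b) * (1ℚ - n * v)
  lem = solve-∀ ℚ-ring
  lem₂ : ∀ x y → x + y * (1ℚ - 1ℚ) ≡ x
  lem₂ = solve-∀ ℚ-ring

opaque
  log-bounds : ∀ x → 0ℝ <ℝ x → ∃[ B ] Eventually λ k →
    0ℚ ≤ seq x k × Bd B (logApprox k (seq x k)) × Bd B (logApprox k (seq x k) + u k)
  log-bounds x (δ , 0<δ , N , hN) =
    let M , P , hM = eventually-bounded x
        C = bound (recip δ)
        B = M ℕ.+ suc C
    in B , N ℕ.⊔ P , λ k hk →
      let a = seq x k ; r = logApprox k a
          δ≤a = subst (_≤ a) (+-identityˡ δ) (hN k (ℕ.m⊔n≤o⇒m≤o N P hk))
          0≤a = ≤-trans (<⇒≤ 0<δ) δ≤a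
          a≤M = ≤-trans (p≤∣p∣ a) (hM k (ℕ.m⊔n≤o⇒n≤o N P hk))
          lo , hi = log-spec k 0≤a
          1+r≤M = ≤-trans (E-bernoulli {r} k (log-pos₁ k a)) (≤-trans lo a≤M)
          s≥ = ≤-trans (neg-antimono-≤ (≤-bound (recip δ))) (E-lower {δ} {r + u k} k 0<δ (log-pos₂ k a) (≤-trans δ≤a (<⇒≤ hi)))
          r+u≤M = ≤-cert (ι M - (1ℚ + r) + (1ℚ - u k)) (0≤q-p 1+r≤M ⊕ 0≤q-p (u≤1 k)) (lem₁ (ι M) r (u k))
          eqB = trans (ι-+ M (suc C)) (cong (λ z → ι M + z) (ι-suc C))
          M≤B = ι-mono {M} {B} (ℕ.m≤m+n M (suc C))
          r≤r+u = ≤-cert {r} {r + u k} (u k) (0≤u k) refl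
          -B≤r = subst (λ z → - z ≤ r) (sym eqB)
                   (≤-cert (r + u k - - ι C + (1ℚ - u k) + ι M) (0≤q-p s≥ ⊕ 0≤q-p (u≤1 k) ⊕ 0≤ι M) (lem₂ (ι M) (ι C) r (u k)))
      in 0≤a , (-B≤r , ≤-trans r≤r+u (≤-trans r+u≤M M≤B)) , (≤-trans -B≤r r≤r+u , ≤-trans r+u≤M M≤B)
    where
    lem₁ : ∀ M r v → M ≡ r + v + (M - (1ℚ + r) + (1ℚ - v))
    lem₁ = solve-∀ ℚ-ring
    lem₂ : ∀ M C r v → r ≡ - (M + (1ℚ + C)) + (r + v - - C + (1ℚ - v) + M)
    lem₂ = solve-∀ ℚ-ring

log-near : ∀ {B} k {a} → 0ℚ ≤ a → Bd B (logApprox k a) → Bd B (logApprox k a + u k) → B ℕ.≤ suc k →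
  a ≤ E k (logApprox k a) + K B * u k
log-near {B} k {a} 0≤a bd bd′ h = ≤-trans (<⇒≤ (proj₂ (log-spec k 0≤a)))
  (subst (λ z → E k (r + u k) ≤ E k r + K B * z) (lem r (u k))
    (E-lip {B} {r + u k} {r} k bd′ bd h (≤-cert (u k) (0≤u k) refl)))
  where
  r : ℚ
  r = logApprox k a
  lem : ∀ r v → r + v - r ≡ v
  lem = solve-∀ ℚ-ring

opaque
  log-cauchy : ∀ x → 0ℝ <ℝ x → IsCauchy (λ k → logApprox k (seq x k))
  log-cauchy x 0<x = (mkCauchy λ ε 0<ε →
    let B , N , hN = log-bounds x 0<x
        KK = K B + K B
        0≤KK = 0≤K B ⊕ 0≤K B
        b² = ι B * ι B
        0≤b² = 0≤ι B ⊗ 0≤ι B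
        3KK = (1ℚ + 1ℚ + 1ℚ) * KK
        η , 0<η , hη = shrink 3KK ε ((0≤1 ⊕ 0≤1 ⊕ 0≤1) ⊗ 0≤KK) 0<ε
        M₁ , h₁ = cauchy x η 0<η
        M₂ , h₂ = archimedean (K B * b²) η (0≤K B ⊗ 0≤b²) 0<η
        M₃ , h₃ = archimedean (K B) η (0≤K B) 0<η
        M₄ , h₄ = archimedean b² ½ 0≤b² (positive⁻¹ ½)
        M₅ = N ℕ.⊔ B ; M₆ = M₁ ℕ.⊔ M₂ ; M₇ = M₃ ℕ.⊔ M₄ ; M₈ = M₆ ℕ.⊔ M₇
    in M₅ ℕ.⊔ M₈ , λ k l hk hl →
      let k₅ = ℕ.m⊔n≤o⇒m≤o M₅ M₈ hk
          k₈ = ℕ.m⊔n≤o⇒n≤o M₅ M₈ hk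
          k₆ = ℕ.m⊔n≤o⇒m≤o M₆ M₇ k₈
          k₇ = ℕ.m⊔n≤o⇒n≤o M₆ M₇ k₈
          l₅ = ℕ.m⊔n≤o⇒m≤o M₅ M₈ hl
          l₈ = ℕ.m⊔n≤o⇒n≤o M₅ M₈ hl
          l₆ = ℕ.m⊔n≤o⇒m≤o M₆ M₇ l₈
          l₇ = ℕ.m⊔n≤o⇒n≤o M₆ M₇ l₈
          0≤xk , bdk , bdk′ = hN k (ℕ.m⊔n≤o⇒m≤o N B k₅)
          0≤xl , bdl , bdl′ = hN l (ℕ.m⊔n≤o⇒m≤o N B l₅)
          B≤k = ℕ.m≤n⇒m≤1+n (ℕ.m⊔n≤o⇒n≤o N B k₅)
          B≤l = ℕ.m≤n⇒m≤1+n (ℕ.m⊔n≤o⇒n≤o N B l₅)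
          xk = seq x k ; xl = seq x l
          rk = logApprox k xk ; rl = logApprox l xl
          open ≤-Reasoning
          E≤ : E k rk ≤ E k rl + (1ℚ + 1ℚ + 1ℚ) * η
          E≤ = begin
            E k rk                                      ≤⟨ proj₁ (log-spec k 0≤xk) ⟩
            xk                                          ≤⟨ ∣-∣⇒≤ {xk} {xl} (h₁ k l (ℕ.m⊔n≤o⇒m≤o M₁ M₂ k₆) (ℕ.m⊔n≤o⇒m≤o M₁ M₂ l₆)) ⟩
            xl + η                                      ≤⟨ +-monoˡ-≤ η (log-near {B} l 0≤xl bdl bdl′ B≤l) ⟩
            E l rl + K B * u l + η                      ≤⟨ +-monoˡ-≤ η (+-mono-≤ (E-compare {B} {rl} l k bdl B≤l B≤k) (h₃ l (ℕ.m⊔n≤o⇒m≤o M₃ M₄ l₇))) ⟩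
            E k rl + K B * b² * u k + η + η             ≤⟨ +-monoˡ-≤ η (+-monoˡ-≤ η (+-monoʳ-≤ (E k rl) (h₂ k (ℕ.m⊔n≤o⇒n≤o M₁ M₂ k₆)))) ⟩
            E k rl + η + η + η                          ≡⟨ lem (E k rl) η ⟩
            E k rl + (1ℚ + 1ℚ + 1ℚ) * η                 ∎
      in begin
        rk                                         ≤⟨ E-inverse-lip {B} {rk} {rl} k bdk bdl B≤k (h₄ k (ℕ.m⊔n≤o⇒n≤o M₃ M₄ k₇)) ((0≤1 ⊕ 0≤1 ⊕ 0≤1) ⊗ <⇒≤ 0<η) E≤ ⟩
        rl + KK * ((1ℚ + 1ℚ + 1ℚ) * η)             ≡⟨ lem₂ rl KK η ⟩
        rl + 3KK * η                               ≤⟨ +-monoʳ-≤ rl hη ⟩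
        rl + ε                                     ∎)
    where
    lem : ∀ a η → a + η + η + η ≡ a + (1ℚ + 1ℚ + 1ℚ) * η
    lem = solve-∀ ℚ-ring
    lem₂ : ∀ r k η → r + k * ((1ℚ + 1ℚ + 1ℚ) * η) ≡ r + (1ℚ + 1ℚ + 1ℚ) * k * η
    lem₂ = solve-∀ ℚ-ring

-- The inverse of exp on the positive reals, see exp-log.  The proof of 0 < x
-- is used only for the Cauchy property.
log : (x : ℝ) → 0ℝ <ℝ x → ℝ
log x 0<x = mkℝ (λ k → logApprox k (seq x k)) (log-cauchy x 0<x)

exp-log : ∀ x (0<x : 0ℝ <ℝ x) → exp (log x 0<x) ≃ℝ x
exp-log x 0<x ε 0<ε =
  let B , N , hN = log-bounds x 0<x
      M , hM = archimedean (K B) ε (0≤K B) 0<ε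
  in N ℕ.⊔ (M ℕ.⊔ B) , λ k hk →
    let k₁ = ℕ.m⊔n≤o⇒n≤o N (M ℕ.⊔ B) hk
        0≤a , bd , bd′ = hN k (ℕ.m⊔n≤o⇒m≤o N (M ℕ.⊔ B) hk)
        B≤k = ℕ.m≤n⇒m≤1+n (ℕ.m⊔n≤o⇒n≤o M B k₁)
        a = seq x k ; r = logApprox k a
    in ≤≤⇒∣-∣ {E k r} {a}
         (≤-trans (proj₁ (log-spec k 0≤a)) (≤-cert ε (<⇒≤ 0<ε) refl))
         (≤-trans (log-near {B} k 0≤a bd bd′ B≤k) (+-monoʳ-≤ (E k r) (hM k (ℕ.m⊔n≤o⇒m≤o M B k₁))))

opaque
  log-lower : ∀ {x c d} (0<x : 0ℝ <ℝ x) → c < d → Eventually (λ k → E k d ≤ seq x k) → fromℚ c <ℝ log x 0<x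
  log-lower {x} {c} {d} 0<x c<d (P , hP) =
    let ε = ½ * (d - c)
        0<ε = half (0<q-p c<d)
        B , N , hN = log-bounds x 0<x
        M , hM = archimedean 1ℚ ε 0≤1 0<ε
    in ε , 0<ε , P ℕ.⊔ (N ℕ.⊔ M) , λ k hk →
      let k₁ = ℕ.m⊔n≤o⇒n≤o P (N ℕ.⊔ M) hk
          0≤a , _ , _ = hN k (ℕ.m⊔n≤o⇒m≤o N M k₁)
          a = seq x k ; r = logApprox k a
          u≤ε = subst (_≤ ε) (*-identityˡ (u k)) (hM k (ℕ.m⊔n≤o⇒n≤o N M k₁))
          d≤r+u : d ≤ r + u k
          d≤r+u = ≮⇒≥ λ r+u<d → <-irrefl refl (<-≤-trans (proj₂ (log-spec k 0≤a))
            (≤-trans (E-mono {r + u k} {d} k (log-pos₂ k a) (<⇒≤ r+u<d)) (hP k (ℕ.m⊔n≤o⇒m≤o P (N ℕ.⊔ M) hk))))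
      in ≤-cert ((r + u k - d) + (ε - u k)) (0≤q-p d≤r+u ⊕ 0≤q-p u≤ε) (lem c d r (u k))
    where
    lem : ∀ c d r v → r ≡ c + ½ * (d - c) + ((r + v - d) + (½ * (d - c) - v))
    lem = solve-∀ ℚ-ring

opaque
  0<log : ∀ {x} (0<x : 0ℝ <ℝ x) → 1ℝ <ℝ x → 0ℝ <ℝ log x 0<x
  0<log {x} 0<x (ε , 0<ε , N , hN) = log-lower {x} {0ℚ} {c} 0<x 0<c (N , λ k hk → ≤-trans (E≤ k) (hN k hk))
    where
    R c : ℚ
    0<1+ε : 0ℚ < 1ℚ + ε
    0<1+ε = +-mono-<-≤ 0<1 (<⇒≤ 0<ε)
    R = recip (1ℚ + ε)
    c = ε * R
    0<c : 0ℚ < c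
    0<c = 0<* 0<ε (0<recip 0<1+ε)
    1-c : 1ℚ + - c ≡ R
    1-c = trans (cong (_+ - c) (sym (recip-inverse 0<1+ε))) (lem ε R)
      where
      lem : ∀ ε r → (1ℚ + ε) * r + - (ε * r) ≡ r
      lem = solve-∀ ℚ-ring
    E≤ : ∀ k → E k c ≤ 1ℚ + ε
    E≤ k = ≤-cert ((1ℚ + ε) * (1ℚ - E k c * R)) (<⇒≤ 0<1+ε ⊗ 0≤q-p h)
      (sym (trans (lem ε R (E k c)) (trans (cong (λ z → 1ℚ + ε + (1ℚ - z) * E k c) (recip-inverse 0<1+ε)) (lem₂ (1ℚ + ε) (E k c)))))
      where
      p⁺ : 0ℚ ≤ 1ℚ + c * u k
      p⁺ = 0≤1 ⊕ <⇒≤ 0<c ⊗ 0≤u k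
      p⁻ : 0ℚ ≤ 1ℚ + (- c) * u k
      p⁻ = subst (0ℚ ≤_) (lem₃ c (u k)) ((subst (0ℚ ≤_) (sym 1-c) (<⇒≤ (0<recip 0<1+ε))) ⊕ <⇒≤ 0<c ⊗ 0≤q-p (u≤1 k))
        where
        lem₃ : ∀ c v → 1ℚ + - c + c * (1ℚ - v) ≡ 1ℚ + (- c) * v
        lem₃ = solve-∀ ℚ-ring
      h : E k c * R ≤ 1ℚ
      h = ≤-trans (*-mono-nn (E-nonNeg {c} k p⁺) (<⇒≤ (0<recip 0<1+ε)) ≤-refl
            (subst (_≤ E k (- c)) 1-c (E-bernoulli { - c} k p⁻))) (E*E⁻≤1 {c} k k p⁺ p⁻)
      lem : ∀ ε R X → X + (1ℚ + ε) * (1ℚ - X * R) ≡ 1ℚ + ε + (1ℚ - (1ℚ + ε) * R) * X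
      lem = solve-∀ ℚ-ring
      lem₂ : ∀ a X → a + (1ℚ - 1ℚ) * X ≡ a
      lem₂ = solve-∀ ℚ-ring

1<⇒0< : ∀ {x} → 1ℝ <ℝ x → 0ℝ <ℝ x
1<⇒0< {x} (ε , 0<ε , N , h) = ε , 0<ε , N , λ n hn → ≤-trans (+-monoˡ-≤ ε 0≤1) (h n hn)

pow : (x : ℝ) → 0ℝ <ℝ x → ℝ → ℝ
pow x 0<x y = exp (y *ℝ log x 0<x)

0<n : ∀ {n} → 3 ℕ.≤ n → 0ℝ <ℝ fromℕ n
0<n {n} h = 1ℚ , 0<1 , 0 , λ _ _ → subst (_≤ ι n) (trans ι1 (sym (+-identityˡ 1ℚ))) (ι-mono {1} {n} (ℕ.≤-trans (ℕ.s≤s ℕ.z≤n) h))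

opaque
  unfolding ι u

  -- (1 - 1.001/6)⁻⁶ ≤ 3
  numeric : 0ℚ ≤ 1ℚ + (- (+ 1001 / 1000)) * u 5 × 1ℚ ≤ ι 3 * E 5 (- (+ 1001 / 1000))
  numeric = from-yes (0ℚ ≤? 1ℚ + (- (+ 1001 / 1000)) * u 5) , from-yes (1ℚ ≤? ι 3 * E 5 (- (+ 1001 / 1000)))

opaque
  1<log : ∀ {n} (3≤n : 3 ℕ.≤ n) → 1ℝ <ℝ log (fromℕ n) (0<n 3≤n)
  1<log {n} 3≤n = log-lower {fromℕ n} {1ℚ} {c} (0<n 3≤n) (from-yes (1ℚ <? c)) (0 , λ k _ → ≤-trans (E≤ k) (ι-mono {3} {n} 3≤n))
    where
    c G : ℚ
    c = + 1001 / 1000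
    G = E 5 (- c)
    E≤ : ∀ k → E k c ≤ ι 3
    E≤ k = ≤-cert (ι 3 * (1ℚ - X * G) + X * (ι 3 * G - 1ℚ))
      (0≤ι 3 ⊗ 0≤q-p (E*E⁻≤1 {c} k 5 p⁺ (proj₁ numeric)) ⊕ E-nonNeg {c} k p⁺ ⊗ 0≤q-p (proj₂ numeric))
      (lem (ι 3) X G)
      where
      X : ℚ
      X = E k c
      p⁺ : 0ℚ ≤ 1ℚ + c * u k
      p⁺ = 0≤1 ⊕ nonNegative⁻¹ c ⊗ 0≤u k
      lem : ∀ t X G → t ≡ X + (t * (1ℚ - X * G) + X * (t * G - 1ℚ))
      lem = solve-∀ ℚ-ring

logℕ : ∀ {n} → 3 ℕ.≤ n → ℝ
logℕ {n} 3≤n = log (fromℕ n) (0<n 3≤n)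

0<logℕ : ∀ {n} (3≤n : 3 ℕ.≤ n) → 0ℝ <ℝ logℕ 3≤n
0<logℕ 3≤n = 1<⇒0< {logℕ 3≤n} (1<log 3≤n)

loglogℕ : ∀ {n} → 3 ℕ.≤ n → ℝ
loglogℕ 3≤n = log (logℕ 3≤n) (0<logℕ 3≤n)

0<loglogℕ : ∀ {n} (3≤n : 3 ℕ.≤ n) → 0ℝ <ℝ loglogℕ 3≤n
0<loglogℕ 3≤n = 0<log {logℕ 3≤n} (0<logℕ 3≤n) (1<log 3≤n)

{-# OPTIONS --safe #-}

-- Let I have length H = 3nD.  By Hall's theorem it suffices that no set S of k
-- integers in [1, n] has its multiples in I contained in a set N of at most k
-- elements.  For x in the middle third of I, let d(x) be the number of s ∈ S
-- dividing x.  Each s ∈ S has at least D multiples x there, so Cauchy–Schwarz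
-- gives Σ d(x)² ≥ kD².  If s divides x, then x ± sj (1 ≤ j ≤ D) are D pairs of
-- points of N symmetric about x; a pair is obtained from at most T elements s,
-- where T bounds the number of divisors of the integers up to H.  Hence
-- D d(x) ≤ T r(x), where r(x) is the number of (p, q) ∈ N² with p + q = 2x.
-- Finally Σ d(x) r(x) counts at most the triples (t, p, q) with t ∈ S and
-- t ∣ p + q.  For each t, comparing the residue classes a and -a bounds it by the
-- number of triples with t ∣ p - q, which is at most k² + Tk².  Altogether
-- D³ ≤ T(T + 1)k, which fails once D³ > T(T + 1)n.  The divisor bound
-- T ≤ exp(O(log n / log log n)) then gives H³ ≤ n⁴ exp(O(log n / log log n)).

module Submission where

-- Combinatorics and divisors: an integer bound for F(n)³

module Arithmetic where

  import Data.Integer as ℤ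
  import Data.Integer.DivMod as ℤ
  import Data.Integer.Divisibility.Signed as ℤ
  import Data.Integer.Properties as ℤ
  open import Defs using (HasMultiples; Admissible; F; F-isLeast)
  open import Algebra.Properties.AbelianGroup ℤ.+-0-abelianGroup using (∙-cancelʳ)
  open import Data.Fin using (Fin; toℕ)
  open import Data.Fin.Properties using (toℕ<n; toℕ-injective)
  open import Data.Integer using (ℤ)
  open import Data.Integer.Tactic.RingSolver using () renaming (solve-∀ to solve-ℤ)
  open import Data.List using (List; []; _∷_; map; length; filter; upTo; _++_)
  open import Data.List.Membership.DecPropositional as DecMembership using ()
  open import Data.List.Membership.Propositional using (_∈_; _∉_; find; lose)
  open import Data.List.Membership.Propositional.Properties
  open import Data.List.Properties using (length-map; length-++; length-upTo; length-filter; map-++)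
  open import Data.List.Relation.Binary.Permutation.Propositional using (_↭_; ↭-refl; ↭-sym; ↭-trans; ↭-prep; ↭-swap; ↭-reflexive; ↭⇒↭ₛ)
  import Data.List.Relation.Binary.Permutation.Propositional.Properties as ↭
  import Data.List.Relation.Binary.Permutation.Setoid.Properties as ↭ₛ
  open import Data.List.Relation.Unary.All as All using (All; []; _∷_)
  import Data.List.Relation.Unary.All.Properties as All
  open import Data.List.Relation.Unary.AllPairs using ([]; _∷_)
  open import Data.List.Relation.Unary.Any as Any using (Any; here; there)
  open import Data.List.Relation.Unary.Unique.Propositional using (Unique)
  import Data.List.Relation.Unary.Unique.Propositional.Properties as Unique
  open import Data.Nat
  open import Data.Nat.Coprimality using (coprime-divisor)
  open import Data.Nat.Divisibility
  open import Data.Nat.DivMod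
  open import Data.Nat.Induction using (<-wellFounded)
  open import Data.Nat.ListAction using (sum; product)
  open import Data.Nat.Primality
  open import Data.Nat.Primality.Factorisation using (factorise)
  open import Data.Nat.Properties
  open import Data.Nat.Tactic.RingSolver using (solve-∀)
  open import Data.Product using (_×_; _,_; ∃-syntax; proj₁; proj₂)
  open import Data.Sum using (_⊎_; inj₁; inj₂)
  open import Data.Empty using (⊥-elim)
  open import Function using (_∘_)
  open import Induction.WellFounded using (Acc; acc)
  open import Level using (Level)
  open import Relation.Binary.Definitions using (DecidableEquality)
  open import Relation.Binary.PropositionalEquality
  open import Relation.Nullary using (Dec; yes; no; ¬_)
  open import Relation.Nullary.Decidable using (_×-dec_; ¬?; decidable-stable)

  private variable
    a b p : Level
    A B : Set a
    P : Set p

  -- Sums over lists and double counting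

  ∑ : List A → (A → ℕ) → ℕ
  ∑ xs f = sum (map f xs)

  ∑-mono : ∀ (xs : List A) {f g : A → ℕ} → (∀ {x} → x ∈ xs → f x ≤ g x) → ∑ xs f ≤ ∑ xs g
  ∑-mono []       h = z≤n
  ∑-mono (x ∷ xs) h = +-mono-≤ (h (here refl)) (∑-mono xs (h ∘ there))

  ∑-cong : ∀ (xs : List A) {f g : A → ℕ} → (∀ x → f x ≡ g x) → ∑ xs f ≡ ∑ xs g
  ∑-cong []       h = refl
  ∑-cong (x ∷ xs) h = cong₂ _+_ (h x) (∑-cong xs h)

  ∑-const : ∀ (xs : List A) c → ∑ xs (λ _ → c) ≡ length xs * c
  ∑-const []       c = refl
  ∑-const (x ∷ xs) c = cong (c +_) (∑-const xs c)

  ∑-+ : ∀ (xs : List A) (f g : A → ℕ) → ∑ xs (λ x → f x + g x) ≡ ∑ xs f + ∑ xs g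
  ∑-+ []       f g = refl
  ∑-+ (x ∷ xs) f g = trans (cong (f x + g x +_) (∑-+ xs f g)) (interchange (f x) (g x) (∑ xs f) (∑ xs g))
    where
    interchange : ∀ a b c d → a + b + (c + d) ≡ a + c + (b + d)
    interchange = solve-∀

  ∑-*ˡ : ∀ (xs : List A) c (f : A → ℕ) → ∑ xs (λ x → c * f x) ≡ c * ∑ xs f
  ∑-*ˡ []       c f = sym (*-zeroʳ c)
  ∑-*ˡ (x ∷ xs) c f = trans (cong (c * f x +_) (∑-*ˡ xs c f)) (sym (*-distribˡ-+ c (f x) (∑ xs f)))

  ∑-*ʳ : ∀ (xs : List A) (f : A → ℕ) c → ∑ xs (λ x → f x * c) ≡ ∑ xs f * c
  ∑-*ʳ xs f c = trans (∑-cong xs (λ x → *-comm (f x) c)) (trans (∑-*ˡ xs c f) (*-comm c (∑ xs f)))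

  ∑-swap : ∀ (xs : List A) (ys : List B) (f : A → B → ℕ) →
    ∑ xs (λ x → ∑ ys (f x)) ≡ ∑ ys (λ y → ∑ xs (λ x → f x y))
  ∑-swap []       ys f = sym (trans (∑-const ys 0) (*-zeroʳ (length ys)))
  ∑-swap (x ∷ xs) ys f = trans (cong (∑ ys (f x) +_) (∑-swap xs ys f))
    (sym (∑-+ ys (f x) (λ y → ∑ xs (λ x → f x y))))

  ∑-*-∑ : ∀ (xs : List A) (ys : List B) (f : A → ℕ) (g : B → ℕ) →
    ∑ xs f * ∑ ys g ≡ ∑ xs (λ x → ∑ ys (λ y → f x * g y))
  ∑-*-∑ xs ys f g = trans (sym (∑-*ʳ xs f (∑ ys g))) (∑-cong xs (λ x → sym (∑-*ˡ ys (f x) g)))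

  2ab≤a²+b² : ∀ a b → 2 * (a * b) ≤ a * a + b * b
  2ab≤a²+b² a b = case (≤-total a b)
    where
    lem : ∀ a d → 2 * (a * (a + d)) + d * d ≡ a * a + (a + d) * (a + d)
    lem = solve-∀
    ordered : ∀ {a b} → a ≤ b → 2 * (a * b) ≤ a * a + b * b
    ordered {a} {b} a≤b = subst (λ b → 2 * (a * b) ≤ a * a + b * b) (m+[n∸m]≡n a≤b)
      (≤-trans (m≤m+n _ ((b ∸ a) * (b ∸ a))) (≤-reflexive (lem a (b ∸ a))))
    case : a ≤ b ⊎ b ≤ a → 2 * (a * b) ≤ a * a + b * b
    case (inj₁ h) = ordered h
    case (inj₂ h) = subst₂ _≤_ (cong (2 *_) (*-comm b a)) (+-comm (b * b) (a * a)) (ordered h)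

  -- Sum 2 f(x) f(y) ≤ f(x)² + f(y)² over all pairs (x, y).
  cauchy-schwarz : ∀ (xs : List A) (f : A → ℕ) → ∑ xs f * ∑ xs f ≤ length xs * ∑ xs (λ x → f x * f x)
  cauchy-schwarz xs f = *-cancelˡ-≤ 2 (begin
    2 * (∑ xs f * ∑ xs f)                                  ≡⟨ cong (2 *_) (∑-*-∑ xs xs f f) ⟩
    2 * ∑ xs (λ x → ∑ xs (λ y → f x * f y))                ≡⟨ trans (sym (∑-*ˡ xs 2 _)) (∑-cong xs (λ x → sym (∑-*ˡ xs 2 _))) ⟩
    ∑ xs (λ x → ∑ xs (λ y → 2 * (f x * f y)))              ≤⟨ ∑-mono xs (λ {x} _ → ∑-mono xs (λ {y} _ → 2ab≤a²+b² (f x) (f y))) ⟩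
    ∑ xs (λ x → ∑ xs (λ y → f x * f x + f y * f y))        ≡⟨ ∑-cong xs (λ x → trans (∑-+ xs _ _) (cong (_+ S) (∑-const xs (f x * f x)))) ⟩
    ∑ xs (λ x → length xs * (f x * f x) + S)               ≡⟨ trans (∑-+ xs _ _) (cong₂ _+_ (∑-*ˡ xs (length xs) _) (∑-const xs S)) ⟩
    length xs * S + length xs * S                          ≡⟨ double (length xs * S) ⟩
    2 * (length xs * S)                                    ∎)
    where
    open ≤-Reasoning
    S = ∑ xs (λ x → f x * f x)
    double : ∀ m → m + m ≡ 2 * m
    double = solve-∀

  -- Indicators and counting

  𝟙 : Dec P → ℕ
  𝟙 (yes _) = 1
  𝟙 (no _)  = 0

  𝟙-yes : (P? : Dec P) → P → 𝟙 P? ≡ 1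
  𝟙-yes (yes _) p = refl
  𝟙-yes (no ¬p) p = ⊥-elim (¬p p)

  𝟙-no : (P? : Dec P) → ¬ P → 𝟙 P? ≡ 0
  𝟙-no (yes p) ¬p = ⊥-elim (¬p p)
  𝟙-no (no _)  ¬p = refl

  𝟙-≤ : (P? : Dec P) {m : ℕ} → (P → 1 ≤ m) → 𝟙 P? ≤ m
  𝟙-≤ (yes p) h = h p
  𝟙-≤ (no _)  h = z≤n

  𝟙-*-≤ : (P? : Dec P) {m o : ℕ} → (P → m ≤ o) → 𝟙 P? * m ≤ o
  𝟙-*-≤ (yes p) {m} h = ≤-trans (≤-reflexive (*-identityˡ m)) (h p)
  𝟙-*-≤ (no _)      h = z≤n

  ∑-none : ∀ {P : A → Set p} (P? : ∀ x → Dec (P x)) (xs : List A) → (∀ {x} → x ∈ xs → ¬ P x) → ∑ xs (𝟙 ∘ P?) ≡ 0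
  ∑-none P? []       h = refl
  ∑-none P? (x ∷ xs) h = cong₂ _+_ (𝟙-no (P? x) (h (here refl))) (∑-none P? xs (h ∘ there))

  ∑-atMostOne : ∀ {P : A → Set p} (P? : ∀ x → Dec (P x)) {xs : List A} → Unique xs →
    (∀ {x y} → x ∈ xs → y ∈ xs → P x → P y → x ≡ y) → ∑ xs (𝟙 ∘ P?) ≤ 1
  ∑-atMostOne P? {[]}     _          h = z≤n
  ∑-atMostOne P? {x ∷ xs} (x∉ ∷ uxs) h with P? x
  ... | yes px = ≤-reflexive (cong suc (∑-none P? xs λ y∈ py → All.lookup x∉ y∈ (h (here refl) (there y∈) px py)))
  ... | no _   = ∑-atMostOne P? uxs λ x∈ y∈ → h (there x∈) (there y∈)

  ∑-member : ∀ {x} {xs : List A} (f : A → ℕ) → x ∈ xs → f x ≤ ∑ xs f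
  ∑-member f (here refl) = m≤m+n _ _
  ∑-member f (there x∈)  = ≤-trans (∑-member f x∈) (m≤n+m _ _)

  -- Double counting of the pairs (i , x) with Q i x.
  ∑-embedding : ∀ D {P : A → Set p} (P? : ∀ x → Dec (P x)) {Q : ℕ → A → Set b} (Q? : ∀ i x → Dec (Q i x)) (xs : List A) →
    (∀ i → i < D → ∃[ x ] x ∈ xs × P x × Q i x) →
    (∀ x {i j} → Q i x → Q j x → i ≡ j) → D ≤ ∑ xs (𝟙 ∘ P?)
  ∑-embedding D P? Q? xs h inj = begin
    D                                                     ≡⟨ sym (length-upTo D) ⟩
    length (upTo D)                                       ≡⟨ sym (trans (∑-const (upTo D) 1) (*-identityʳ _)) ⟩
    ∑ (upTo D) (λ _ → 1)                                  ≤⟨ ∑-mono (upTo D) step ⟩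
    ∑ (upTo D) (λ i → ∑ xs (λ x → 𝟙 (P? x) * 𝟙 (Q? i x))) ≡⟨ ∑-swap (upTo D) xs _ ⟩
    ∑ xs (λ x → ∑ (upTo D) (λ i → 𝟙 (P? x) * 𝟙 (Q? i x))) ≡⟨ ∑-cong xs (λ x → ∑-*ˡ (upTo D) (𝟙 (P? x)) _) ⟩
    ∑ xs (λ x → 𝟙 (P? x) * ∑ (upTo D) (λ i → 𝟙 (Q? i x))) ≤⟨ ∑-mono xs (λ {x} _ → ≤-trans
       (*-monoʳ-≤ (𝟙 (P? x)) (∑-atMostOne (λ i → Q? i x) (Unique.upTo⁺ D) (λ _ _ → inj x))) (≤-reflexive (*-identityʳ _))) ⟩
    ∑ xs (𝟙 ∘ P?)                                         ∎
    where
    open ≤-Reasoning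
    step : ∀ {i} → i ∈ upTo D → 1 ≤ ∑ xs (λ x → 𝟙 (P? x) * 𝟙 (Q? i x))
    step {i} i∈ with h i (∈-upTo⁻ i∈)
    ... | x , x∈ , px , qx = ≤-trans (≤-reflexive (sym (cong₂ _*_ (𝟙-yes (P? x) px) (𝟙-yes (Q? i x) qx))))
                               (∑-member (λ x → 𝟙 (P? x) * 𝟙 (Q? i x)) x∈)

  -- The number of pairs summing to 0 mod t is at most the number of pairs of
  -- congruent elements: for bₐ elements in the class of a, 2 bₐ b₋ₐ ≤ bₐ² + b₋ₐ².
  ∑-antipodal : ∀ t .{{_ : NonZero t}} (xs : List ℕ) →
    ∑ xs (λ p → ∑ xs (λ q → 𝟙 (t ∣? p + q))) ≤ ∑ xs (λ p → ∑ xs (λ q → 𝟙 (t ∣? ∣ p - q ∣)))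
  ∑-antipodal t xs = *-cancelˡ-≤ 2 (begin
    2 * ∑ xs (λ p → ∑ xs (λ q → 𝟙 (t ∣? p + q)))            ≤⟨ *-monoʳ-≤ 2 (∑-mono xs (λ {p} _ → ∑-mono xs (λ {q} _ → split p q))) ⟩
    2 * ∑ xs (λ p → ∑ xs (λ q → ∑ C (λ a → α a p * β a q)))  ≡⟨ cong (2 *_) (classwise α β) ⟩
    2 * ∑ C (λ a → ∑ xs (α a) * ∑ xs (β a))                  ≡⟨ sym (∑-*ˡ C 2 _) ⟩
    ∑ C (λ a → 2 * (∑ xs (α a) * ∑ xs (β a)))                ≤⟨ ∑-mono C (λ {a} _ → 2ab≤a²+b² (∑ xs (α a)) (∑ xs (β a))) ⟩
    ∑ C (λ a → ∑ xs (α a) * ∑ xs (α a) + ∑ xs (β a) * ∑ xs (β a)) ≡⟨ ∑-+ C _ _ ⟩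
    ∑ C (λ a → ∑ xs (α a) * ∑ xs (α a)) + ∑ C (λ a → ∑ xs (β a) * ∑ xs (β a))
       ≡⟨ cong₂ _+_ (sym (classwise α α)) (sym (classwise β β)) ⟩
    ∑ xs (λ p → ∑ xs (λ q → ∑ C (λ a → α a p * α a q))) + ∑ xs (λ p → ∑ xs (λ q → ∑ C (λ a → β a p * β a q)))
       ≤⟨ +-mono-≤ (∑-mono xs (λ {p} _ → ∑-mono xs (λ {q} _ → αα p q))) (∑-mono xs (λ {p} _ → ∑-mono xs (λ {q} _ → ββ p q))) ⟩
    S + S                                                   ≡⟨ double S ⟩
    2 * S                                                   ∎)
    where
    open ≤-Reasoning
    C = upTo t
    S = ∑ xs (λ p → ∑ xs (λ q → 𝟙 (t ∣? ∣ p - q ∣)))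
    double : ∀ m → m + m ≡ 2 * m
    double = solve-∀
    -- For a residue a, `α a` marks the class of a and `β a` the class of -a.
    α β : ℕ → ℕ → ℕ
    α a p = 𝟙 (p % t ≟ a)
    β a q = 𝟙 (t ∣? a + q)
    classwise : ∀ (α β : ℕ → ℕ → ℕ) → ∑ xs (λ p → ∑ xs (λ q → ∑ C (λ a → α a p * β a q))) ≡ ∑ C (λ a → ∑ xs (α a) * ∑ xs (β a))
    classwise α β = trans (∑-cong xs (λ p → ∑-swap xs C _)) (trans (∑-swap xs C _)
      (∑-cong C (λ a → sym (∑-*-∑ xs xs (α a) (β a)))))
    ∣-diff : ∀ {m n} → t ∣ m → t ∣ n → t ∣ ∣ m - n ∣
    ∣-diff (divides-refl x) (divides-refl y) = divides ∣ x - y ∣ (sym (*-distribʳ-∣-∣ t x y))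
    shifted : ∀ {a p q} → t ∣ a + p → t ∣ a + q → t ∣ ∣ p - q ∣
    shifted {a} {p} {q} h k = subst (t ∣_) (∣m+n-m+o∣≡∣n-o∣ a p q) (∣-diff h k)
    residue : ∀ p → p ≡ p % t + p / t * t
    residue p = m≡m%n+[m/n]*n p t
    -- The term a = p % t suffices: if t divides p + q, then q lies in the class of -a.
    split : ∀ p q → 𝟙 (t ∣? p + q) ≤ ∑ C (λ a → α a p * β a q)
    split p q = 𝟙-≤ (t ∣? p + q) λ h → ≤-trans
      (≤-reflexive (sym (cong₂ _*_ (𝟙-yes (p % t ≟ p % t) refl) (𝟙-yes (t ∣? p % t + q) (reduce h)))))
      (∑-member (λ a → α a p * β a q) (∈-upTo⁺ (m%n<n p t)))
      where
      lem : ∀ r m q → r + m + q ≡ m + (r + q)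
      lem = solve-∀
      reduce : t ∣ p + q → t ∣ p % t + q
      reduce h = ∣m+n∣m⇒∣n (subst (t ∣_) (trans (cong (_+ q) (residue p)) (lem (p % t) (p / t * t) q)) h) (n∣m*n (p / t))
    αα : ∀ p q → ∑ C (λ a → α a p * α a q) ≤ 𝟙 (t ∣? ∣ p - q ∣)
    αα p q with t ∣? ∣ p - q ∣
    ... | yes _ = ≤-trans (∑-mono C (λ {a} _ → ≤-trans (*-monoʳ-≤ (α a p) (𝟙-≤ (q % t ≟ a) (λ _ → s≤s z≤n))) (≤-reflexive (*-identityʳ (α a p)))))
                    (∑-atMostOne (λ a → p % t ≟ a) (Unique.upTo⁺ t) (λ _ _ e f → trans (sym e) f))
    ... | no ¬d = ≤-trans (∑-mono C {g = λ _ → 0} (λ {a} _ → 𝟙-*-≤ (p % t ≟ a) λ e → 𝟙-≤ (q % t ≟ a) λ f → ⊥-elim (¬d (cls (trans e (sym f))))))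
                    (≤-reflexive (trans (∑-const C 0) (*-zeroʳ (length C))))
      where
      cls : p % t ≡ q % t → t ∣ ∣ p - q ∣
      cls e = subst (t ∣_) (trans (sym (∣m+n-m+o∣≡∣n-o∣ (p % t) (p / t * t) (q / t * t)))
        (cong₂ ∣_-_∣ (sym (residue p)) (trans (cong (_+ q / t * t) e) (sym (residue q)))))
        (∣-diff (n∣m*n (p / t)) (n∣m*n (q / t)))
    -- Two residues below t differ by less than t, so a difference divisible by t vanishes.
    unique-class : ∀ {a a′ p} → a < t → a′ < t → t ∣ a + p → t ∣ a′ + p → a ≡ a′
    unique-class {a} {a′} {p} a< a′< h k with ∣ a - a′ ∣ in e
    ... | zero  = ∣m-n∣≡0⇒m≡n e
    ... | suc d = ⊥-elim (<⇒≱ (≤-<-trans (∣m-n∣≤m⊔n a a′) (⊔-pres-<m a< a′<))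
        (subst (t ≤_) (sym e) (∣⇒≤ (subst (t ∣_) e (shifted {p} (subst (t ∣_) (+-comm a p) h) (subst (t ∣_) (+-comm a′ p) k))))))
    ββ : ∀ p q → ∑ C (λ a → β a p * β a q) ≤ 𝟙 (t ∣? ∣ p - q ∣)
    ββ p q with t ∣? ∣ p - q ∣
    ... | yes _ = ≤-trans (∑-mono C (λ {a} _ → ≤-trans (*-monoʳ-≤ (β a p) (𝟙-≤ (t ∣? a + q) (λ _ → s≤s z≤n))) (≤-reflexive (*-identityʳ (β a p)))))
                    (∑-atMostOne (λ a → t ∣? a + p) (Unique.upTo⁺ t) (λ x∈ y∈ → unique-class {p = p} (∈-upTo⁻ x∈) (∈-upTo⁻ y∈)))
    ... | no ¬d = ≤-trans (∑-mono C {g = λ _ → 0} (λ {a} _ → 𝟙-*-≤ (t ∣? a + p) λ e → 𝟙-≤ (t ∣? a + q) λ f → ⊥-elim (¬d (shifted {a} e f))))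
                    (≤-reflexive (trans (∑-const C 0) (*-zeroʳ (length C))))

  -- Hall's theorem

  Unique-++ˡ : ∀ {A : Set} (xs : List A) {ys} → Unique (xs ++ ys) → Unique xs
  Unique-++ˡ []       u        = []
  Unique-++ˡ (x ∷ xs) (x∉ ∷ u) = All.++⁻ˡ xs x∉ ∷ Unique-++ˡ xs u

  Unique-map-injective : ∀ {A B : Set} {f : A → B} {xs : List A} {x y} →
    Unique (map f xs) → x ∈ xs → y ∈ xs → f x ≡ f y → x ≡ y
  Unique-map-injective (_ ∷ _)  (here refl) (here refl) e = refl
  Unique-map-injective (z∉ ∷ _) (here refl) (there y∈)  e = ⊥-elim (All.lookup z∉ (∈-map⁺ _ y∈) e)
  Unique-map-injective (z∉ ∷ _) (there x∈)  (here refl) e = ⊥-elim (All.lookup z∉ (∈-map⁺ _ x∈) (sym e))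
  Unique-map-injective (_ ∷ u)  (there x∈)  (there y∈)  e = Unique-map-injective u x∈ y∈ e

  module _ {A B : Set} {R : A → B → Set} (_≟B_ : DecidableEquality B) (R? : ∀ x y → Dec (R x y)) (ys : List B) where

    open DecMembership _≟B_ using (_∈?_)

    IsEdge : A × B → Set
    IsEdge (x , y) = y ∈ ys × R x y

    lefts : List (A × B) → List A
    lefts = map proj₁

    rights : List (A × B) → List B
    rights = map proj₂

    Matching : List A → Set
    Matching xs = ∃[ M ] lefts M ↭ xs × Unique (rights M) × All IsEdge M

    -- `S` is given as part of a permutation of `xs`, so that distinctness and the bound on its
    -- length are inherited from `xs`. `N` contains the neighbours of `S` in `ys` and may be larger.
    record Violator (xs : List A) : Set where
      constructor violator
      field
        S rest  : List A
        S↭      : S ++ rest ↭ xs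
        N       : List B
        N-uniq  : Unique N
        N⊆      : All (_∈ ys) N
        closed  : ∀ {s y} → s ∈ S → y ∈ ys → R s y → y ∈ N
        smaller : length N < length S

    private
      unique-resp : ∀ {xs zs : List B} → xs ↭ zs → Unique xs → Unique zs
      unique-resp p = ↭ₛ.Unique-resp-↭ (setoid B) (↭⇒↭ₛ p)

      -- One stage of the search for an augmenting path: either an edge leads from a reached left
      -- vertex to a new right vertex, or the reached vertices are closed under taking neighbours.
      extensible? : ∀ (L : List A) (N : List B) →
        (∃[ x ] ∃[ y ] x ∈ L × y ∈ ys × R x y × y ∉ N) ⊎ (∀ {x y} → x ∈ L → y ∈ ys → R x y → y ∈ N)
      extensible? L N with Any.any? (λ x → Any.any? (λ y → R? x y ×-dec ¬? (y ∈? N)) ys) L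
      ... | yes h with find h
      ...   | x , x∈ , h′ with find h′
      ...     | y , y∈ , r , y∉ = inj₁ (x , y , x∈ , y∈ , r , y∉)
      extensible? L N | no ¬h = inj₂ λ {x} {y} x∈ y∈ r →
        decidable-stable (y ∈? N) λ y∉ → ¬h (lose x∈ (lose y∈ (r , y∉)))

      rights⊆ : ∀ {M} → All IsEdge M → All (_∈ ys) (rights M)
      rights⊆ []             = []
      rights⊆ ((y∈ , _) ∷ h) = y∈ ∷ rights⊆ h

      -- `A₁` rematches the reached pairs `A₀`: it covers `v`, omits `x` and keeps the right ends,
      -- so that `x` can be joined to a new vertex.
      Freeing : A → List (A × B) → A → Set
      Freeing v A₀ x = ∃[ A₁ ] x ∷ lefts A₁ ↭ v ∷ lefts A₀ × rights A₁ ↭ rights A₀ × All IsEdge A₁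

      -- The pairs A₀ of the matching A₀ ++ Rest are those reached from v by
      -- alternating paths; switching the path to x leaves x as the unmatched vertex.
      augment : ∀ k v {xs} (A₀ Rest : List (A × B)) → length Rest ≤ k →
        lefts (A₀ ++ Rest) ↭ xs → Unique (rights (A₀ ++ Rest)) → All IsEdge (A₀ ++ Rest) →
        (∀ {x} → x ∈ v ∷ lefts A₀ → Freeing v A₀ x) → Matching (v ∷ xs) ⊎ Violator (v ∷ xs)
      augment k v {xs} A₀ Rest len perm uniq edges free with extensible? (v ∷ lefts A₀) (rights A₀)
      -- The search is stuck, and the reached left vertices outnumber the reached right vertices by
      -- one, namely by `v`.
      ... | inj₂ closed = inj₂ (violator (v ∷ lefts A₀) (lefts Rest)
              (↭-prep v (↭-trans (↭-reflexive (sym (map-++ proj₁ A₀ Rest))) perm)) (rights A₀)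
              (Unique-++ˡ (rights A₀) (subst Unique (map-++ proj₂ A₀ Rest) uniq))
              (rights⊆ (All.++⁻ˡ A₀ edges)) closed
              (subst₂ (λ i j → i < suc j) (sym (length-map proj₂ A₀)) (sym (length-map proj₁ A₀)) (n<1+n (length A₀))))
      ... | inj₁ (x , y , x∈ , y∈ , r , y∉) with y ∈? rights Rest | free x∈
      -- `y` is unmatched, so the path ends here: free `x` and join it to `y`.
      ...   | no y∉Rest | A₁ , lp , rp , es = inj₁ ((x , y) ∷ A₁ ++ Rest
              , ↭-trans (↭-reflexive (cong (x ∷_) (map-++ proj₁ A₁ Rest)))
                  (↭-trans (↭.++⁺ʳ (lefts Rest) lp) (↭-prep v (↭-trans (↭-reflexive (sym (map-++ proj₁ A₀ Rest))) perm)))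
              , All.tabulate (λ {z} z∈ y≡z → new (↭.∈-resp-↭ rperm (subst (_∈ _) (sym y≡z) z∈)))
                ∷ unique-resp (↭-sym rperm) uniq
              , (y∈ , r) ∷ All.++⁺ es (All.++⁻ʳ A₀ edges))
        where
        rperm : rights (A₁ ++ Rest) ↭ rights (A₀ ++ Rest)
        rperm = ↭-trans (↭-reflexive (map-++ proj₂ A₁ Rest))
          (↭-trans (↭.++⁺ʳ (rights Rest) rp) (↭-reflexive (sym (map-++ proj₂ A₀ Rest))))
        new : y ∉ rights (A₀ ++ Rest)
        new h with ∈-++⁻ (rights A₀) (subst (y ∈_) (map-++ proj₂ A₀ Rest) h)
        ... | inj₁ h′ = y∉ h′
        ... | inj₂ h′ = y∉Rest h′
      -- `y` is matched to some `x′` not yet reached. Its pair moves from `Rest` to `A₀`; the fuel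
      -- `k` bounds the length of `Rest`, which drops by one.
      ...   | yes y∈Rest | A₁ , lp , rp , es with ∈-map⁻ proj₂ y∈Rest
      ...     | (x′ , .y) , p∈ , refl with ∈-∃++ p∈
      ...       | R₁ , R₂ , refl with k
      ...         | zero  = ⊥-elim (nonempty R₁ len)
        where
        nonempty : ∀ (R₁ : List (A × B)) {p R₂} → ¬ length (R₁ ++ p ∷ R₂) ≤ 0
        nonempty []      ()
        nonempty (_ ∷ _) ()
      ...         | suc k = augment k v ((x′ , y) ∷ A₀) (R₁ ++ R₂)
                (≤-pred (subst (_≤ suc k) (↭.↭-length (↭.shift (x′ , y) R₁ R₂)) len))
                (↭-trans (↭.map⁺ proj₁ move) perm)
                (unique-resp (↭-sym (↭.map⁺ proj₂ move)) uniq)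
                (↭.All-resp-↭ (↭-sym move) edges)
                free′
        where
        move : (x′ , y) ∷ A₀ ++ (R₁ ++ R₂) ↭ A₀ ++ R₁ ++ (x′ , y) ∷ R₂
        move = ↭-sym (↭-trans (↭.++⁺ˡ A₀ (↭.shift (x′ , y) R₁ R₂)) (↭.shift (x′ , y) A₀ (R₁ ++ R₂)))
        edge : IsEdge (x′ , y)
        edge = All.lookup edges (∈-++⁺ʳ A₀ p∈)
        old : ∀ {z} → z ∈ v ∷ lefts A₀ → Freeing v ((x′ , y) ∷ A₀) z
        old {z} z∈ with free z∈
        ... | A₂ , lp₂ , rp₂ , es₂ = (x′ , y) ∷ A₂
          , ↭-trans (↭-swap z x′ ↭-refl) (↭-trans (↭-prep x′ lp₂) (↭-swap x′ v ↭-refl))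
          , ↭-prep y rp₂ , edge ∷ es₂
        free′ : ∀ {z} → z ∈ v ∷ lefts ((x′ , y) ∷ A₀) → Freeing v ((x′ , y) ∷ A₀) z
        free′ (here refl)         = old (here refl)
        -- To free `x′`, first free `x` and then match `x` with `y`.
        free′ (there (here refl)) = (x , y) ∷ A₁
          , ↭-trans (↭-prep x′ lp) (↭-swap x′ v ↭-refl)
          , ↭-prep y rp , (y∈ , r) ∷ es
        free′ (there (there z∈))  = old (there z∈)

    -- Left vertices are added one at a time. A violator for `xs` remains one for `v ∷ xs`; a
    -- matching is extended by the search, which starts with `v` as the only reached vertex.
    hall : ∀ xs → Matching xs ⊎ Violator xs
    hall []       = inj₁ ([] , ↭-refl , [] , [])
    hall (v ∷ xs) with hall xs
    ... | inj₂ (violator S rest S↭ N N-uniq N⊆ closed smaller) =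
          inj₂ (violator S (v ∷ rest) (↭-trans (↭.shift v S rest) (↭-prep v S↭)) N N-uniq N⊆ closed smaller)
    ... | inj₁ (M , perm , uniq , edges) = augment (length M) v [] M (≤-reflexive refl) perm uniq edges
          λ { (here refl) → [] , ↭-refl , ↭-refl , [] }

  -- The size of a violator of Hall's condition

  module _
    (n D T m : ℕ) (S N : List ℕ)
    (1≤S : ∀ {s} → s ∈ S → 1 ≤ s) (S≤n : ∀ {s} → s ∈ S → s ≤ n)
    (uniqN : Unique N)
    (m<N : ∀ {y} → y ∈ N → m < y) (N≤ : ∀ {y} → y ∈ N → y ≤ m + 3 * (n * D))
    (closed : ∀ {s y} → s ∈ S → m < y → y ≤ m + 3 * (n * D) → s ∣ y → y ∈ N)
    (∣N∣≤∣S∣ : length N ≤ length S) (0<∣S∣ : 0 < length S)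
    (fewDivisors : ∀ w → 0 < w → w ≤ 3 * (n * D) → ∑ S (λ s → 𝟙 (s ∣? w)) ≤ T)
    where

    private
      -- Each third of the interval has length Δ, so a step s·j with s ≤ n and j ≤ D from a point of
      -- the middle third stays inside the interval.
      k Δ : ℕ
      k = length S
      Δ = n * D

      middle? : ∀ x → Dec (m + Δ < x × x ≤ m + Δ + Δ)
      middle? x = (m + Δ <? x) ×-dec (x ≤? m + Δ + Δ)

      Mid : List ℕ
      Mid = filter middle? N

      deg refl-pairs : ℕ → ℕ
      deg x = ∑ S (λ s → 𝟙 (s ∣? x))
      refl-pairs x = ∑ N (λ p → ∑ N (λ q → 𝟙 (p + q ≟ x + x)))

      3Δ : ∀ a → m + a + a + a ≡ m + 3 * a
      3Δ = lem m
        where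
        lem : ∀ m a → m + a + a + a ≡ m + 3 * a
        lem = solve-∀

      step≤Δ : ∀ {s i} → s ≤ n → i < D → s * suc i ≤ Δ
      step≤Δ s≤n i<D = *-mono-≤ s≤n i<D

      multiple-cancel : ∀ {s i j} → 1 ≤ s → s * i ≡ s * j → i ≡ j
      multiple-cancel {s} {i} {j} 1≤s e = *-cancelˡ-≡ i j s {{>-nonZero 1≤s}} e

      -- If x₀ is the largest multiple of s not exceeding m + Δ, then x₀ + s, ..., x₀ + sD lie in
      -- the middle third, and `closed` puts them into N.
      D≤multiples : ∀ {s} → s ∈ S → D ≤ ∑ Mid (λ x → 𝟙 (s ∣? x))
      D≤multiples {s} s∈ = ∑-embedding D (s ∣?_) (λ i x → x ≟ x₀ + s * suc i) Mid
        (λ i i<D → x₀ + s * suc i , mem i i<D , divides-x i , refl)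
        (λ _ e f → suc-injective (multiple-cancel (1≤S s∈) (+-cancelˡ-≡ x₀ _ _ (trans (sym e) f))))
        where
        instance
          s≢0 : NonZero s
          s≢0 = >-nonZero (1≤S s∈)
        base x₀ : ℕ
        base = m + Δ
        x₀ = base / s * s
        x₀≤ : x₀ ≤ base
        x₀≤ = m/n*n≤m base s
        base< : base < x₀ + s
        base< = subst (base <_) (+-comm s x₀) (subst (_< s + x₀) (sym (m≡m%n+[m/n]*n base s)) (+-monoˡ-< x₀ (m%n<n base s)))
        divides-x : ∀ i → s ∣ x₀ + s * suc i
        divides-x i = ∣m∣n⇒∣m+n (n∣m*n (base / s)) (m∣m*n (suc i))
        mem : ∀ i → i < D → x₀ + s * suc i ∈ Mid
        mem i i<D = ∈-filter⁺ middle? (closed s∈ (≤-<-trans (m≤m+n m Δ) lo) (≤-trans hi (≤-trans (m≤m+n _ Δ) (≤-reflexive (3Δ Δ)))) (divides-x i)) (lo , hi)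
          where
          lo : base < x₀ + s * suc i
          lo = <-≤-trans base< (+-monoʳ-≤ x₀ (m≤m*n s (suc i)))
          hi : x₀ + s * suc i ≤ base + Δ
          hi = +-mono-≤ x₀≤ (step≤Δ (S≤n s∈) i<D)

      kD≤degrees : k * D ≤ ∑ Mid deg
      kD≤degrees = begin
        k * D                                     ≡⟨ sym (∑-const S D) ⟩
        ∑ S (λ _ → D)                             ≤⟨ ∑-mono S D≤multiples ⟩
        ∑ S (λ s → ∑ Mid (λ x → 𝟙 (s ∣? x)))      ≡⟨ ∑-swap S Mid _ ⟩
        ∑ Mid deg                                 ∎
        where open ≤-Reasoning

      -- Cauchy-Schwarz is applied to at most k points, since the middle third of N has no more
      -- elements than N; then one factor k cancels.
      kD²≤squares : k * (D * D) ≤ ∑ Mid (λ x → deg x * deg x)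
      kD²≤squares = *-cancelˡ-≤ k {{>-nonZero 0<∣S∣}} (begin
        k * (k * (D * D))                         ≡⟨ lem k D ⟩
        k * D * (k * D)                           ≤⟨ *-mono-≤ kD≤degrees kD≤degrees ⟩
        ∑ Mid deg * ∑ Mid deg                     ≤⟨ cauchy-schwarz Mid deg ⟩
        length Mid * ∑ Mid (λ x → deg x * deg x)  ≤⟨ *-monoˡ-≤ _ (≤-trans (length-filter middle? N) ∣N∣≤∣S∣) ⟩
        k * ∑ Mid (λ x → deg x * deg x)           ∎)
        where
        open ≤-Reasoning
        lem : ∀ k D → k * (k * (D * D)) ≡ k * D * (k * D)
        lem = solve-∀

      module _ {x} (x∈ : x ∈ Mid) where
        private
          x∈N = proj₁ (∈-filter⁻ middle? {xs = N} x∈)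
          lo = proj₁ (proj₂ (∈-filter⁻ middle? {xs = N} x∈))
          hi = proj₂ (proj₂ (∈-filter⁻ middle? {xs = N} x∈))

        -- The mirror image 2x - p lies in N, phrased without subtraction.
        Reflected : ℕ → Set
        Reflected p = Any (λ q → p + q ≡ x + x) N

        -- Only points p > x are counted, so that p ∸ x is positive and `fewDivisors` applies to it.
        hit? : ∀ s p → Dec ((x < p × Reflected p) × s ∣ p ∸ x)
        hit? s p = ((x <? p) ×-dec Any.any? (λ q → p + q ≟ x + x) N) ×-dec (s ∣? p ∸ x)

        -- The hits are the points x + sj with 1 ≤ j ≤ D; the mirror images x - sj are again
        -- multiples of s in the interval, hence in N.
        D≤hits : ∀ {s} → s ∈ S → s ∣ x → D ≤ ∑ N (λ p → 𝟙 (hit? s p))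
        D≤hits {s} s∈ s∣x = ∑-embedding D (hit? s) (λ i p → p ≟ x + s * suc i) N
          (λ i i<D → x + s * suc i , mem i i<D , ((x<p i , lose (mem′ i i<D) (sum-eq i i<D))
             , subst (s ∣_) (sym (m+n∸m≡n x (s * suc i))) (m∣m*n (suc i))) , refl)
          (λ _ e f → suc-injective (multiple-cancel (1≤S s∈) (+-cancelˡ-≡ x _ _ (trans (sym e) f))))
          where
          x<p : ∀ i → x < x + s * suc i
          x<p i = m<m+n x (≤-trans (1≤S s∈) (m≤m*n s (suc i)))
          mem : ∀ i → i < D → x + s * suc i ∈ N
          mem i i<D = closed s∈ (<-trans (m<N x∈N) (x<p i))
            (≤-trans (+-mono-≤ hi (step≤Δ (S≤n s∈) i<D)) (≤-reflexive (3Δ Δ)))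
            (∣m∣n⇒∣m+n s∣x (m∣m*n (suc i)))
          step≤x : ∀ i → i < D → s * suc i ≤ x
          step≤x i i<D = ≤-trans (step≤Δ (S≤n s∈) i<D) (≤-trans (m≤n+m Δ m) (<⇒≤ lo))
          mem′ : ∀ i → i < D → x ∸ s * suc i ∈ N
          mem′ i i<D = closed s∈
            (+-cancelʳ-< (s * suc i) m _ (subst (m + s * suc i <_) (sym (m∸n+n≡m (step≤x i i<D))) (≤-<-trans (+-monoʳ-≤ m (step≤Δ (S≤n s∈) i<D)) lo)))
            (≤-trans (m∸n≤m x (s * suc i)) (N≤ x∈N))
            (∣m+n∣m⇒∣n (subst (s ∣_) (sym (m+[n∸m]≡n (step≤x i i<D))) s∣x) (m∣m*n (suc i)))
          sum-eq : ∀ i → i < D → x + s * suc i + (x ∸ s * suc i) ≡ x + x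
          sum-eq i i<D = trans (+-assoc x _ _) (cong (x +_) (m+[n∸m]≡n (step≤x i i<D)))

        -- A pair of points symmetric about x determines the multiple p - x of s.
        D*deg≤T*pairs : D * deg x ≤ T * refl-pairs x
        D*deg≤T*pairs = begin
          D * deg x                                         ≡⟨ trans (*-comm D (deg x)) (sym (∑-*ʳ S _ D)) ⟩
          ∑ S (λ s → 𝟙 (s ∣? x) * D)                        ≤⟨ ∑-mono S (λ {s} s∈ → 𝟙-*-≤ (s ∣? x) (D≤hits s∈)) ⟩
          ∑ S (λ s → ∑ N (λ p → 𝟙 (hit? s p)))              ≡⟨ ∑-swap S N _ ⟩
          ∑ N (λ p → ∑ S (λ s → 𝟙 (hit? s p)))              ≤⟨ ∑-mono N bound-at ⟩
          ∑ N (λ p → T * ∑ N (λ q → 𝟙 (p + q ≟ x + x)))     ≡⟨ ∑-*ˡ N T _ ⟩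
          T * refl-pairs x                                  ∎
          where
          open ≤-Reasoning
          bound-at : ∀ {p} → p ∈ N → ∑ S (λ s → 𝟙 (hit? s p)) ≤ T * ∑ N (λ q → 𝟙 (p + q ≟ x + x))
          bound-at {p} p∈ with (x <? p) ×-dec Any.any? (λ q → p + q ≟ x + x) N
          ... | no ¬h = ≤-trans (≤-reflexive (trans (∑-cong S (λ s → 𝟙-no (no ¬h ×-dec (s ∣? p ∸ x)) (¬h ∘ proj₁)))
                           (trans (∑-const S 0) (*-zeroʳ k)))) z≤n
          ... | yes (x<p , r) with find r
          -- Every s counted divides the positive number p ∸ x ≤ 3Δ, so there are at most T of them,
          -- while the partner q makes the right-hand side at least T.
          ...   | q , q∈ , e = begin
            ∑ S (λ s → 𝟙 (yes (x<p , r) ×-dec (s ∣? p ∸ x)))  ≤⟨ ∑-mono S (λ {s} _ → 𝟙-≤ (yes (x<p , r) ×-dec (s ∣? p ∸ x)) λ (_ , d) → ≤-reflexive (sym (𝟙-yes (s ∣? p ∸ x) d))) ⟩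
            ∑ S (λ s → 𝟙 (s ∣? p ∸ x))                        ≤⟨ fewDivisors (p ∸ x) (m<n⇒0<n∸m x<p)
                                                                   (≤-trans (∸-mono (N≤ p∈) (<⇒≤ (m<N x∈N))) (≤-reflexive (m+n∸m≡n m _))) ⟩
            T                                                 ≡⟨ sym (*-identityʳ T) ⟩
            T * 1                                             ≤⟨ *-monoʳ-≤ T (≤-trans (≤-reflexive (sym (𝟙-yes (p + q ≟ x + x) e)))
                                                                   (∑-member (λ q → 𝟙 (p + q ≟ x + x)) q∈)) ⟩
            T * ∑ N (λ q → 𝟙 (p + q ≟ x + x))                 ∎

      -- A pair (p, q) determines its midpoint x, and t ∣ x implies t ∣ p + q because p + q = 2x.
      midpoints : ∀ t → ∑ Mid (λ x → 𝟙 (t ∣? x) * refl-pairs x) ≤ ∑ N (λ p → ∑ N (λ q → 𝟙 (t ∣? p + q)))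
      midpoints t = begin
        ∑ Mid (λ x → 𝟙 (t ∣? x) * refl-pairs x)
          ≡⟨ ∑-cong Mid (λ x → trans (sym (∑-*ˡ N (𝟙 (t ∣? x)) _)) (∑-cong N (λ p → sym (∑-*ˡ N (𝟙 (t ∣? x)) _)))) ⟩
        ∑ Mid (λ x → ∑ N (λ p → ∑ N (λ q → 𝟙 (t ∣? x) * 𝟙 (p + q ≟ x + x))))
          ≡⟨ trans (∑-swap Mid N _) (∑-cong N (λ p → ∑-swap Mid N _)) ⟩
        ∑ N (λ p → ∑ N (λ q → ∑ Mid (λ x → 𝟙 (t ∣? x) * 𝟙 (p + q ≟ x + x))))
          ≤⟨ ∑-mono N (λ {p} _ → ∑-mono N (λ {q} _ → at-most-one p q)) ⟩
        ∑ N (λ p → ∑ N (λ q → 𝟙 (t ∣? p + q)))  ∎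
        where
        open ≤-Reasoning
        double-injective : ∀ {x y} → x + x ≡ y + y → x ≡ y
        double-injective {x} {y} e = *-cancelˡ-≡ x y 2 (trans (lem x) (trans e (sym (lem y))))
          where
          lem : ∀ x → 2 * x ≡ x + x
          lem = solve-∀
        at-most-one : ∀ p q → ∑ Mid (λ x → 𝟙 (t ∣? x) * 𝟙 (p + q ≟ x + x)) ≤ 𝟙 (t ∣? p + q)
        at-most-one p q with t ∣? p + q
        ... | yes _ = ≤-trans (∑-mono Mid (λ {x} _ → 𝟙-*-≤ (t ∣? x) (λ _ → ≤-refl)))
                        (∑-atMostOne (λ x → p + q ≟ x + x) (Unique.filter⁺ middle? uniqN) (λ _ _ e f → double-injective (trans (sym e) f)))
        ... | no ¬d = ≤-trans (∑-mono Mid {g = λ _ → 0} (λ {x} _ → 𝟙-*-≤ (t ∣? x) λ d → 𝟙-≤ (p + q ≟ x + x) λ e → ⊥-elim (¬d (subst (t ∣_) (sym e) (∣m∣n⇒∣m+n d d)))))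
                        (≤-reflexive (trans (∑-const Mid 0) (*-zeroʳ (length Mid))))

      -- A pair with p ≠ q has at most T elements t dividing the positive difference, which is at
      -- most 3Δ. The at most k diagonal pairs contribute up to k each.
      congruent-pairs : ∑ S (λ t → ∑ N (λ p → ∑ N (λ q → 𝟙 (t ∣? ∣ p - q ∣)))) ≤ k * (k * T + k)
      congruent-pairs = begin
        ∑ S (λ t → ∑ N (λ p → ∑ N (λ q → 𝟙 (t ∣? ∣ p - q ∣))))  ≡⟨ trans (∑-swap S N _) (∑-cong N (λ p → ∑-swap S N _)) ⟩
        ∑ N (λ p → ∑ N (λ q → ∑ S (λ t → 𝟙 (t ∣? ∣ p - q ∣))))  ≤⟨ ∑-mono N (λ {p} p∈ → row p p∈) ⟩
        ∑ N (λ p → k * T + k)                                   ≡⟨ ∑-const N _ ⟩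
        length N * (k * T + k)                                  ≤⟨ *-monoˡ-≤ _ ∣N∣≤∣S∣ ⟩
        k * (k * T + k)                                         ∎
        where
        open ≤-Reasoning
        gap : ∀ {p q} → p ∈ N → q ∈ N → p ∸ q ≤ 3 * Δ
        gap p∈ q∈ = ≤-trans (∸-mono (N≤ p∈) (<⇒≤ (m<N q∈))) (≤-reflexive (m+n∸m≡n m _))
        distance : ∀ {p q} → p ∈ N → q ∈ N → ∣ p - q ∣ ≤ 3 * Δ
        distance {p} {q} p∈ q∈ with ∣m-n∣≡[m∸n]∨[n∸m] p q
        ... | inj₁ e = subst (_≤ 3 * Δ) (sym e) (gap p∈ q∈)
        ... | inj₂ e = subst (_≤ 3 * Δ) (sym e) (gap q∈ p∈)
        cell : ∀ {p q} → p ∈ N → q ∈ N → ∑ S (λ t → 𝟙 (t ∣? ∣ p - q ∣)) ≤ T + k * 𝟙 (p ≟ q)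
        cell {p} {q} p∈ q∈ with p ≟ q
        ... | yes _  = ≤-trans (∑-mono S {g = λ _ → 1} (λ {t} _ → 𝟙-≤ (t ∣? ∣ p - q ∣) (λ _ → ≤-refl)))
                         (≤-trans (≤-reflexive (∑-const S 1)) (m≤n+m (k * 1) T))
        ... | no p≢q = ≤-trans (fewDivisors ∣ p - q ∣ (n≢0⇒n>0 (p≢q ∘ ∣m-n∣≡0⇒m≡n)) (distance p∈ q∈)) (m≤m+n T _)
        row : ∀ p → p ∈ N → ∑ N (λ q → ∑ S (λ t → 𝟙 (t ∣? ∣ p - q ∣))) ≤ k * T + k
        row p p∈ = begin
          ∑ N (λ q → ∑ S (λ t → 𝟙 (t ∣? ∣ p - q ∣)))      ≤⟨ ∑-mono N (cell p∈) ⟩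
          ∑ N (λ q → T + k * 𝟙 (p ≟ q))                   ≡⟨ trans (∑-+ N _ _) (cong₂ _+_ (∑-const N T) (∑-*ˡ N k _)) ⟩
          length N * T + k * ∑ N (λ q → 𝟙 (p ≟ q))        ≤⟨ +-mono-≤ (*-monoˡ-≤ T ∣N∣≤∣S∣) (*-monoʳ-≤ k (∑-atMostOne (p ≟_) uniqN (λ _ _ e f → trans (sym e) f))) ⟩
          k * T + k * 1                                   ≡⟨ cong (k * T +_) (*-identityʳ k) ⟩
          k * T + k                                       ∎

      -- Writing the degree as a sum over t and exchanging the sums leaves, for each t, the
      -- midpoints divisible by t. These are bounded by pairs with t ∣ p + q and then, by
      -- `∑-antipodal`, by pairs with t ∣ p - q.
      weighted-degrees : ∑ Mid (λ x → deg x * refl-pairs x) ≤ k * (k * T + k)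
      weighted-degrees = begin
        ∑ Mid (λ x → deg x * refl-pairs x)                      ≡⟨ ∑-cong Mid (λ x → sym (∑-*ʳ S _ (refl-pairs x))) ⟩
        ∑ Mid (λ x → ∑ S (λ t → 𝟙 (t ∣? x) * refl-pairs x))     ≡⟨ ∑-swap Mid S _ ⟩
        ∑ S (λ t → ∑ Mid (λ x → 𝟙 (t ∣? x) * refl-pairs x))     ≤⟨ ∑-mono S (λ {t} t∈ → ≤-trans (midpoints t) (∑-antipodal t {{>-nonZero (1≤S t∈)}} N)) ⟩
        ∑ S (λ t → ∑ N (λ p → ∑ N (λ q → 𝟙 (t ∣? ∣ p - q ∣))))  ≤⟨ congruent-pairs ⟩
        k * (k * T + k)                                         ∎
        where open ≤-Reasoning

    -- Multiply the lower bound for the sum of squared degrees by D, trade one factor D d(x) for T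
    -- r(x), insert the bound on the sum of d(x) r(x), and cancel k.
    violator-size : D * (D * D) ≤ T * suc T * length S
    violator-size = *-cancelˡ-≤ k {{>-nonZero 0<∣S∣}} (begin
      k * (D * (D * D))                           ≡⟨ lem₁ k D ⟩
      D * (k * (D * D))                           ≤⟨ *-monoʳ-≤ D kD²≤squares ⟩
      D * ∑ Mid (λ x → deg x * deg x)             ≡⟨ sym (∑-*ˡ Mid D _) ⟩
      ∑ Mid (λ x → D * (deg x * deg x))           ≤⟨ ∑-mono Mid (λ {x} x∈ → ≤-trans (≤-reflexive (lem₂ D (deg x)))
                                                        (≤-trans (*-monoʳ-≤ (deg x) (D*deg≤T*pairs x∈)) (≤-reflexive (lem₃ (deg x) T (refl-pairs x))))) ⟩
      ∑ Mid (λ x → T * (deg x * refl-pairs x))    ≡⟨ ∑-*ˡ Mid T _ ⟩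
      T * ∑ Mid (λ x → deg x * refl-pairs x)      ≤⟨ *-monoʳ-≤ T weighted-degrees ⟩
      T * (k * (k * T + k))                       ≡⟨ lem₄ T k ⟩
      k * (T * suc T * k)                         ∎)
      where
      open ≤-Reasoning
      lem₁ : ∀ k D → k * (D * (D * D)) ≡ D * (k * (D * D))
      lem₁ = solve-∀
      lem₂ : ∀ D d → D * (d * d) ≡ d * (D * d)
      lem₂ = solve-∀
      lem₃ : ∀ d T r → d * (T * r) ≡ T * (d * r)
      lem₃ = solve-∀
      lem₄ : ∀ T k → T * (k * (k * T + k)) ≡ k * (T * (1 + T) * k)
      lem₄ = solve-∀

  -- The divisor bound

  -- The list only has to cover the divisors. It may repeat entries or contain other numbers, so
  -- lists for several factors can simply be concatenated.
  AtMostDivisors : ℕ → ℕ → Set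
  AtMostDivisors T w = ∃[ L ] length L ≤ T × (∀ {d} → d ∣ w → d ∈ L)

  AtMostDivisors-mono : ∀ {T T′ w} → T ≤ T′ → AtMostDivisors T w → AtMostDivisors T′ w
  AtMostDivisors-mono T≤T′ (L , len , h) = L , ≤-trans len T≤T′ , h

  AtMostDivisors-1 : AtMostDivisors 1 1
  AtMostDivisors-1 = 1 ∷ [] , ≤-refl , λ d∣1 → here (∣1⇒≡1 d∣1)

  AtMostDivisors-split : ∀ {T₁ T₂ u v w} c → (∀ {d} → d ∣ u → d ∣ v ⊎ (∃[ e ] e ∣ w × d ≡ c * e)) →
    AtMostDivisors T₁ v → AtMostDivisors T₂ w → AtMostDivisors (T₁ + T₂) u
  AtMostDivisors-split {u = u} c split (L₁ , len₁ , h₁) (L₂ , len₂ , h₂) = L₁ ++ map (c *_) L₂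
    , ≤-trans (≤-reflexive (trans (length-++ L₁) (cong (length L₁ +_) (length-map (c *_) L₂)))) (+-mono-≤ len₁ len₂)
    , λ {d} d∣u → mem (split d∣u)
    where
    mem : ∀ {d} → d ∣ _ ⊎ (∃[ e ] e ∣ _ × d ≡ c * e) → d ∈ L₁ ++ map (c *_) L₂
    mem (inj₁ d∣v)             = ∈-++⁺ˡ (h₁ d∣v)
    mem (inj₂ (e , e∣w , refl)) = ∈-++⁺ʳ L₁ (∈-map⁺ (c *_) (h₂ e∣w))

  -- As `S` has no repetitions, each entry of the covering list accounts for at most one element of
  -- `S`.
  ∑-divisors : ∀ {T w S} → Unique S → AtMostDivisors T w → ∑ S (λ s → 𝟙 (s ∣? w)) ≤ T
  ∑-divisors {T} {w} {S} uniq (L , len , h) = begin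
    ∑ S (λ s → 𝟙 (s ∣? w))              ≤⟨ ∑-mono S (λ {s} _ → 𝟙-≤ (s ∣? w) λ d → ≤-trans (≤-reflexive (sym (𝟙-yes (s ≟ s) refl))) (∑-member (λ d → 𝟙 (s ≟ d)) (h d))) ⟩
    ∑ S (λ s → ∑ L (λ d → 𝟙 (s ≟ d)))   ≡⟨ ∑-swap S L _ ⟩
    ∑ L (λ d → ∑ S (λ s → 𝟙 (s ≟ d)))   ≤⟨ ∑-mono L (λ {d} _ → ∑-atMostOne (_≟ d) uniq (λ _ _ e f → trans e (sym f))) ⟩
    ∑ L (λ _ → 1)                       ≡⟨ trans (∑-const L 1) (*-identityʳ _) ⟩
    length L                            ≤⟨ len ⟩
    T                                   ∎
    where open ≤-Reasoning

  ∣p*w : ∀ {p d} w → Prime p → d ∣ p * w → d ∣ w ⊎ (∃[ e ] e ∣ w × d ≡ p * e)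
  ∣p*w {p} {d} w pr d∣pw with p ∣? d
  ... | yes (divides e refl) = inj₂ (e , *-cancelˡ-∣ p {{prime⇒nonZero pr}} (subst (_∣ p * w) (*-comm e p) d∣pw) , *-comm e p)
  ... | no p∤d = inj₁ (coprime-divisor {n = p} coprime d∣pw)
    where
    coprime : ∀ {i} → i ∣ d × i ∣ p → i ≡ 1
    coprime (i∣d , i∣p) with prime⇒irreducible pr i∣p
    ... | inj₁ i≡1  = i≡1
    ... | inj₂ refl = ⊥-elim (p∤d i∣d)

  -- A divisor either survives the loss of one factor p or carries the whole power p^(a+1).
  -- Splitting off the whole power makes the divisor count grow by an added T per step, hence by the
  -- factor a + 1 in all, instead of doubling.
  ∣p^a*w : ∀ {p d} a w → Prime p → d ∣ p ^ suc a * w → d ∣ p ^ a * w ⊎ (∃[ e ] e ∣ w × d ≡ p ^ suc a * e)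
  ∣p^a*w {p} {d} a w pr d∣ with ∣p*w (p ^ a * w) pr (subst (d ∣_) (*-assoc p (p ^ a) w) d∣)
  ∣p^a*w a w pr d∣ | inj₁ h = inj₁ h
  ∣p^a*w {p} zero w pr d∣ | inj₂ (e , e∣ , refl) =
    inj₂ (e , subst (e ∣_) (*-identityˡ w) e∣ , cong (_* e) (sym (*-identityʳ p)))
  ∣p^a*w {p} (suc a) w pr d∣ | inj₂ (e , e∣ , refl) with ∣p^a*w a w pr e∣
  ... | inj₁ h               = inj₁ (subst (p * e ∣_) (sym (*-assoc p (p ^ a) w)) (*-monoʳ-∣ p h))
  ... | inj₂ (f , f∣w , refl) = inj₂ (f , f∣w , sym (*-assoc p (p ^ suc a) f))

  AtMostDivisors-p^a*w : ∀ {p T w} a → Prime p → AtMostDivisors T w → AtMostDivisors (suc a * T) (p ^ a * w)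
  AtMostDivisors-p^a*w {T = T} {w} zero pr h =
    subst₂ AtMostDivisors (sym (+-identityʳ T)) (sym (+-identityʳ w)) h
  AtMostDivisors-p^a*w {p} {T} {w} (suc a) pr h = subst (λ T → AtMostDivisors T (p ^ suc a * w)) (+-comm (suc a * T) T)
    (AtMostDivisors-split (p ^ suc a) (∣p^a*w a w pr) (AtMostDivisors-p^a*w a pr h) h)

  factor-out : ∀ p .{{_ : NonTrivial p}} w → 0 < w → ∃[ a ] ∃[ w′ ] w ≡ p ^ a * w′ × p ∤ w′
  factor-out p w 0<w = go w 0<w (<-wellFounded w)
    where
    go : ∀ w → 0 < w → Acc _<_ w → ∃[ a ] ∃[ w′ ] w ≡ p ^ a * w′ × p ∤ w′
    go w 0<w (acc rs) with p ∣? w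
    ... | no p∤w = 0 , w , sym (*-identityˡ w) , p∤w
    ... | yes (divides zero refl) = ⊥-elim (n≮0 0<w)
    ... | yes (divides q@(suc _) refl) with go q z<s (rs (m<m*n q p (nonTrivial⇒n>1 p)))
    ...   | a , w′ , eq , p∤w′ = suc a , w′ , trans (trans (*-comm q p) (cong (p *_) eq)) (sym (*-assoc p (p ^ a) w′)) , p∤w′

  2^a≤p^a : ∀ p .{{_ : NonTrivial p}} a → 2 ^ a ≤ p ^ a
  2^a≤p^a p a = ^-monoˡ-≤ a (nonTrivial⇒n>1 p)

  0<∣ : ∀ {d w} → 0 < w → d ∣ w → 0 < d
  0<∣ {zero}  0<w d∣w = ⊥-elim (n≮0 (subst (0 <_) (0∣⇒≡0 d∣w) 0<w))
  0<∣ {suc _} _   _   = z<s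

  2^-cancel-< : ∀ {a b} → 2 ^ a < 2 ^ b → a < b
  2^-cancel-< {a} {b} h = ≰⇒> λ b≤a → <⇒≱ h (^-monoʳ-≤ 2 b≤a)

  module _ (L : ℕ) where

    -- Each prime below m occurs to a power less than L, so it contributes a
    -- factor of at most L to the number of divisors.
    remove-small-primes : ∀ m w → 0 < w → w < 2 ^ L →
      ∃[ w′ ] w′ ∣ w × m Rough w′ × (∀ {T} → AtMostDivisors T w′ → AtMostDivisors (L ^ m * T) w)
    remove-small-primes zero w 0<w w< = w , ∣-refl , 0-rough , λ {T} → AtMostDivisors-mono (≤-reflexive (sym (*-identityˡ T)))
    remove-small-primes (suc m) w 0<w w< with remove-small-primes m w 0<w w<
    ... | w′ , w′∣w , rough , up = next m rough up
      where
      0<w′ = 0<∣ 0<w w′∣w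
      w′<2^L : w′ < 2 ^ L
      w′<2^L = ≤-<-trans (∣⇒≤ {{>-nonZero 0<w}} w′∣w) w<
      1≤L : 1 ≤ L
      1≤L = 2^-cancel-< (≤-<-trans 0<w w<)
      Result : ℕ → ℕ → Set
      Result m w′ = w′ ∣ w × suc m Rough w′ × (∀ {T} → AtMostDivisors T w′ → AtMostDivisors (L ^ suc m * T) w)
      weaken : ∀ m → (∀ {T} → AtMostDivisors T w′ → AtMostDivisors (L ^ m * T) w) →
        ∀ {T} → AtMostDivisors T w′ → AtMostDivisors (L ^ suc m * T) w
      weaken m up {T} h = AtMostDivisors-mono (*-monoˡ-≤ T (m≤n*m (L ^ m) L {{>-nonZero 1≤L}})) (up h)
      next : ∀ m → m Rough w′ → (∀ {T} → AtMostDivisors T w′ → AtMostDivisors (L ^ m * T) w) → ∃[ w″ ] Result m w″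
      next 0 rough up = w′ , w′∣w , 1-rough , weaken 0 up
      next 1 rough up = w′ , w′∣w , 2-rough , weaken 1 up
      -- If w′ has no divisor in [2, p) but p divides it, then p is prime. Values of p that do not
      -- divide w′ merely waste a factor L.
      next p@(suc (suc _)) rough up with p ∣? w′
      ... | no p∤w′ = w′ , w′∣w , ∤⇒rough-suc p∤w′ rough , weaken p up
      ... | yes p∣w′ with factor-out p w′ 0<w′
      ...   | a , w″ , eq , p∤w″ = w″ , ∣-trans w″∣w′ w′∣w , ∤⇒rough-suc p∤w″ (rough∧∣⇒rough rough w″∣w′)
              , λ {T} h → AtMostDivisors-mono (≤-trans (*-monoʳ-≤ (L ^ p) (*-monoˡ-≤ T a<L)) (≤-reflexive (lem (L ^ p) L T)))
                  (up (subst (AtMostDivisors (suc a * T)) (sym eq) (AtMostDivisors-p^a*w a (rough∧∣⇒prime rough p∣w′) h)))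
        where
        w″∣w′ : w″ ∣ w′
        w″∣w′ = divides (p ^ a) eq
        -- From 2^a ≤ p^a ≤ w′ < 2^L; thus the factor a + 1 is at most L.
        a<L : a < L
        a<L = 2^-cancel-< (≤-<-trans (≤-trans (2^a≤p^a p a) (≤-trans (m≤m*n (p ^ a) w″ {{>-nonZero (0<∣ 0<w′ w″∣w′)}}) (≤-reflexive (sym eq)))) w′<2^L)
        lem : ∀ P L T → P * (L * T) ≡ L * P * T
        lem = solve-∀

  -- All prime factors are at least Y, so there are at most e of them with multiplicity, and each
  -- one at most doubles the number of divisors.
  AtMostDivisors-rough : ∀ e {Y w} → 0 < w → Y Rough w → w < Y ^ suc e → AtMostDivisors (2 ^ e) w
  AtMostDivisors-rough e {Y} {w} 0<w rough w< with factorise w {{>-nonZero 0<w}}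
  ... | record { factors = [] ; isFactorisation = refl } = AtMostDivisors-mono (m^n>0 2 e) AtMostDivisors-1
  ... | record { factors = p ∷ ps ; isFactorisation = refl ; factorsPrime = pr ∷ prs } = step e w<
    where
    instance _ = prime⇒nonTrivial pr
    w′ = product ps
    0<w′ : 0 < w′
    0<w′ = 0<∣ 0<w (n∣m*n p)
    Y≤p : Y ≤ p
    Y≤p = rough⇒≤ (rough∧∣⇒rough rough (m∣m*n w′))
    step : ∀ e → p * w′ < Y ^ suc e → AtMostDivisors (2 ^ e) (p * w′)
    step zero    h = ⊥-elim (<⇒≱ h (≤-trans (≤-reflexive (*-identityʳ Y)) (≤-trans Y≤p (m≤m*n p w′ {{>-nonZero 0<w′}}))))
    step (suc e) h = subst (λ T → AtMostDivisors T (p * w′)) (cong (2 ^ e +_) (sym (+-identityʳ (2 ^ e))))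
      (AtMostDivisors-split p (∣p*w w′ pr) rec rec)
      where
      rec : AtMostDivisors (2 ^ e) w′
      rec = AtMostDivisors-rough e 0<w′ (rough∧∣⇒rough rough (n∣m*n p))
        (*-cancelˡ-< Y _ _ (≤-<-trans (*-monoˡ-≤ w′ Y≤p) h))

  -- The numbers below Y cost a factor L each; the remaining Y-rough part has at most e prime
  -- factors.
  divisor-bound : ∀ {L Y e w} → 0 < w → w < 2 ^ L → 2 ^ L ≤ Y ^ suc e → AtMostDivisors (L ^ Y * 2 ^ e) w
  divisor-bound {L} {Y} {e} {w} 0<w w< 2^L≤ with remove-small-primes L Y w 0<w w<
  ... | w′ , w′∣w , rough , up = up (AtMostDivisors-rough e (0<∣ 0<w w′∣w) rough
          (<-≤-trans (≤-<-trans (∣⇒≤ {{>-nonZero 0<w}} w′∣w) w<) 2^L≤))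

  -- From Hall's theorem to admissible lengths

  HasMultiples-translate : ∀ {n H m} s → (∀ (i : Fin n) → ℤ.+ suc (toℕ i) ℤ.∣ s) → HasMultiples n H m → HasMultiples n H (m ℤ.+ s)
  HasMultiples-translate {n} {H} {m} s i∣s (a , a∈ , inj , div) = (λ i → a i ℤ.+ s)
    , (λ i → subst (ℤ._≤ a i ℤ.+ s) (lem m (ℤ.+ 1) s) (ℤ.+-monoˡ-≤ s (proj₁ (a∈ i)))
           , subst (a i ℤ.+ s ℤ.≤_) (lem m (ℤ.+ H) s) (ℤ.+-monoˡ-≤ s (proj₂ (a∈ i))))
    , (λ {i} {j} eq → inj (∙-cancelʳ s (a i) (a j) eq))
    , (λ i → ℤ.∣m∣n⇒∣m+n (div i) (i∣s i))
    where
    lem : ∀ m c s → m ℤ.+ c ℤ.+ s ≡ m ℤ.+ s ℤ.+ c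
    lem = solve-ℤ

  module _ (n D T : ℕ) (T*[1+T]*n<D³ : T * suc T * n < D * (D * D))
    (fewDivisors : ∀ w → 0 < w → w ≤ 3 * (n * D) → AtMostDivisors T w) where

    private
      H : ℕ
      H = 3 * (n * D)

      [1,n] : List ℕ
      [1,n] = map suc (upTo n)

      Interval : ℕ → List ℕ
      Interval m = map (λ i → m + suc i) (upTo H)

      ∈-[1,n] : ∀ {s} → s ∈ [1,n] → 1 ≤ s × s ≤ n
      ∈-[1,n] s∈ with ∈-map⁻ suc s∈
      ... | i , i∈ , refl = s≤s z≤n , ∈-upTo⁻ i∈

      ∈-Interval⁻ : ∀ {m y} → y ∈ Interval m → m < y × y ≤ m + H
      ∈-Interval⁻ {m} y∈ with ∈-map⁻ (λ i → m + suc i) y∈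
      ... | i , i∈ , refl = m<m+n m (s≤s z≤n) , +-monoʳ-≤ m (∈-upTo⁻ i∈)

      ∈-Interval⁺ : ∀ {m y} → m < y → y ≤ m + H → y ∈ Interval m
      ∈-Interval⁺ {m} {y} m<y y≤ with m≤n⇒∃[o]m+o≡n m<y
      ... | o , refl = subst (_∈ Interval m) (+-suc m o)
            (∈-map⁺ (λ i → m + suc i) (∈-upTo⁺ (+-cancelˡ-≤ m _ _ (subst (_≤ m + H) (sym (+-suc m o)) y≤))))

      -- A violator would give D³ ≤ T(T + 1)|S| ≤ T(T + 1)n.
      no-violator : ∀ m → ¬ Violator _≟_ _∣?_ (Interval m) [1,n]
      no-violator m (violator S rest S↭ N N-uniq N⊆ closed smaller) = <⇒≱ T*[1+T]*n<D³ (begin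
        D * (D * D)            ≤⟨ violator-size n D T m S N (proj₁ ∘ bounds) (proj₂ ∘ bounds) N-uniq
                                   (proj₁ ∘ inside) (proj₂ ∘ inside)
                                   (λ s∈ m<y y≤ s∣y → closed s∈ (∈-Interval⁺ m<y y≤) s∣y)
                                   (<⇒≤ smaller) (≤-<-trans z≤n smaller)
                                   (λ w 0<w w≤ → ∑-divisors S-uniq (fewDivisors w 0<w w≤)) ⟩
        T * suc T * length S   ≤⟨ *-monoʳ-≤ (T * suc T) ∣S∣≤n ⟩
        T * suc T * n          ∎)
        where
        open ≤-Reasoning
        bounds : ∀ {s} → s ∈ S → 1 ≤ s × s ≤ n
        bounds s∈ = ∈-[1,n] (↭.∈-resp-↭ S↭ (∈-++⁺ˡ s∈))
        inside : ∀ {y} → y ∈ N → m < y × y ≤ m + H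
        inside y∈ = ∈-Interval⁻ (All.lookup N⊆ y∈)
        S-uniq : Unique S
        S-uniq = Unique-++ˡ S (↭ₛ.Unique-resp-↭ (setoid ℕ) (↭⇒↭ₛ (↭-sym S↭)) (Unique.map⁺ suc-injective (Unique.upTo⁺ n)))
        ∣S∣≤n : length S ≤ n
        ∣S∣≤n = begin
          length S               ≤⟨ m≤m+n (length S) (length rest) ⟩
          length S + length rest ≡⟨ sym (length-++ S) ⟩
          length (S ++ rest)     ≡⟨ ↭.↭-length S↭ ⟩
          length [1,n]           ≡⟨ trans (length-map suc (upTo n)) (length-upTo n) ⟩
          n                      ∎

      hasMultiples-+ : ∀ m → HasMultiples n H (ℤ.+ m)
      hasMultiples-+ m with hall _≟_ _∣?_ (Interval m) [1,n]
      ... | inj₂ v = ⊥-elim (no-violator m v)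
      ... | inj₁ (M , perm , uniq , edges) = (λ i → ℤ.+ value i)
          , (λ i → let lo , hi = ∈-Interval⁻ (proj₁ (edge i)) in
               ℤ.+≤+ (subst (_≤ value i) (+-comm 1 m) lo) , ℤ.+≤+ hi)
          -- Right ends of the matching are distinct, so equal values come from the same pair and
          -- hence from the same divisor.
          , (λ {i} {j} e → toℕ-injective (suc-injective
               (trans (proj₂ (proj₂ (pair i))) (trans (cong proj₁ (Unique-map-injective uniq (pair∈ i) (pair∈ j) (ℤ.+-injective e)))
                 (sym (proj₂ (proj₂ (pair j))))))))
          , (λ i → ℤ.∣ᵤ⇒∣ (subst (_∣ value i) (sym (proj₂ (proj₂ (pair i)))) (proj₂ (edge i))))
        where
        pair : ∀ i → ∃[ z ] z ∈ M × suc (toℕ i) ≡ proj₁ z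
        pair i = ∈-map⁻ proj₁ (↭.∈-resp-↭ (↭-sym perm) (∈-map⁺ suc (∈-upTo⁺ (toℕ<n i))))
        value : Fin n → ℕ
        value i = proj₂ (proj₁ (pair i))
        pair∈ : ∀ i → proj₁ (pair i) ∈ M
        pair∈ i = proj₁ (proj₂ (pair i))
        edge : ∀ i → value i ∈ Interval m × proj₁ (proj₁ (pair i)) ∣ value i
        edge i = All.lookup edges (pair∈ i)

    -- Translation by a multiple of n! preserves divisibility by every i ≤ n, so m may be replaced
    -- by its residue modulo n!, which is a natural number.
    admissible : Admissible n (3 * (n * D))
    admissible m = subst (HasMultiples n H) (sym (ℤ.a≡a%ℕn+[a/ℕn]*n m (n !)))
      (HasMultiples-translate {m = ℤ.+ (m ℤ.%ℕ (n !))} ((m ℤ./ℕ (n !)) ℤ.* ℤ.+ (n !))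
        (λ i → ℤ.∣n⇒∣m*n (m ℤ./ℕ (n !)) (ℤ.∣ᵤ⇒∣ (∣-trans (m∣m*n (toℕ i !)) (m≤n⇒m!∣n! (toℕ<n i)))))
        (hasMultiples-+ (m ℤ.%ℕ (n !))))
      where
      instance _ = n !≢0

  -- The choice of the parameters

  -- Induction on X inverts f up to rounding; this provides integer cube roots and integer
  -- logarithms to the bases 2 and 4.
  bracket : ∀ (f : ℕ → ℕ) → (∀ d → f d < f (suc d)) → ∀ X → f 0 ≤ X → ∃[ d ] f d ≤ X × X < f (suc d)
  bracket f incr X f0≤X with m≤n⇒m<n∨m≡n f0≤X
  ... | inj₂ refl = 0 , ≤-refl , incr 0
  bracket f incr (suc X) f0≤X | inj₁ (s≤s f0≤) with bracket f incr X f0≤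
  ... | d , lo , hi with m≤n⇒m<n∨m≡n hi
  ...   | inj₁ h  = d , m≤n⇒m≤1+n lo , h
  ...   | inj₂ eq = suc d , ≤-reflexive (sym eq) , subst (_< f (suc (suc d))) (sym eq) (incr (suc d))

  cube : ℕ → ℕ
  cube d = d * (d * d)

  cube-mono-≤ : ∀ {a b} → a ≤ b → cube a ≤ cube b
  cube-mono-≤ h = *-mono-≤ h (*-mono-≤ h h)

  cube-mono-< : ∀ {a b} → a < b → cube a < cube b
  cube-mono-< h = *-mono-< h (*-mono-< h h)

  cube-cancel-< : ∀ {a b} → cube a < cube b → a < b
  cube-cancel-< h = ≰⇒> λ b≤a → <⇒≱ h (cube-mono-≤ b≤a)

  -- If c ≥ 1 is the integer cube root of X, take D = c + 1 ≤ 2c.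
  cube-above : ∀ X → 0 < X → ∃[ D ] X < cube D × cube D ≤ 8 * X
  cube-above X 0<X with bracket cube (λ d → cube-mono-< (n<1+n d)) X z≤n
  ... | zero  , lo , hi = ⊥-elim (<⇒≱ hi 0<X)
  ... | suc d , lo , hi = suc (suc d) , hi , ≤-trans (cube-mono-≤ {suc (suc d)} {2 * suc d} (s≤s (subst (suc d ≤_) (lem d) (s≤s (m≤n+m d d)))))
          (≤-trans (≤-reflexive (lem₂ (suc d))) (*-monoʳ-≤ 8 lo))
    where
    lem : ∀ d → 1 + (d + d) ≡ d + (1 + (d + 0))
    lem = solve-∀
    lem₂ : ∀ d → 2 * d * (2 * d * (2 * d)) ≡ 8 * (d * (d * d))
    lem₂ = solve-∀

  1+n≤2^n : ∀ n → suc n ≤ 2 ^ n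
  1+n≤2^n zero    = s≤s z≤n
  1+n≤2^n (suc n) = ≤-trans (+-mono-≤ (m^n>0 2 n) (1+n≤2^n n)) (≤-reflexive (cong (2 ^ n +_) (sym (+-identityʳ (2 ^ n)))))

  -- Multiplied by 2^β, this makes β times the small-prime part of the exponent `t` at most 16·4^β ≤
  -- 16ℓ. In the induction the left side grows by 4β + 9 ≤ 16(β + 1).
  [2β+7]β≤16*2^β : ∀ β → (2 * β + 7) * β ≤ 16 * 2 ^ β
  [2β+7]β≤16*2^β zero    = z≤n
  [2β+7]β≤16*2^β (suc β) = begin
    (2 * suc β + 7) * suc β                        ≡⟨ lem β ⟩
    (2 * β + 7) * β + (4 * β + 9)                  ≤⟨ +-mono-≤ ([2β+7]β≤16*2^β β) (≤-trans (m≤m+n _ (12 * β + 7)) (≤-trans (≤-reflexive (lem₂ β)) (*-monoʳ-≤ 16 (1+n≤2^n β)))) ⟩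
    16 * 2 ^ β + 16 * 2 ^ β                        ≡⟨ lem₃ (2 ^ β) ⟩
    16 * 2 ^ suc β                                 ∎
    where
    open ≤-Reasoning
    lem : ∀ β → (2 * (1 + β) + 7) * (1 + β) ≡ (2 * β + 7) * β + (4 * β + 9)
    lem = solve-∀
    lem₂ : ∀ β → 4 * β + 9 + (12 * β + 7) ≡ 16 * (1 + β)
    lem₂ = solve-∀
    lem₃ : ∀ x → 16 * x + 16 * x ≡ 16 * (2 * x)
    lem₃ = solve-∀

  module _ {n ℓ β : ℕ} (2^ℓ≤n : 2 ^ ℓ ≤ n) (n<2^[1+ℓ] : n < 2 ^ suc ℓ)
    (4^β≤ℓ : 4 ^ β ≤ ℓ) (ℓ<4^[1+β] : ℓ < 4 ^ suc β) (2≤β : 2 ≤ β) where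

    private
      instance
        β≢0 : NonZero β
        β≢0 = >-nonZero (≤-trans (s≤s z≤n) 2≤β)

      -- 2^L exceeds the length of the interval, and the primes below 2^β ≤ √ℓ are
      -- treated separately from the larger ones.
      L e t : ℕ
      L = 32 * ℓ
      e = L / β
      t = (2 * β + 7) * 2 ^ β + e

      2^2m≡4^m : ∀ m → 2 ^ (2 * m) ≡ 4 ^ m
      2^2m≡4^m m = sym (^-*-assoc 2 2 m)

      2^-square : ∀ β → 2 ^ β * 2 ^ β ≡ 4 ^ β
      2^-square β = trans (sym (^-distribˡ-+-* 2 β β)) (trans (cong (λ z → 2 ^ (β + z)) (sym (+-identityʳ β))) (2^2m≡4^m β))

      β≤ℓ : β ≤ ℓ
      β≤ℓ = ≤-trans (≤-trans (n≤1+n β) (1+n≤2^n β)) (≤-trans (^-monoˡ-≤ β {2} {4} (s≤s (s≤s z≤n))) 4^β≤ℓ)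

      -- The small primes contribute 16ℓ and the large ones eβ ≤ 32ℓ. As ℓ and β have the orders of
      -- log n and log log n, this is t = O(log n / log log n).
      t*β≤48*ℓ : t * β ≤ 48 * ℓ
      t*β≤48*ℓ = begin
        ((2 * β + 7) * 2 ^ β + e) * β                ≡⟨ lem (2 * β + 7) (2 ^ β) e β ⟩
        (2 * β + 7) * β * 2 ^ β + e * β              ≤⟨ +-mono-≤ (*-monoˡ-≤ (2 ^ β) ([2β+7]β≤16*2^β β)) (m/n*n≤m L β) ⟩
        16 * 2 ^ β * 2 ^ β + 32 * ℓ                  ≡⟨ cong (_+ 32 * ℓ) (trans (*-assoc 16 (2 ^ β) (2 ^ β)) (cong (16 *_) (2^-square β))) ⟩
        16 * 4 ^ β + 32 * ℓ                          ≤⟨ +-monoˡ-≤ (32 * ℓ) (*-monoʳ-≤ 16 4^β≤ℓ) ⟩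
        16 * ℓ + 32 * ℓ                              ≡⟨ sym (*-distribʳ-+ ℓ 16 32) ⟩
        48 * ℓ                                       ∎
        where
        open ≤-Reasoning
        lem : ∀ a b e β → (a * b + e) * β ≡ a * β * b + e * β
        lem = solve-∀

      2*t≤48*ℓ : 2 * t ≤ 48 * ℓ
      2*t≤48*ℓ = ≤-trans (*-monoˡ-≤ t 2≤β) (≤-trans (≤-reflexive (*-comm β t)) t*β≤48*ℓ)

      L≤ : L ≤ 2 ^ (2 * β + 7)
      L≤ = begin
        32 * ℓ                     ≤⟨ *-monoʳ-≤ 32 (<⇒≤ ℓ<4^[1+β]) ⟩
        2 ^ 5 * 4 ^ suc β          ≡⟨ cong (2 ^ 5 *_) (sym (2^2m≡4^m (suc β))) ⟩
        2 ^ 5 * 2 ^ (2 * suc β)    ≡⟨ sym (^-distribˡ-+-* 2 5 (2 * suc β)) ⟩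
        2 ^ (5 + 2 * suc β)        ≡⟨ cong (2 ^_) (lem β) ⟩
        2 ^ (2 * β + 7)            ∎
        where
        open ≤-Reasoning
        lem : ∀ β → 5 + 2 * (1 + β) ≡ 2 * β + 7
        lem = solve-∀

      -- The summands of `t` are the binary exponents of the two factors: 2^β copies of L ≤
      -- 2^(2β+7), and 2^e.
      L^Y*2^e≤2^t : L ^ (2 ^ β) * 2 ^ e ≤ 2 ^ t
      L^Y*2^e≤2^t = begin
        L ^ (2 ^ β) * 2 ^ e                    ≤⟨ *-monoˡ-≤ (2 ^ e) (^-monoˡ-≤ (2 ^ β) L≤) ⟩
        (2 ^ (2 * β + 7)) ^ (2 ^ β) * 2 ^ e    ≡⟨ cong (_* 2 ^ e) (^-*-assoc 2 (2 * β + 7) (2 ^ β)) ⟩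
        2 ^ ((2 * β + 7) * 2 ^ β) * 2 ^ e      ≡⟨ sym (^-distribˡ-+-* 2 ((2 * β + 7) * 2 ^ β) e) ⟩
        2 ^ t                                  ∎
        where open ≤-Reasoning

      2^L≤ : 2 ^ L ≤ (2 ^ β) ^ suc e
      2^L≤ = begin
        2 ^ L              ≤⟨ ^-monoʳ-≤ 2 (<⇒≤ (subst₂ _<_ (sym (m≡m%n+[m/n]*n L β)) (*-comm (suc e) β) (+-monoˡ-< (e * β) (m%n<n L β)))) ⟩
        2 ^ (β * suc e)    ≡⟨ sym (^-*-assoc 2 β (suc e)) ⟩
        (2 ^ β) ^ suc e    ∎
        where open ≤-Reasoning

      T : ℕ
      T = 2 ^ t

      0<n : 0 < n
      0<n = ≤-trans (m^n>0 2 ℓ) 2^ℓ≤n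

      -- Since T ≥ 1, T(T + 1)n ≤ 2T²n, so D³ > X rules out violators.
      X : ℕ
      X = 2 * (T * T) * n

      0<X : 0 < X
      0<X = *-mono-< {0} {_} {0} (*-mono-< {0} {2} {0} (s≤s z≤n) (*-mono-< {0} {_} {0} (m^n>0 2 t) (m^n>0 2 t))) 0<n

      D : ℕ
      D = proj₁ (cube-above X 0<X)

      X<cube : X < cube D
      X<cube = proj₁ (proj₂ (cube-above X 0<X))

      cube≤8X : cube D ≤ 8 * X
      cube≤8X = proj₂ (proj₂ (cube-above X 0<X))

      H G n⁴ : ℕ
      H = 3 * (n * D)
      G = 2 ^ (t + 3)
      n⁴ = (n * n) * (n * n)

      -- With 27·8·2 = 432 ≤ 8³ and T² ≤ T³, all constants are absorbed into G = 8T.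
      cube-H : cube H ≤ cube G * n⁴
      cube-H = begin
        cube H                                     ≡⟨ lem₁ n D ⟩
        27 * cube n * cube D                       ≤⟨ *-monoʳ-≤ (27 * cube n) cube≤8X ⟩
        27 * cube n * (8 * X)                      ≡⟨ lem₂ n T ⟩
        432 * (T * T) * n⁴                         ≤⟨ *-monoˡ-≤ n⁴ (*-mono-≤ {432} {512} (m≤n+m 432 80) (m≤m*n (T * T) T {{>-nonZero (m^n>0 2 t)}})) ⟩
        512 * (T * T * T) * n⁴                     ≡⟨ cong (_* n⁴) (lem₃ T) ⟩
        cube (T * 8) * n⁴                          ≡⟨ cong (λ g → cube g * n⁴) (sym (^-distribˡ-+-* 2 t 3)) ⟩
        cube G * n⁴                                ∎
        where
        open ≤-Reasoning
        lem₁ : ∀ n D → 3 * (n * D) * (3 * (n * D) * (3 * (n * D))) ≡ 27 * (n * (n * n)) * (D * (D * D))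
        lem₁ = solve-∀
        lem₂ : ∀ n T → 27 * (n * (n * n)) * (8 * (2 * (T * T) * n)) ≡ 432 * (T * T) * ((n * n) * (n * n))
        lem₂ = solve-∀
        lem₃ : ∀ T → 512 * (T * T * T) ≡ T * 8 * (T * 8 * (T * 8))
        lem₃ = solve-∀

      -- This closes the circle: T must bound divisor counts up to H, while H depends on T. The cube
      -- of H has binary exponent below 3t + 4ℓ + 13 ≤ 96ℓ = 3L, which is why L = 32ℓ was taken.
      H<2^L : H < 2 ^ L
      H<2^L = cube-cancel-< (begin-strict
        cube H                                     ≤⟨ cube-H ⟩
        cube G * n⁴                                <⟨ *-monoʳ-< (cube G) {{>-nonZero (*-mono-< {0} {_} {0} (m^n>0 2 (t + 3)) (*-mono-< {0} {_} {0} (m^n>0 2 (t + 3)) (m^n>0 2 (t + 3))))}}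
                                                       (*-mono-< (*-mono-< n<2^[1+ℓ] n<2^[1+ℓ]) (*-mono-< n<2^[1+ℓ] n<2^[1+ℓ])) ⟩
        cube G * ((N * N) * (N * N))               ≡⟨ cong₂ _*_ (trans (cong (G *_) (sq (t + 3))) (sym (^-distribˡ-+-* 2 (t + 3) _)))
                                                       (trans (cong₂ _*_ (sq (suc ℓ)) (sq (suc ℓ))) (sq (suc ℓ + suc ℓ))) ⟩
        2 ^ (t + 3 + (t + 3 + (t + 3))) * 2 ^ (suc ℓ + suc ℓ + (suc ℓ + suc ℓ))
                                                   ≡⟨ sym (^-distribˡ-+-* 2 (t + 3 + (t + 3 + (t + 3))) _) ⟩
        2 ^ (t + 3 + (t + 3 + (t + 3)) + (suc ℓ + suc ℓ + (suc ℓ + suc ℓ)))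
                                                   ≤⟨ ^-monoʳ-≤ 2 exponent ⟩
        2 ^ (L + (L + L))                          ≡⟨ trans (^-distribˡ-+-* 2 L (L + L)) (cong (2 ^ L *_) (^-distribˡ-+-* 2 L L)) ⟩
        cube (2 ^ L)                               ∎)
        where
        open ≤-Reasoning
        N = 2 ^ suc ℓ
        sq : ∀ a → 2 ^ a * 2 ^ a ≡ 2 ^ (a + a)
        sq a = sym (^-distribˡ-+-* 2 a a)
        lem : ∀ t ℓ → t + 3 + (t + 3 + (t + 3)) + (1 + ℓ + (1 + ℓ) + (1 + ℓ + (1 + ℓ))) ≡ 2 * t + t + 4 * ℓ + 13
        lem = solve-∀
        lem₂ : ∀ ℓ → 48 * ℓ + 24 * ℓ + 4 * ℓ + 20 * ℓ ≡ 32 * ℓ + (32 * ℓ + 32 * ℓ)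
        lem₂ = solve-∀
        exponent : t + 3 + (t + 3 + (t + 3)) + (suc ℓ + suc ℓ + (suc ℓ + suc ℓ)) ≤ L + (L + L)
        exponent = ≤-trans (≤-reflexive (lem t ℓ)) (≤-trans
          (+-mono-≤ (+-monoˡ-≤ (4 * ℓ) (+-mono-≤ 2*t≤48*ℓ (*-cancelˡ-≤ 2 (≤-trans 2*t≤48*ℓ (≤-reflexive (*-assoc 2 24 ℓ))))))
            (≤-trans (m≤m+n 13 7) (*-monoʳ-≤ 20 (≤-trans (≤-trans (s≤s z≤n) 2≤β) β≤ℓ))))
          (≤-reflexive (lem₂ ℓ)))

      fewDivisors : ∀ w → 0 < w → w ≤ H → AtMostDivisors T w
      fewDivisors w 0<w w≤H = AtMostDivisors-mono L^Y*2^e≤2^t (divisor-bound {L} {2 ^ β} {e} 0<w (≤-<-trans w≤H H<2^L) 2^L≤)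

      T*[1+T]*n<D³ : T * suc T * n < D * (D * D)
      T*[1+T]*n<D³ = ≤-<-trans (*-monoˡ-≤ n (≤-trans (≤-reflexive (*-suc T T)) (≤-trans (+-monoˡ-≤ (T * T) (m≤m*n T T {{>-nonZero (m^n>0 2 t)}}))
        (≤-reflexive (cong (T * T +_) (sym (+-identityʳ (T * T)))))))) X<cube

      0<H : 0 < H
      0<H = *-mono-< {0} {3} {0} (s≤s z≤n) (*-mono-< {0} {_} {0} 0<n (0<D D (≤-<-trans z≤n X<cube)))
        where
        0<D : ∀ D → 0 < cube D → 0 < D
        0<D (suc _) _ = s≤s z≤n

    -- Take g = t + 3; then gβ ≤ 48ℓ + 3ℓ because β ≤ ℓ. Cubing expresses the exponent 4/3 within
    -- the natural numbers.
    F-bound : ∃[ g ] g * β ≤ 51 * ℓ × cube (F n) ≤ cube (2 ^ g) * ((n * n) * (n * n))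
    F-bound = t + 3
      , ≤-trans (≤-reflexive (*-distribʳ-+ β t 3)) (≤-trans (+-mono-≤ t*β≤48*ℓ (*-monoʳ-≤ 3 β≤ℓ)) (≤-reflexive (sym (*-distribʳ-+ ℓ 48 3))))
      , ≤-trans (cube-mono-≤ (proj₂ (proj₂ (F-isLeast n)) H 0<H (admissible n D T T*[1+T]*n<D³ fewDivisors))) cube-H

  -- From n ≥ 2^16 follows ℓ ≥ 16 = 4², and hence β ≥ 2.
  scales : ∀ n → 2 ^ 16 ≤ n → ∃[ ℓ ] ∃[ β ] 2 ^ ℓ ≤ n × n < 2 ^ suc ℓ × 4 ^ β ≤ ℓ × ℓ < 4 ^ suc β × 2 ≤ β
  scales n 2^16≤n with bracket (2 ^_) (λ d → ^-monoʳ-< 2 (s≤s (s≤s z≤n)) (n<1+n d)) n (≤-trans (s≤s z≤n) 2^16≤n)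
  ... | ℓ , lo , hi with bracket (4 ^_) (λ d → ^-monoʳ-< 4 (s≤s (s≤s z≤n)) (n<1+n d)) ℓ (≤-trans (s≤s z≤n) 16≤ℓ)
    where
    16≤ℓ : 16 ≤ ℓ
    16≤ℓ = ≤-pred (2^-cancel-< (≤-<-trans 2^16≤n hi))
  ...   | β , lo′ , hi′ = ℓ , β , lo , hi , lo′ , hi′
          , ≮⇒≥ λ β<2 → <⇒≱ hi′ (≤-trans (^-monoʳ-≤ 4 β<2) (≤-pred (2^-cancel-< {16} (≤-<-trans 2^16≤n hi))))

-- Transfer of the integer bound to the approximants of exp and log

module Analysis where

  open import Data.Rational.Properties
  open import Defs
  open import Algebra.Bundles using (CommutativeRing)
  open import Algebra.Properties.CommutativeSemiring.Exp (CommutativeRing.commutativeSemiring +-*-commutativeRing)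
  open import Data.Integer using (+_)
  open import Data.Nat as ℕ using (ℕ; zero; suc; z≤n; s≤s)
  import Data.Nat.DivMod as ℕ
  import Data.Nat.Properties as ℕ
  open import Data.Nat.Tactic.RingSolver using () renaming (solve-∀ to solve-ℕ)
  open import Data.Product using (_,_; proj₁; proj₂)
  open import Data.Rational
  open import Relation.Binary.PropositionalEquality
  open import Tactic.RingSolver using (solve-∀)
  open Arithmetic using (cube; 1+n≤2^n; scales; F-bound)

  2ℚ : ℚ
  2ℚ = 1ℚ + 1ℚ

  ι-2 : ι 2 ≡ 2ℚ
  ι-2 = trans (ι-+ 1 1) (cong₂ _+_ ι1 ι1)

  ι-2^ : ∀ m → ι (2 ℕ.^ m) ≡ 2ℚ ^ m
  ι-2^ zero    = ι1
  ι-2^ (suc m) = trans (ι-* 2 (2 ℕ.^ m)) (cong₂ _*_ ι-2 (ι-2^ m))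

  ι-mono-< : ∀ {m n} → m ℕ.< n → ι m < ι n
  ι-mono-< {m} {n} h = <-≤-trans (<-cert 1ℚ 0<1 (trans (ι-suc m) (+-comm 1ℚ (ι m)))) (ι-mono h)

  ^-monoʳ-≤ : ∀ {a i j} → 1ℚ ≤ a → i ℕ.≤ j → a ^ i ≤ a ^ j
  ^-monoʳ-≤ {a} {i} 1≤a i≤j = go (ℕ.≤⇒≤′ i≤j)
    where
    go : ∀ {j} → i ℕ.≤′ j → a ^ i ≤ a ^ j
    go ℕ.≤′-refl               = ≤-refl
    go (ℕ.≤′-step {n = j} i≤j) = ≤-trans (go i≤j) (^≤^suc j 1≤a)

  -- Let N = k + 1 and let q be N / m rounded down. By Bernoulli (1 + z/N)^q ≥ 1 + qz/N ≥ 2, since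
  -- 2mq ≥ N; raising this to the power m uses exponent qm ≤ N.
  2^m≤E : ∀ {z} k m → m ℕ.≤ suc k → ι (m ℕ.+ m) ≤ z → ι (2 ℕ.^ m) ≤ E k z
  2^m≤E {z} k zero _ 0≤z = subst (_≤ E k z) (sym ι1) (≤-trans (≤-cert z 0≤z′ refl) (E-bernoulli {z} k (0≤1 ⊕ 0≤z′ ⊗ 0≤u k)))
    where
    0≤z′ : 0ℚ ≤ z
    0≤z′ = subst (_≤ z) ι0 0≤z
  2^m≤E {z} k m@(suc _) m≤N 2m≤z = begin
    ι (2 ℕ.^ m)         ≡⟨ ι-2^ m ⟩
    2ℚ ^ m              ≤⟨ ^-mono m (0≤1 ⊕ 0≤1) (≤-trans (+-monoʳ-≤ 1ℚ 1≤q) (bernoulli q (0≤1 ⊕ 0≤zv))) ⟩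
    (base ^ q) ^ m      ≡⟨ ^-assocʳ base q m ⟩
    base ^ (q ℕ.* m)    ≤⟨ ^-monoʳ-≤ (≤-cert (z * u k) 0≤zv refl) (ℕ.m/n*n≤m (suc k) m) ⟩
    E k z               ∎
    where
    open ≤-Reasoning
    q : ℕ
    q = suc k ℕ./ m
    base : ℚ
    base = 1ℚ + z * u k
    0≤zv : 0ℚ ≤ z * u k
    0≤zv = ≤-trans (0≤ι (m ℕ.+ m)) 2m≤z ⊗ 0≤u k
    -- The remainder of N modulo m is at most m ≤ qm, because m ≤ N gives q ≥ 1.
    N≤ : suc k ℕ.≤ q ℕ.* (m ℕ.+ m)
    N≤ = ℕ.≤-trans (ℕ.≤-reflexive (ℕ.m≡m%n+[m/n]*n (suc k) m))
      (ℕ.≤-trans (ℕ.+-monoˡ-≤ (q ℕ.* m) (ℕ.≤-trans (ℕ.<⇒≤ (ℕ.m%n<n (suc k) m)) (ℕ.m≤n*m m q {{ℕ.>-nonZero (ℕ.m≥n⇒m/n>0 m≤N)}})))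
        (ℕ.≤-reflexive (sym (ℕ.*-distribˡ-+ q m m))))
    1≤q : 1ℚ ≤ ι q * (z * u k)
    1≤q = begin
      1ℚ                              ≡⟨ sym (ι*u k) ⟩
      ι (suc k) * u k                 ≤⟨ *-mono-nn (0≤ι (suc k)) (0≤u k) (ι-mono N≤) ≤-refl ⟩
      ι (q ℕ.* (m ℕ.+ m)) * u k       ≡⟨ trans (cong (_* u k) (ι-* q (m ℕ.+ m))) (*-assoc (ι q) (ι (m ℕ.+ m)) (u k)) ⟩
      ι q * (ι (m ℕ.+ m) * u k)       ≤⟨ *-mono-nn (0≤ι q) (0≤ι (m ℕ.+ m) ⊗ 0≤u k) ≤-refl (*-mono-nn (0≤ι (m ℕ.+ m)) (0≤u k) 2m≤z ≤-refl) ⟩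
      ι q * (z * u k)                 ∎

  cubeℚ-cancel-≤ : ∀ {f h} → 0ℚ ≤ h → f * (f * f) ≤ h * (h * h) → f ≤ h
  cubeℚ-cancel-≤ {f} {h} 0≤h f³≤h³ = ≮⇒≥ λ h<f →
    let 0<f = ≤-<-trans 0≤h h<f in
    <-irrefl refl (<-≤-trans (<-cert ((f - h) * (f * f + (f * h + h * h))) (0<* (0<q-p h<f) (+-mono-<-≤ (0<* 0<f 0<f) (<⇒≤ 0<f ⊗ 0≤h ⊕ 0≤h ⊗ 0≤h))) (lem f h)) f³≤h³)
    where
    lem : ∀ f h → f * (f * f) ≡ h * (h * h) + (f - h) * (f * f + (f * h + h * h))
    lem = solve-∀ ℚ-ring

  -- The exponent 4/3 at the level of approximants

  4/3ℚ : ℚ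
  4/3ℚ = + 4 / 3

  module _ {r v M : ℚ} (0≤r : 0ℚ ≤ r) (0≤v : 0ℚ ≤ v) (r+v≤M : r + v ≤ M) (1≤M : 1ℚ ≤ M) (11M²v≤1 : + 11 / 1 * (M * M) * v ≤ 1ℚ) where

    private
      -- In the application v = 1/N and r is the approximate logarithm of n. Then Q^N exceeds n, and
      -- P^N is the product of the approximants of exp(4r/3) and of e. The factor 1 + v pays for the
      -- rounding of r to its grid.
      s Q P : ℚ
      s = (r + v) * v
      Q = 1ℚ + s
      P = (1ℚ + 4/3ℚ * r * v) * (1ℚ + 1ℚ * v)

      0≤M : 0ℚ ≤ M
      0≤M = ≤-trans 0≤1 1≤M

      0≤s : 0ℚ ≤ s
      0≤s = (0≤r ⊕ 0≤v) ⊗ 0≤v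

      c : ∀ q .{{_ : NonNegative q}} → 0ℚ ≤ q
      c q = nonNegative⁻¹ q

      11v≤1 : + 11 / 1 * v ≤ 1ℚ
      11v≤1 = ≤-cert ((1ℚ - + 11 / 1 * (M * M) * v) + + 11 / 1 * ((M - 1ℚ) * (M + 1ℚ)) * v)
        (0≤q-p 11M²v≤1 ⊕ c (+ 11 / 1) ⊗ (0≤q-p 1≤M ⊗ (0≤M ⊕ 0≤1)) ⊗ 0≤v) (lem M v)
        where
        lem : ∀ M v → 1ℚ ≡ + 11 / 1 * v + ((1ℚ - + 11 / 1 * (M * M) * v) + + 11 / 1 * ((M - 1ℚ) * (M + 1ℚ)) * v)
        lem = solve-∀ ℚ-ring

      -- Here s ≤ Mv and 11M²v ≤ 1. The constant 11 = 6 + 4 + 1 collects the terms of degree at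
      -- least 2 of (1 + s)⁴ when s ≤ 1.
      11s²≤v : + 11 / 1 * (s * s) ≤ v
      11s²≤v = ≤-cert (v * (1ℚ - + 11 / 1 * (M * M) * v) + + 11 / 1 * ((M - (r + v)) * (M + (r + v))) * (v * v))
        (0≤v ⊗ 0≤q-p 11M²v≤1 ⊕ c (+ 11 / 1) ⊗ (0≤q-p r+v≤M ⊗ (0≤M ⊕ (0≤r ⊕ 0≤v))) ⊗ (0≤v ⊗ 0≤v)) (lem M v (r + v))
        where
        lem : ∀ M v y → v ≡ + 11 / 1 * (y * v * (y * v)) + (v * (1ℚ - + 11 / 1 * (M * M) * v) + + 11 / 1 * ((M - y) * (M + y)) * (v * v))
        lem = solve-∀ ℚ-ring

      s≤1 : s ≤ 1ℚ
      s≤1 = ≤-cert ((1ℚ - + 11 / 1 * (M * M) * v) + + 10 / 1 * (M * M) * v + (M * (M - 1ℚ)) * v + (M - (r + v)) * v)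
        (0≤q-p 11M²v≤1 ⊕ c (+ 10 / 1) ⊗ (0≤M ⊗ 0≤M) ⊗ 0≤v ⊕ 0≤M ⊗ 0≤q-p 1≤M ⊗ 0≤v ⊕ 0≤q-p r+v≤M ⊗ 0≤v) (lem M v (r + v))
        where
        lem : ∀ M v y → 1ℚ ≡ y * v + ((1ℚ - + 11 / 1 * (M * M) * v) + + 10 / 1 * (M * M) * v + (M * (M - 1ℚ)) * v + (M - y) * v)
        lem = solve-∀ ℚ-ring

    -- To first order in v the two sides are 1 + 4rv and 1 + (4r + 3)v; the factor
    -- (1 + v)³ pays for the terms of order v².
    quartic≤cubic : Q * Q * (Q * Q) ≤ P * (P * P)
    quartic≤cubic = begin
      Q * Q * (Q * Q)
        ≤⟨ ≤-cert (s * s * ((1ℚ - s) * (+ 5 / 1 + s))) (0≤s ⊗ 0≤s ⊗ (0≤q-p s≤1 ⊗ (c (+ 5 / 1) ⊕ 0≤s))) (lem₁ s) ⟩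
      1ℚ + + 4 / 1 * s + + 11 / 1 * (s * s)
        ≤⟨ ≤-cert ((v - + 11 / 1 * (s * s)) + v * (1ℚ - + 11 / 1 * v) + (v + + 7 / 1 * (v * v)))
            (0≤q-p 11s²≤v ⊕ 0≤v ⊗ 0≤q-p 11v≤1 ⊕ (0≤v ⊕ c (+ 7 / 1) ⊗ (0≤v ⊗ 0≤v))) (lem₂ r v) ⟩
      1ℚ + (+ 4 / 1 * a + + 3 / 1 * v)
        ≤⟨ ≤-cert (+ 4 / 1 * a * v + + 3 / 1 * (x * x) + x * (x * x))
            (c (+ 4 / 1) ⊗ 0≤a ⊗ 0≤v ⊕ c (+ 3 / 1) ⊗ (0≤x ⊗ 0≤x) ⊕ 0≤x ⊗ (0≤x ⊗ 0≤x)) (lem₃ r v) ⟩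
      P * (P * P) ∎
      where
      open ≤-Reasoning
      a x : ℚ
      a = r * v
      x = 4/3ℚ * a + v + 4/3ℚ * a * v
      0≤a : 0ℚ ≤ a
      0≤a = 0≤r ⊗ 0≤v
      0≤x : 0ℚ ≤ x
      0≤x = c 4/3ℚ ⊗ 0≤a ⊕ 0≤v ⊕ c 4/3ℚ ⊗ 0≤a ⊗ 0≤v
      lem₁ : ∀ s → 1ℚ + + 4 / 1 * s + + 11 / 1 * (s * s) ≡ (1ℚ + s) * (1ℚ + s) * ((1ℚ + s) * (1ℚ + s)) + s * s * ((1ℚ - s) * (+ 5 / 1 + s))
      lem₁ = solve-∀ ℚ-ring
      lem₂ : ∀ r v → 1ℚ + (+ 4 / 1 * (r * v) + + 3 / 1 * v) ≡ 1ℚ + + 4 / 1 * ((r + v) * v) + + 11 / 1 * ((r + v) * v * ((r + v) * v))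
        + ((v - + 11 / 1 * ((r + v) * v * ((r + v) * v))) + v * (1ℚ - + 11 / 1 * v) + (v + + 7 / 1 * (v * v)))
      lem₂ = solve-∀ ℚ-ring
      lem₃ : ∀ r v → (1ℚ + + 4 / 3 * r * v) * (1ℚ + 1ℚ * v) * ((1ℚ + + 4 / 3 * r * v) * (1ℚ + 1ℚ * v) * ((1ℚ + + 4 / 3 * r * v) * (1ℚ + 1ℚ * v)))
        ≡ 1ℚ + (+ 4 / 1 * (r * v) + + 3 / 1 * v)
         + (+ 4 / 1 * (r * v) * v + + 3 / 1 * ((+ 4 / 3 * (r * v) + v + + 4 / 3 * (r * v) * v) * (+ 4 / 3 * (r * v) + v + + 4 / 3 * (r * v) * v))
           + (+ 4 / 3 * (r * v) + v + + 4 / 3 * (r * v) * v) * ((+ 4 / 3 * (r * v) + v + + 4 / 3 * (r * v) * v) * (+ 4 / 3 * (r * v) + v + + 4 / 3 * (r * v) * v)))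
      lem₃ = solve-∀ ℚ-ring

    0≤Q : 0ℚ ≤ Q
    0≤Q = 0≤1 ⊕ 0≤s

  -- Approximate log n and log log n against ℓ and β

  module _ {n ℓ β : ℕ} (2^ℓ≤n : 2 ℕ.^ ℓ ℕ.≤ n) (n<2^[1+ℓ] : n ℕ.< 2 ℕ.^ suc ℓ)
    (4^β≤ℓ : 4 ℕ.^ β ℕ.≤ ℓ) (ℓ<4^[1+β] : ℓ ℕ.< 4 ℕ.^ suc β) (2≤β : 2 ℕ.≤ β) where

    -- The bound for r + v: r is at most 2(ℓ + 1) and v at most 1.
    M : ℕ
    M = suc (suc ℓ ℕ.+ suc ℓ)

    module _ {k} (1+ℓ≤k : suc ℓ ℕ.≤ suc k) (2β+4≤k : 2 ℕ.* β ℕ.+ 4 ℕ.≤ suc k) (v-small : + 11 / 1 * (ι M * ι M) * u k ≤ 1ℚ) where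

      private
        r R v : ℚ
        r = logApprox k (ι n)
        R = logApprox k r
        v = u k

      -- A larger r would give n ≥ E(r) ≥ 2^(ℓ+1), by the crude comparison 2^m ≤ exp(2m).
      r≤ : r ≤ ι (suc ℓ ℕ.+ suc ℓ)
      r≤ = ≮⇒≥ λ a<r → <-irrefl refl (begin-strict
        ι (2 ℕ.^ suc ℓ)            ≤⟨ 2^m≤E k (suc ℓ) 1+ℓ≤k ≤-refl ⟩
        E k (ι (suc ℓ ℕ.+ suc ℓ))  ≤⟨ E-mono {ι (suc ℓ ℕ.+ suc ℓ)} {r} k (0≤1 ⊕ 0≤ι (suc ℓ ℕ.+ suc ℓ) ⊗ 0≤u k) (<⇒≤ a<r) ⟩
        E k r                      ≤⟨ proj₁ (log-spec k (0≤ι n)) ⟩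
        ι n                        <⟨ ι-mono-< n<2^[1+ℓ] ⟩
        ι (2 ℕ.^ suc ℓ)            ∎)
        where open ≤-Reasoning

      -- With b = ℓ / 4 rounded down, E(b + 1) ≤ 2^(2b+3) ≤ 2^ℓ ≤ n < E(r + v), so b + 1 ≤ r + v. As
      -- v ≤ 1 this leaves b ≤ r, and ℓ ≤ 4 + 4b ≤ 8b.
      ℓ≤8r : ι ℓ ≤ ι 8 * r
      ℓ≤8r = begin
        ι ℓ             ≤⟨ ι-mono ℓ≤8b ⟩
        ι (8 ℕ.* b)     ≡⟨ ι-* 8 b ⟩
        ι 8 * ι b       ≤⟨ *-mono-nn (0≤ι 8) (0≤ι b) ≤-refl b≤r ⟩
        ι 8 * r         ∎
        where
        open ≤-Reasoning
        b : ℕ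
        b = ℓ ℕ./ 4
        16≤ℓ : 16 ℕ.≤ ℓ
        16≤ℓ = ℕ.≤-trans (ℕ.^-monoʳ-≤ 4 2≤β) 4^β≤ℓ
        4≤b : 4 ℕ.≤ b
        4≤b = ℕ./-monoˡ-≤ 4 16≤ℓ
        ℓ≤8b : ℓ ℕ.≤ 8 ℕ.* b
        ℓ≤8b = ℕ.≤-trans (ℕ.≤-reflexive (ℕ.m≡m%n+[m/n]*n ℓ 4))
          (ℕ.≤-trans (ℕ.+-monoˡ-≤ (b ℕ.* 4) (ℕ.≤-trans (ℕ.<⇒≤ (ℕ.m%n<n ℓ 4)) (ℕ.≤-trans 4≤b (ℕ.m≤n*m b 4))))
            (ℕ.≤-reflexive (lem b)))
          where
          lem : ∀ b → 4 ℕ.* b ℕ.+ b ℕ.* 4 ≡ 8 ℕ.* b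
          lem = solve-ℕ
        2B+1≤ℓ : suc (2 ℕ.* suc b) ℕ.≤ ℓ
        2B+1≤ℓ = ℕ.≤-trans (ℕ.≤-reflexive (lem b)) (ℕ.≤-trans (ℕ.+-monoʳ-≤ (2 ℕ.* b) (ℕ.≤-trans (ℕ.≤-trans (s≤s (s≤s (s≤s z≤n))) 4≤b) (ℕ.m≤n*m b 2)))
          (ℕ.≤-trans (ℕ.≤-reflexive (lem₂ b)) (ℕ.m/n*n≤m ℓ 4)))
          where
          lem : ∀ b → 1 ℕ.+ 2 ℕ.* (1 ℕ.+ b) ≡ 2 ℕ.* b ℕ.+ 3
          lem = solve-ℕ
          lem₂ : ∀ b → 2 ℕ.* b ℕ.+ 2 ℕ.* b ≡ b ℕ.* 4
          lem₂ = solve-ℕ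
        B≤k : suc b ℕ.≤ suc k
        B≤k = ℕ.≤-trans (s≤s (ℕ.m/n≤m ℓ 4)) 1+ℓ≤k
        B≤r+v : ι (suc b) ≤ r + v
        B≤r+v = ≮⇒≥ λ r+v<B → <-irrefl refl (begin-strict
          ι n                             <⟨ proj₂ (log-spec k (0≤ι n)) ⟩
          E k (r + v)                     ≤⟨ E-mono {r + v} {ι (suc b)} k (log-pos₂ k (ι n)) (<⇒≤ r+v<B) ⟩
          E k (ι (suc b))                 ≤⟨ E≤K {suc b} {ι (suc b)} k (Bd-top (suc b)) B≤k ⟩
          K (suc b)                       ≡⟨ sym (ι-2^ (suc (2 ℕ.* suc b))) ⟩
          ι (2 ℕ.^ suc (2 ℕ.* suc b))     ≤⟨ ι-mono (ℕ.≤-trans (ℕ.^-monoʳ-≤ 2 2B+1≤ℓ) 2^ℓ≤n) ⟩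
          ι n                             ∎)
        b≤r : ι b ≤ r
        b≤r = ≤-cert ((r + v - ι (suc b)) + (1ℚ - v)) (0≤q-p B≤r+v ⊕ 0≤q-p (u≤1 k))
          (trans (lem r v (ι b)) (cong (λ z → ι b + ((r + v - z) + (1ℚ - v))) (sym (ι-suc b))))
          where
          lem : ∀ r v b → r ≡ b + ((r + v - (1ℚ + b)) + (1ℚ - v))
          lem = solve-∀ ℚ-ring

      0≤r : 0ℚ ≤ r
      0≤r = ≮⇒≥ λ r<0 → <-irrefl refl (<-≤-trans (<-cert (ι 8 * (0ℚ - r)) (0<* 0<8 (0<q-p r<0)) (lem (ι 8) r))
        (≤-trans (0≤ι ℓ) ℓ≤8r))
        where
        0<8 : 0ℚ < ι 8
        0<8 = subst (_< ι 8) ι0 (ι-mono-< {0} {8} (s≤s z≤n))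
        lem : ∀ e r → 0ℚ ≡ e * r + e * (0ℚ - r)
        lem = solve-∀ ℚ-ring

      -- As r ≤ 2ℓ + 2 < 2^(2β+4), the same comparison gives R ≤ 2(2β + 4) = 4β + 8, and β ≥ 2.
      R≤8β : R ≤ ι (8 ℕ.* β)
      R≤8β = ≤-trans R≤ (ι-mono (ℕ.≤-trans (ℕ.≤-reflexive (lem β)) (ℕ.≤-trans (ℕ.+-monoʳ-≤ (4 ℕ.* β) (ℕ.*-monoʳ-≤ 4 2≤β)) (ℕ.≤-reflexive (sym (ℕ.*-distribʳ-+ β 4 4))))))
        where
        open ≤-Reasoning
        m : ℕ
        m = 2 ℕ.* β ℕ.+ 4
        lem : ∀ β → 2 ℕ.* β ℕ.+ 4 ℕ.+ (2 ℕ.* β ℕ.+ 4) ≡ 4 ℕ.* β ℕ.+ 8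
        lem = solve-ℕ
        2ℓ+2<2^m : suc ℓ ℕ.+ suc ℓ ℕ.< 2 ℕ.^ m
        2ℓ+2<2^m = ℕ.≤-<-trans (ℕ.+-mono-≤ ℓ<4^[1+β] ℓ<4^[1+β])
          (subst₂ ℕ._<_ (cong (4 ℕ.^ suc β ℕ.+_) (ℕ.+-identityʳ (4 ℕ.^ suc β)))
            (trans (lem₂ (4 ℕ.^ β)) (trans (cong (ℕ._* 16) (ℕ.^-*-assoc 2 2 β)) (sym (ℕ.^-distribˡ-+-* 2 (2 ℕ.* β) 4))))
            (ℕ.*-monoˡ-< (4 ℕ.^ suc β) {{ℕ.>-nonZero (ℕ.m^n>0 4 (suc β))}} {2} {4} (s≤s (s≤s (s≤s z≤n)))))
          where
          lem₂ : ∀ a → 4 ℕ.* (4 ℕ.* a) ≡ a ℕ.* 16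
          lem₂ = solve-ℕ
        R≤ : R ≤ ι (m ℕ.+ m)
        R≤ = ≮⇒≥ λ a<R → <-irrefl refl (begin-strict
          ι (2 ℕ.^ m)          ≤⟨ 2^m≤E k m 2β+4≤k ≤-refl ⟩
          E k (ι (m ℕ.+ m))    ≤⟨ E-mono {ι (m ℕ.+ m)} {R} k (0≤1 ⊕ 0≤ι (m ℕ.+ m) ⊗ 0≤u k) (<⇒≤ a<R) ⟩
          E k R                ≤⟨ proj₁ (log-spec k 0≤r) ⟩
          r                    ≤⟨ r≤ ⟩
          ι (suc ℓ ℕ.+ suc ℓ)  <⟨ ι-mono-< 2ℓ+2<2^m ⟩
          ι (2 ℕ.^ m)          ∎)

      -- The source of the constant 6912: 2(g + 3)R ≤ 16(g + 3)β ≤ 16·54ℓ = 864ℓ ≤ 864·8r. The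
      -- doubling is what `2^m≤E` asks for, and the 3 makes room for the bound W ≤ 2³.
      exponent-large : ∀ {g} → g ℕ.* β ℕ.≤ 51 ℕ.* ℓ → 0ℚ < R →
        ι ((g ℕ.+ 3) ℕ.+ (g ℕ.+ 3)) ≤ ι 6912 * (r * recip R)
      exponent-large {g} gβ≤51ℓ 0<R = begin
        ι G                          ≡⟨ sym (trans (cong (ι G *_) (recip-inverse 0<R)) (*-identityʳ (ι G))) ⟩
        ι G * (R * recip R)          ≡⟨ sym (*-assoc (ι G) R (recip R)) ⟩
        ι G * R * recip R            ≤⟨ *-mono-nn (0≤ι G ⊗ <⇒≤ 0<R) (<⇒≤ (0<recip 0<R)) GR≤ ≤-refl ⟩
        ι 6912 * r * recip R         ≡⟨ *-assoc (ι 6912) r (recip R) ⟩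
        ι 6912 * (r * recip R)       ∎
        where
        open ≤-Reasoning
        G : ℕ
        G = (g ℕ.+ 3) ℕ.+ (g ℕ.+ 3)
        β≤ℓ : β ℕ.≤ ℓ
        β≤ℓ = ℕ.≤-trans (ℕ.≤-trans (ℕ.≤-trans (ℕ.n≤1+n β) (1+n≤2^n β)) (ℕ.^-monoˡ-≤ β {2} {4} (s≤s (s≤s z≤n)))) 4^β≤ℓ
        lem₁ : ∀ g β → (g ℕ.+ 3 ℕ.+ (g ℕ.+ 3)) ℕ.* (8 ℕ.* β) ≡ 16 ℕ.* (g ℕ.* β ℕ.+ 3 ℕ.* β)
        lem₁ = solve-ℕ
        lem₂ : ∀ ℓ → 16 ℕ.* (51 ℕ.* ℓ ℕ.+ 3 ℕ.* ℓ) ≡ 864 ℕ.* ℓ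
        lem₂ = solve-ℕ
        GR≤ : ι G * R ≤ ι 6912 * r
        GR≤ = begin
          ι G * R                ≤⟨ *-mono-nn (0≤ι G) (<⇒≤ 0<R) ≤-refl R≤8β ⟩
          ι G * ι (8 ℕ.* β)      ≡⟨ sym (ι-* G (8 ℕ.* β)) ⟩
          ι (G ℕ.* (8 ℕ.* β))    ≤⟨ ι-mono (ℕ.≤-trans (ℕ.≤-reflexive (lem₁ g β)) (ℕ.≤-trans (ℕ.*-monoʳ-≤ 16 (ℕ.+-mono-≤ gβ≤51ℓ (ℕ.*-monoʳ-≤ 3 β≤ℓ))) (ℕ.≤-reflexive (lem₂ ℓ)))) ⟩
          ι (864 ℕ.* ℓ)          ≡⟨ ι-* 864 ℓ ⟩
          ι 864 * ι ℓ            ≤⟨ *-mono-nn (0≤ι 864) (0≤ι ℓ) ≤-refl ℓ≤8r ⟩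
          ι 864 * (ι 8 * r)      ≡⟨ trans (sym (*-assoc (ι 864) (ι 8) r)) (cong (_* r) (sym (ι-* 864 8))) ⟩
          ι 6912 * r             ∎

      private
        A W : ℚ
        A = E k (4/3ℚ * r)
        W = E k 1ℚ

      0≤A : 0ℚ ≤ A
      0≤A = E-nonNeg {4/3ℚ * r} k (0≤1 ⊕ nonNegative⁻¹ 4/3ℚ ⊗ 0≤r ⊗ 0≤u k)

      W≤8 : W ≤ ι 8
      W≤8 = ≤-trans (E≤K {1} {1ℚ} k (subst (Bd 1) ι1 (Bd-top 1)) (s≤s z≤n)) (≤-reflexive (sym (ι-2^ 3)))

      0≤W : 0ℚ ≤ W
      0≤W = E-nonNeg {1ℚ} k (0≤1 ⊕ 0≤1 ⊗ 0≤u k)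

      -- Raise `quartic≤cubic` to the power N and use n < Q^N.
      n⁴≤ : (ι n * ι n) * (ι n * ι n) ≤ (A * W) * ((A * W) * (A * W))
      n⁴≤ = begin
        (ι n * ι n) * (ι n * ι n)             ≤⟨ *-mono-nn (0≤ι n ⊗ 0≤ι n) (0≤ι n ⊗ 0≤ι n) sq sq ⟩
        (Q ^ N * Q ^ N) * (Q ^ N * Q ^ N)     ≡⟨ sym (trans (^-distrib-* (Q * Q) (Q * Q) N) (cong₂ _*_ (^-distrib-* Q Q N) (^-distrib-* Q Q N))) ⟩
        (Q * Q * (Q * Q)) ^ N                 ≤⟨ ^-mono N (0≤Q′ ⊗ 0≤Q′ ⊗ (0≤Q′ ⊗ 0≤Q′)) (quartic≤cubic 0≤r (0≤u k) r+v≤M 1≤M v-small) ⟩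
        (P * (P * P)) ^ N                     ≡⟨ trans (^-distrib-* P (P * P) N) (cong (P ^ N *_) (^-distrib-* P P N)) ⟩
        P ^ N * (P ^ N * P ^ N)               ≡⟨ cong (λ z → z * (z * z)) (^-distrib-* (1ℚ + 4/3ℚ * r * v) (1ℚ + 1ℚ * v) N) ⟩
        (A * W) * ((A * W) * (A * W))         ∎
        where
        open ≤-Reasoning
        N : ℕ
        N = suc k
        Q P : ℚ
        Q = 1ℚ + (r + v) * v
        P = (1ℚ + 4/3ℚ * r * v) * (1ℚ + 1ℚ * v)
        n≤ : ι n ≤ Q ^ N
        n≤ = <⇒≤ (proj₂ (log-spec k (0≤ι n)))
        sq : ι n * ι n ≤ Q ^ N * Q ^ N
        sq = *-mono-nn (0≤ι n) (0≤ι n) n≤ n≤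
        1≤M : 1ℚ ≤ ι M
        1≤M = subst (_≤ ι M) ι1 (ι-mono {1} {M} (s≤s z≤n))
        r+v≤M : r + v ≤ ι M
        r+v≤M = ≤-trans (+-mono-≤ r≤ (u≤1 k)) (≤-reflexive (trans (+-comm (ι (suc ℓ ℕ.+ suc ℓ)) 1ℚ) (sym (ι-suc (suc ℓ ℕ.+ suc ℓ)))))
        0≤Q′ : 0ℚ ≤ Q
        0≤Q′ = 0≤Q 0≤r (0≤u k) r+v≤M 1≤M v-small

      -- Combining the cubed hypothesis with `n⁴≤` and W ≤ 8 gives f³ ≤ (8·2^g·A)³. Take cube roots
      -- and absorb 8·2^g = 2^(g+3) into the second exponential.
      approximant-bound : ∀ {f g} → g ℕ.* β ℕ.≤ 51 ℕ.* ℓ → g ℕ.+ 3 ℕ.≤ suc k → 0ℚ < R →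
        cube f ℕ.≤ cube (2 ℕ.^ g) ℕ.* ((n ℕ.* n) ℕ.* (n ℕ.* n)) →
        ι f ≤ A * E k (ι 6912 * (r * recip R))
      approximant-bound {f} {g} gβ≤51ℓ g+3≤k 0<R f³≤ = begin
        ι f                                  ≤⟨ cubeℚ-cancel-≤ (0≤A ⊗ (0≤ι 8 ⊗ 0≤ι G)) cubes ⟩
        A * (ι 8 * ι G)                      ≡⟨ cong (A *_) (trans (sym (ι-* 8 G)) (cong ι (trans (ℕ.*-comm 8 G) (sym (ℕ.^-distribˡ-+-* 2 g 3))))) ⟩
        A * ι (2 ℕ.^ (g ℕ.+ 3))              ≤⟨ *-mono-nn 0≤A (0≤ι (2 ℕ.^ (g ℕ.+ 3))) ≤-refl (2^m≤E k (g ℕ.+ 3) g+3≤k (exponent-large {g} gβ≤51ℓ 0<R)) ⟩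
        A * E k (ι 6912 * (r * recip R))     ∎
        where
        open ≤-Reasoning
        G : ℕ
        G = 2 ℕ.^ g
        ι-cube : ∀ a → ι (cube a) ≡ ι a * (ι a * ι a)
        ι-cube a = trans (ι-* a (a ℕ.* a)) (cong (ι a *_) (ι-* a a))
        lem : ∀ g a w → g * (g * g) * ((a * w) * ((a * w) * (a * w))) ≡ (a * (w * g)) * ((a * (w * g)) * (a * (w * g)))
        lem = solve-∀ ℚ-ring
        AW≤ : A * W ≤ A * ι 8
        AW≤ = *-mono-nn 0≤A 0≤W ≤-refl W≤8
        cube-mono : ∀ {a b} → 0ℚ ≤ a → a ≤ b → a * (a * a) ≤ b * (b * b)
        cube-mono 0≤a a≤b = *-mono-nn 0≤a (0≤a ⊗ 0≤a) a≤b (*-mono-nn 0≤a 0≤a a≤b a≤b)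
        cubes : ι f * (ι f * ι f) ≤ (A * (ι 8 * ι G)) * ((A * (ι 8 * ι G)) * (A * (ι 8 * ι G)))
        cubes = begin
          ι f * (ι f * ι f)                                            ≡⟨ sym (ι-cube f) ⟩
          ι (cube f)                                                   ≤⟨ ι-mono f³≤ ⟩
          ι (cube G ℕ.* ((n ℕ.* n) ℕ.* (n ℕ.* n)))                     ≡⟨ trans (ι-* (cube G) _) (cong₂ _*_ (ι-cube G) (trans (ι-* (n ℕ.* n) (n ℕ.* n)) (cong₂ _*_ (ι-* n n) (ι-* n n)))) ⟩
          ι G * (ι G * ι G) * ((ι n * ι n) * (ι n * ι n))              ≤⟨ *-mono-nn (0≤ι G ⊗ (0≤ι G ⊗ 0≤ι G)) (0≤ι n ⊗ 0≤ι n ⊗ (0≤ι n ⊗ 0≤ι n)) ≤-refl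
                                                                            (≤-trans n⁴≤ (cube-mono (0≤A ⊗ 0≤W) AW≤)) ⟩
          ι G * (ι G * ι G) * ((A * ι 8) * ((A * ι 8) * (A * ι 8)))    ≡⟨ lem (ι G) A (ι 8) ⟩
          (A * (ι 8 * ι G)) * ((A * (ι 8 * ι G)) * (A * (ι 8 * ι G)))  ∎

  -- The inequality between real numbers

  0<6912 : 0ℝ <ℝ fromℕ 6912
  0<6912 = 1ℚ , 0<1 , 0 , λ _ _ → subst (_≤ ι 6912) (trans ι1 (sym (+-identityˡ 1ℚ))) (ι-mono {1} {6912} (s≤s z≤n))

  -- For fixed n the inequality holds between the k-th approximants themselves once k is large, so ε
  -- is pure slack.
  F≤n^[4/3]exp : ∀ n (3≤n : 3 ℕ.≤ n) → 2 ℕ.^ 16 ℕ.≤ n → fromℕ (F n) ≤ℝ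
    pow (fromℕ n) (0<n 3≤n) (fromℚ (+ 4 / 3))
    *ℝ exp (fromℕ 6912 *ℝ (logℕ 3≤n ÷ℝ loglogℕ 3≤n [ 0<loglogℕ 3≤n ]))
  F≤n^[4/3]exp n 3≤n 2^16≤n ε 0<ε =
    let ℓ , β , 2^ℓ≤n , n<2^[1+ℓ] , 4^β≤ℓ , ℓ<4^[1+β] , 2≤β = scales n 2^16≤n
        g , gβ≤51ℓ , F³≤ = F-bound 2^ℓ≤n n<2^[1+ℓ] 4^β≤ℓ ℓ<4^[1+β] 2≤β
        M = suc (suc ℓ ℕ.+ suc ℓ)
        -- Beyond `N₁` the approximants of log log n are at least δ, so `recip` never takes its
        -- default value at 0.
        δ , 0<δ , N₁ , R≥δ = 0<loglogℕ 3≤n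
        N₂ , small = archimedean (+ 11 / 1 * (ι M * ι M)) 1ℚ (nonNegative⁻¹ (+ 11 / 1) ⊗ (0≤ι M ⊗ 0≤ι M)) 0<1
        N₃ = ℓ ℕ.⊔ ((2 ℕ.* β ℕ.+ 4) ℕ.⊔ (g ℕ.+ 3))
    in N₁ ℕ.⊔ (N₂ ℕ.⊔ N₃) , λ k hk →
      let k₁ = ℕ.m⊔n≤o⇒m≤o N₁ (N₂ ℕ.⊔ N₃) hk
          k₂₃ = ℕ.m⊔n≤o⇒n≤o N₁ (N₂ ℕ.⊔ N₃) hk
          k₂ = ℕ.m⊔n≤o⇒m≤o N₂ N₃ k₂₃
          k₃ = ℕ.m⊔n≤o⇒n≤o N₂ N₃ k₂₃
          kℓ = ℕ.m⊔n≤o⇒m≤o ℓ ((2 ℕ.* β ℕ.+ 4) ℕ.⊔ (g ℕ.+ 3)) k₃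
          k₄ = ℕ.m⊔n≤o⇒n≤o ℓ ((2 ℕ.* β ℕ.+ 4) ℕ.⊔ (g ℕ.+ 3)) k₃
          kβ = ℕ.m⊔n≤o⇒m≤o (2 ℕ.* β ℕ.+ 4) (g ℕ.+ 3) k₄
          kg = ℕ.m⊔n≤o⇒n≤o (2 ℕ.* β ℕ.+ 4) (g ℕ.+ 3) k₄
      in ≤-trans (approximant-bound 2^ℓ≤n n<2^[1+ℓ] 4^β≤ℓ ℓ<4^[1+β] 2≤β (s≤s kℓ) (ℕ.m≤n⇒m≤1+n kβ) (small k k₂)
                   gβ≤51ℓ (ℕ.m≤n⇒m≤1+n kg) (<-≤-trans 0<δ (subst (_≤ _) (+-identityˡ δ) (R≥δ k k₁))) F³≤)
           (≤-cert ε (<⇒≤ 0<ε) refl)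

open import Defs
open import Data.Nat using (_≤_; _^_)
open import Data.Integer using (+_)
open import Data.Product using (_×_; _,_; ∃-syntax)
open import Data.Rational using (_/_)

theorem1p1 : ∃[ C ] 0ℝ <ℝ C × (∃[ N ] ∀ n (3≤n : 3 ≤ n) → N ≤ n →
    fromℕ (F n) ≤ℝ
    pow (fromℕ n) (0<n 3≤n) (fromℚ (+ 4 / 3))
    *ℝ exp (C *ℝ (logℕ 3≤n ÷ℝ loglogℕ 3≤n [ 0<loglogℕ 3≤n ])))
theorem1p1 = fromℕ 6912 , Analysis.0<6912 , 2 ^ 16 , Analysis.F≤n^[4/3]exp
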